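{- $F_e(3,3;4) \leq 786$. That is, there exists a $K_4$-free simple graph on $786$ vertices such that every $2$-coloring of its edges contains a monochromatic triangle.
   Context: For a simple graph $G$, $G \rightarrow (3,3)$ means that every coloring of the edges of $G$ with two colors yields a triangle ($K_3$) all of whose edges have the same color. The edge Folkman number $F_e(3,3;4)$ is the smallest number of vertices of a graph $G$ that contains no $K_4$ (complete graph on 4 vertices) and satisfies $G \rightarrow (3,3)$. -}

module Defs where

open import Data.Nat using (ℕ)
open import Data.Fin using (Fin; _<_)
open import Data.Bool using (Bool; true; false)
open import Data.Product using (Σ; _×_; ∃-syntax)
open import Relation.Binary.PropositionalEquality using (_≡_)
open import Relation.Nullary using (¬_)

record SimpleGraph (n : ℕ) : Set where
  field
    adj   : Fin n → Fin n → Bool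
    sym   : ∀ i j → adj i j ≡ adj j i
    irrefl : ∀ i → adj i i ≡ false
open SimpleGraph public

Adj : ∀ {n} → SimpleGraph n → Fin n → Fin n → Set
Adj G i j = adj G i j ≡ true

ContainsK4 : ∀ {n} → SimpleGraph n → Set
ContainsK4 {n} G =
  ∃[ a ] ∃[ b ] ∃[ c ] ∃[ d ]
    (a < b × b < c × c < d ×
     Adj G a b × Adj G a c × Adj G a d ×
     Adj G b c × Adj G b d × Adj G c d)

-- A 2-colouring of the edges of G.  The edge {i,j} with i < j receives
-- colour col i j; values of col on non-edges or on pairs with i ≥ j are
-- irrelevant, so such functions correspond exactly to edge colourings.
EdgeColouring : ℕ → Set
EdgeColouring n = Fin n → Fin n → Bool

MonoTriangle : ∀ {n} → SimpleGraph n → EdgeColouring n → Set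
MonoTriangle G col =
  ∃[ a ] ∃[ b ] ∃[ c ] ∃[ k ]
    (a < b × b < c ×
     Adj G a b × Adj G a c × Adj G b c ×
     col a b ≡ k × col a c ≡ k × col b c ≡ k)

Arrows33 : ∀ {n} → SimpleGraph n → Set
Arrows33 {n} G = (col : EdgeColouring n) → MonoTriangle G col

{-# OPTIONS --safe #-}

-- Let L be the circulant graph on ℤ/785 with connection set ⟨53⟩ = -⟨53⟩, and A the adjacency matrix of
-- the relation "in a common triangle" on its edges.  In a colouring without monochromatic triangles,
-- written as x = ±1, the three products of values in a triangle sum to -1, which gives
-- ⟨x , (A + 14) x⟩ = 0.  But A + 14 is positive semidefinite and its kernel consists of functions pulled
-- back from the edges of K₅ by reduction modulo 5.  So the colouring is pulled back from K₅, and one further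
-- vertex, joined to 11 vertices of L, is enough to exclude these colourings.
--
-- On functions that come from K₅, semidefiniteness is the identity A(K₅) + 2 = N Nᵀ with N the incidence
-- matrix.  On their orthogonal complement 2¹⁵² (A + 14) = q(A)² + P(A) for an integer polynomial q, where
-- P(A) is strictly diagonally dominant after subtracting a matrix that vanishes there.  The automorphism
-- group of L is transitive on edges, so it suffices to compute one row of P(A); the powers of A are
-- computed on rows packed into long integers.

module Submission where

open import Defs hiding (sym)

open import Data.Bool.Base using (Bool; true; false; T; not; _∧_; if_then_else_)
open import Data.Bool.ListAction using (all; any)
open import Data.Bool.Properties using (T-∧; T-≡; T?; ∨-zeroʳ; _≟_)
open import Data.Empty using (⊥; ⊥-elim)
open import Data.Fin.Base using (toℕ)
import Data.Fin.Properties as Finₚ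
open import Data.Fin.Properties using (toℕ<n; toℕ-fromℕ<; any?)
open import Data.Integer.Base as ℤ using (ℤ; +_; -[1+_]; -_; 0ℤ; 1ℤ; +≤+)
  renaming (_+_ to _+ᶻ_; _*_ to _*ᶻ_; _-_ to _-ᶻ_; _≤_ to _≤ᶻ_; _<_ to _<ᶻ_)
import Data.Integer.Properties as ℤₚ
import Algebra.Properties.AbelianGroup ℤₚ.+-0-abelianGroup as ℤ-Group
open import Data.Integer.Tactic.RingSolver using (solve-∀)
open import Data.List.Base using (List; []; _∷_; _++_; concat; drop; filterᵇ; foldr; length; map; replicate; take; upTo)
open import Data.List.Membership.Propositional using (_∈_)
open import Data.List.Membership.Propositional.Properties using (∈-filter⁺; ∈-upTo⁺)
open import Data.List.Properties using (drop-map; length-map; map-++; map-cong; map-replicate; map-∘; take-map)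
open import Data.List.Relation.Unary.All as All using (All; []; _∷_)
open import Data.List.Relation.Unary.All.Properties using (all⁺; map⁺; ++⁺)
open import Data.List.Relation.Unary.Any using (here; there)
open import Data.Maybe.Base using (Maybe; just; nothing)
open import Data.Nat.Base as ℕ using (ℕ; zero; suc; NonZero; _+_; _*_; _∸_; _^_; _<_; _≤_; z≤n; s≤s)
open import Data.Nat.DivMod
open import Data.Nat.Divisibility using (divides-refl)
open import Data.Nat.Properties as ℕₚ using (m^n≢0)
import Data.Nat.Tactic.RingSolver as ℕ-Ring
open import Data.Product using (Σ; ∃; _×_; _,_; proj₁; proj₂)
open import Data.Sum.Base using (inj₁; inj₂)
open import Data.Unit.Base using (tt)
open import Function.Base using (_∘_)
open import Function.Bundles using (Equivalence)
open import Relation.Binary.Definitions using (tri<; tri≈; tri>)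
open import Relation.Binary.PropositionalEquality
  using (_≡_; _≢_; refl; sym; trans; cong; cong₂; subst; subst₂; module ≡-Reasoning)
open import Relation.Nullary.Decidable using (Dec; yes; no; _×-dec_; decidable-stable; toWitness)
open import Relation.Nullary.Negation using (¬_; contradiction)

-- Finite sums

-- The circulant graph alone does not arrow: no power of 53 is divisible by 5, so reduction modulo 5
-- maps it to K₅, whose colouring by two complementary 5-cycles has no monochromatic triangle and
-- pulls back. Hence A + 14 cannot be positive definite and no strict eigenvalue bound is available;
-- the kernel has to be split off exactly, and the further vertex must defeat precisely the
-- pulled-back colourings. The identity with q defines P for every polynomial q, so errors of
-- approximation only cost margin. Approximating the root of x + 13.67 rather than x + 14 leaves
-- P(A) near 0.33 · 2¹⁵² times the identity away from K₅, and this is what makes it diagonally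
-- dominant. One row suffices because the oriented edges form a group, the semidirect product of
-- ℤ/785 and ℤ/156. A is a sum of right translations, so its quadratic form is one row paired with
-- the autocorrelation of the field, whose values are at most the squared norm.

∑ : ℕ → (ℕ → ℤ) → ℤ
∑ zero f = 0ℤ
∑ (suc n) f = f 0 +ᶻ ∑ n (f ∘ suc)

∑-cong< : ∀ n {f g : ℕ → ℤ} → (∀ i → i < n → f i ≡ g i) → ∑ n f ≡ ∑ n g
∑-cong< zero eq = refl
∑-cong< (suc n) eq = cong₂ _+ᶻ_ (eq 0 (s≤s z≤n)) (∑-cong< n (λ i i<n → eq (suc i) (s≤s i<n)))

∑-cong : ∀ n {f g : ℕ → ℤ} → (∀ i → f i ≡ g i) → ∑ n f ≡ ∑ n g
∑-cong n eq = ∑-cong< n (λ i _ → eq i)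

interchange : ∀ a b c d → (a +ᶻ b) +ᶻ (c +ᶻ d) ≡ (a +ᶻ c) +ᶻ (b +ᶻ d)
interchange = solve-∀

∑-+ : ∀ n (f g : ℕ → ℤ) → ∑ n (λ i → f i +ᶻ g i) ≡ ∑ n f +ᶻ ∑ n g
∑-+ zero f g = refl
∑-+ (suc n) f g = trans (cong (f 0 +ᶻ g 0 +ᶻ_) (∑-+ n (f ∘ suc) (g ∘ suc))) (interchange (f 0) (g 0) _ _)

∑-*ˡ : ∀ n c (f : ℕ → ℤ) → ∑ n (λ i → c *ᶻ f i) ≡ c *ᶻ ∑ n f
∑-*ˡ zero c f = sym (ℤₚ.*-zeroʳ c)
∑-*ˡ (suc n) c f = trans (cong (c *ᶻ f 0 +ᶻ_) (∑-*ˡ n c (f ∘ suc))) (sym (ℤₚ.*-distribˡ-+ c (f 0) _))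

∑-zero : ∀ n → ∑ n (λ _ → 0ℤ) ≡ 0ℤ
∑-zero zero = refl
∑-zero (suc n) = trans (ℤₚ.+-identityˡ _) (∑-zero n)

∑-const : ∀ n c → ∑ n (λ _ → c) ≡ + n *ᶻ c
∑-const zero c = refl
∑-const (suc n) c = trans (cong (c +ᶻ_) (∑-const n c)) (sym (ℤₚ.suc-* (+ n) c))

∑-swap : ∀ m n (f : ℕ → ℕ → ℤ) → ∑ m (λ i → ∑ n (f i)) ≡ ∑ n (λ j → ∑ m (λ i → f i j))
∑-swap zero n f = sym (∑-zero n)
∑-swap (suc m) n f = trans (cong (∑ n (f 0) +ᶻ_) (∑-swap m n (f ∘ suc))) (sym (∑-+ n (f 0) _))

∑-last : ∀ n (f : ℕ → ℤ) → ∑ (suc n) f ≡ ∑ n f +ᶻ f n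
∑-last zero f = ℤₚ.+-comm (f 0) 0ℤ
∑-last (suc n) f = trans (cong (f 0 +ᶻ_) (∑-last n (f ∘ suc))) (sym (ℤₚ.+-assoc (f 0) _ _))

∑-shift₁ : ∀ n (f : ℕ → ℤ) → f n ≡ f 0 → ∑ n (f ∘ suc) ≡ ∑ n f
∑-shift₁ n f eq = ℤ-Group.∙-cancelˡ (f 0) _ _ (begin
  f 0 +ᶻ ∑ n (f ∘ suc)  ≡⟨ ∑-last n f ⟩
  ∑ n f +ᶻ f n          ≡⟨ cong (∑ n f +ᶻ_) eq ⟩
  ∑ n f +ᶻ f 0          ≡⟨ ℤₚ.+-comm (∑ n f) (f 0) ⟩
  f 0 +ᶻ ∑ n f          ∎)
  where open ≡-Reasoning

∑-shift : ∀ n (f : ℕ → ℤ) → (∀ i → f (n + i) ≡ f i) → ∀ k → ∑ n (λ i → f (i + k)) ≡ ∑ n f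
∑-shift n f per zero = ∑-cong n (λ i → cong f (ℕₚ.+-identityʳ i))
∑-shift n f per (suc k) = begin
  ∑ n (λ i → f (i + suc k))    ≡⟨ ∑-cong n (λ i → cong f (ℕₚ.+-suc i k)) ⟩
  ∑ n (λ i → f (suc i + k))    ≡⟨ ∑-shift₁ n (λ i → f (i + k)) (per k) ⟩
  ∑ n (λ i → f (i + k))        ≡⟨ ∑-shift n f per k ⟩
  ∑ n f                        ∎
  where open ≡-Reasoning

∑-≥0 : ∀ n {f : ℕ → ℤ} → (∀ i → 0ℤ ≤ᶻ f i) → 0ℤ ≤ᶻ ∑ n f
∑-≥0 zero pos = ℤₚ.≤-refl
∑-≥0 (suc n) pos = ℤₚ.+-mono-≤ (pos 0) (∑-≥0 n (pos ∘ suc))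

∑≤0⇒≡0 : ∀ n {f : ℕ → ℤ} → (∀ i → 0ℤ ≤ᶻ f i) → ∑ n f ≤ᶻ 0ℤ → ∀ i → i < n → f i ≡ 0ℤ
∑≤0⇒≡0 (suc n) {f} pos le zero _ = ℤₚ.≤-antisym
  (ℤₚ.≤-trans (subst (_≤ᶻ f 0 +ᶻ ∑ n (f ∘ suc)) (ℤₚ.+-identityʳ (f 0)) (ℤₚ.+-monoʳ-≤ (f 0) (∑-≥0 n (pos ∘ suc)))) le)
  (pos 0)
∑≤0⇒≡0 (suc n) {f} pos le (suc i) (s≤s i<n) = ∑≤0⇒≡0 n (pos ∘ suc)
  (ℤₚ.≤-trans (subst (_≤ᶻ f 0 +ᶻ ∑ n (f ∘ suc)) (ℤₚ.+-identityˡ _) (ℤₚ.+-monoˡ-≤ (∑ n (f ∘ suc)) (pos 0))) le)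
  i i<n

-- Linear functionals given by lists of coefficients

merge : {A : Set} → (A → A → A) → List A → List A → List A
merge _∙_ [] ys = ys
merge _∙_ xs@(_ ∷ _) [] = xs
merge _∙_ (x ∷ xs) (y ∷ ys) = (x ∙ y) ∷ merge _∙_ xs ys

module _ {A B : Set} (_·_ : A → B → ℤ) where

  -- The pairing is a parameter so that `lin` can be nested: with `row` or `poly` as the pairing, a
  -- list of rows acts on functions of two variables. A list stands for a sequence continued by
  -- zeros, which is why `merge` keeps the longer tail.
  lin : List A → (ℕ → B) → ℤ
  lin [] F = 0ℤ
  lin (x ∷ xs) F = (x · F 0) +ᶻ lin xs (F ∘ suc)

  lin-++ : ∀ xs ys F → lin (xs ++ ys) F ≡ lin xs F +ᶻ lin ys (λ i → F (length xs + i))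
  lin-++ [] ys F = sym (ℤₚ.+-identityˡ _)
  lin-++ (x ∷ xs) ys F = trans (cong ((x · F 0) +ᶻ_) (lin-++ xs ys (F ∘ suc))) (sym (ℤₚ.+-assoc (x · F 0) _ _))

  lin-take-drop : ∀ k xs F → lin xs F ≡ lin (take k xs) F +ᶻ lin (drop k xs) (λ i → F (k + i))
  lin-take-drop zero xs F = sym (ℤₚ.+-identityˡ _)
  lin-take-drop (suc k) [] F = refl
  lin-take-drop (suc k) (x ∷ xs) F = trans (cong ((x · F 0) +ᶻ_) (lin-take-drop k xs (F ∘ suc))) (sym (ℤₚ.+-assoc (x · F 0) _ _))

  lin-replicate : ∀ k x xs F → (∀ b → x · b ≡ 0ℤ) → lin (replicate k x ++ xs) F ≡ lin xs (λ i → F (k + i))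
  lin-replicate zero x xs F eq = refl
  lin-replicate (suc k) x xs F eq = trans (cong₂ _+ᶻ_ (eq (F 0)) (lin-replicate k x xs (F ∘ suc) eq)) (ℤₚ.+-identityˡ _)

  lin-merge : ∀ _∙_ → (∀ x y b → (x ∙ y) · b ≡ (x · b) +ᶻ (y · b)) →
              ∀ xs ys F → lin (merge _∙_ xs ys) F ≡ lin xs F +ᶻ lin ys F
  lin-merge _∙_ hom [] ys F = sym (ℤₚ.+-identityˡ _)
  lin-merge _∙_ hom (x ∷ xs) [] F = sym (ℤₚ.+-identityʳ _)
  lin-merge _∙_ hom (x ∷ xs) (y ∷ ys) F =
    trans (cong₂ _+ᶻ_ (hom x y (F 0)) (lin-merge _∙_ hom xs ys (F ∘ suc))) (interchange (x · F 0) (y · F 0) _ _)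

  lin-cong : ∀ xs {F G : ℕ → B} → (∀ x i → (x · F i) ≡ (x · G i)) → lin xs F ≡ lin xs G
  lin-cong [] eq = refl
  lin-cong (x ∷ xs) eq = cong₂ _+ᶻ_ (eq x 0) (lin-cong xs (λ x i → eq x (suc i)))

  lin-+ : ∀ xs {F G H : ℕ → B} → (∀ x i → (x · H i) ≡ (x · F i) +ᶻ (x · G i)) → lin xs H ≡ lin xs F +ᶻ lin xs G
  lin-+ [] eq = refl
  lin-+ (x ∷ xs) {F} {G} eq = trans (cong₂ _+ᶻ_ (eq x 0) (lin-+ xs (λ x i → eq x (suc i)))) (interchange (x · F 0) (x · G 0) _ _)

  lin-* : ∀ c xs {F G : ℕ → B} → (∀ x i → (x · G i) ≡ c *ᶻ (x · F i)) → lin xs G ≡ c *ᶻ lin xs F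
  lin-* c [] eq = sym (ℤₚ.*-zeroʳ c)
  lin-* c (x ∷ xs) {F} eq = trans (cong₂ _+ᶻ_ (eq x 0) (lin-* c xs (λ x i → eq x (suc i)))) (sym (ℤₚ.*-distribˡ-+ c (x · F 0) _))

lin-map : {A A′ B : Set} (_·_ : A → B → ℤ) (_∘′_ : A′ → B → ℤ) (f : A′ → A) → (∀ x b → (f x · b) ≡ (x ∘′ b)) →
          ∀ xs F → lin _·_ (map f xs) F ≡ lin _∘′_ xs F
lin-map _·_ _∘′_ f eq [] F = refl
lin-map _·_ _∘′_ f eq (x ∷ xs) F = cong₂ _+ᶻ_ (eq x (F 0)) (lin-map _·_ _∘′_ f eq xs (F ∘ suc))

-- Functions on the edges of a circulant graph

-- In the circulant graph on ℤ/n with connection set ⟨s⟩, where sʰ = -1, the pair (t , m) stands for the edge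
-- with midpoint m and difference ± sᵗ.  A function on edges thus has period h in t and period n in m.
Field : Set
Field = ℕ → ℕ → ℤ

module Circulant (n : ℕ) .{{_ : NonZero n}} (s h : ℕ) (1+sʰ : (1 + s ^ h) % n ≡ 0 % n) where

  infix 4 _≈_
  _≈_ : ℕ → ℕ → Set
  a ≈ b = a % n ≡ b % n

  ≈-+ : ∀ {a a′ b b′} → a ≈ a′ → b ≈ b′ → a + b ≈ a′ + b′
  ≈-+ {a} {a′} {b} {b′} p q =
    trans (%-distribˡ-+ a b n) (trans (cong₂ (λ x y → (x + y) % n) p q) (sym (%-distribˡ-+ a′ b′ n)))

  ≈-* : ∀ {a a′ b b′} → a ≈ a′ → b ≈ b′ → a * b ≈ a′ * b′
  ≈-* {a} {a′} {b} {b′} p q =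
    trans (%-distribˡ-* a b n) (trans (cong₂ (λ x y → (x * y) % n) p q) (sym (%-distribˡ-* a′ b′ n)))

  ≈-≡ : ∀ {a b} → a ≡ b → a ≈ b
  ≈-≡ = cong (_% n)

  ≈-% : ∀ a → a % n ≈ a
  ≈-% a = m%n%n≡m%n a n

  ≈-n+ : ∀ a → n + a ≈ a
  ≈-n+ a = trans (≈-≡ (trans (ℕₚ.+-comm n a) (cong (λ k → a + k) (sym (ℕₚ.*-identityˡ n))))) ([m+kn]%n≡m%n a 1 n)

  x+sʰx≈0 : ∀ x → x + s ^ h * x ≈ 0
  x+sʰx≈0 x = ≈-* {1 + s ^ h} {0} {x} {x} 1+sʰ refl

  cancelʰ : ∀ x y → x + (y + s ^ h * y) ≈ x
  cancelʰ x y = trans (≈-+ {x} {x} refl (x+sʰx≈0 y)) (≈-≡ (ℕₚ.+-identityʳ x))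

  s²ʰ≈1 : s ^ (h + h) ≈ 1
  s²ʰ≈1 = begin
    s ^ (h + h) % n                        ≡⟨ ≈-≡ (ℕₚ.^-distribˡ-+-* s h h) ⟩
    (s ^ h * s ^ h) % n                    ≡⟨ cancelʰ (s ^ h * s ^ h) 1 ⟨
    (s ^ h * s ^ h + (1 + s ^ h * 1)) % n  ≡⟨ ≈-≡ (lemma (s ^ h)) ⟩
    (1 + (s ^ h + s ^ h * s ^ h)) % n      ≡⟨ cancelʰ 1 (s ^ h) ⟩
    1 % n                                  ∎
    where
    open ≡-Reasoning
    lemma : ∀ x → x * x + (1 + x * 1) ≡ 1 + (x + x * x)
    lemma = ℕ-Ring.solve-∀

  s²ʰx≈x : ∀ x → s ^ (h + h) * x ≈ x
  s²ʰx≈x x = trans (≈-* {b = x} s²ʰ≈1 refl) (≈-≡ (ℕₚ.*-identityˡ x))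

  sʰsʰx≈x : ∀ x → s ^ h * (s ^ h * x) ≈ x
  sʰsʰx≈x x = trans (≈-≡ (trans (sym (ℕₚ.*-assoc (s ^ h) (s ^ h) x)) (cong (_* x) (sym (ℕₚ.^-distribˡ-+-* s h h))))) (s²ʰx≈x x)

  ≈-cancel : ∀ v {a b} → v + a ≈ v + b → a ≈ b
  ≈-cancel v {a} {b} eq = trans (sym (drop-v a)) (trans (≈-+ {s ^ h * v} {s ^ h * v} refl eq) (drop-v b))
    where
    drop-v : ∀ a → s ^ h * v + (v + a) ≈ a
    drop-v a = trans (≈-≡ (lemma (s ^ h * v) v a)) (cancelʰ a v)
      where
      lemma : ∀ w v a → w + (v + a) ≡ a + (v + w)
      lemma = ℕ-Ring.solve-∀

  -- The absolute difference is i - j or its negative; in the second case the exponent grows by `h`,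
  -- because `s ^ h` is -1.
  ≈-distance : ∀ {i j} k → i ≈ j + s ^ k → ∃ λ e → ℕ.∣ i - j ∣ ≈ s ^ e
  ≈-distance {i} {j} k eq with ℕₚ.≤-total j i
  ... | inj₁ j≤i = k , trans (≈-≡ (ℕₚ.m≤n⇒∣n-m∣≡n∸m j≤i)) (≈-cancel j (trans (≈-≡ (ℕₚ.m+[n∸m]≡n j≤i)) eq))
  ... | inj₂ i≤j = h + k , trans (≈-≡ (ℕₚ.m≤n⇒∣m-n∣≡n∸m i≤j)) (trans (sym (cancelʰ d (s ^ k)))
      (trans (≈-≡ (sym (ℕₚ.+-assoc d (s ^ k) (s ^ h * s ^ k)))) (trans (≈-+ {b = s ^ h * s ^ k} zero-sum refl) (≈-≡ (sym (ℕₚ.^-distribˡ-+-* s h k))))))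
    where
    d = j ∸ i
    zero-sum : d + s ^ k ≈ 0
    zero-sum = ≈-cancel i (trans (≈-≡ (trans (sym (ℕₚ.+-assoc i d (s ^ k))) (cong (_+ s ^ k) (ℕₚ.m+[n∸m]≡n i≤j)))) (trans (sym eq) (≈-≡ (sym (ℕₚ.+-identityʳ i)))))

  ≈-vertex : ∀ a b k → a ≈ b + s ^ k → ∀ t m → (m + s ^ t * a) % n ≈ (m + s ^ t * b) % n + s ^ (t + k)
  ≈-vertex a b k eq t m = trans (≈-% (m + s ^ t * a)) (trans (≈-+ {m} refl (≈-* {s ^ t} refl eq))
    (trans (≈-≡ (trans (lemma m (s ^ t) b (s ^ k)) (cong (λ w → m + s ^ t * b + w) (sym (ℕₚ.^-distribˡ-+-* s t k)))))
      (≈-+ {b = s ^ (t + k)} (sym (≈-% (m + s ^ t * b))) refl)))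
    where
    lemma : ∀ m w b v → m + w * (b + v) ≡ m + w * b + w * v
    lemma = ℕ-Ring.solve-∀

  record Periodic (k : ℕ) (z : Field) : Set where
    field
      resp : ∀ t {a b} → a ≈ b → z t a ≡ z t b
      per  : ∀ t m → z (k + t) m ≡ z t m
  open Periodic public

  -- Raising `t` by `h` multiplies the difference by -1 and keeps the edge, so these are the
  -- functions of the unoriented edge.
  Even : Field → Set
  Even = Periodic h

  double : ∀ {z} → Even z → Periodic (h + h) z
  double {z} e .resp = e .resp
  double {z} e .per t m = trans (cong (λ k → z k m) (ℕₚ.+-assoc h h t)) (trans (e .per (h + t) m) (e .per t m))

  -- Right translation in the semidirect product ℕ ⋉ ℕ; it commutes with the automorphisms of the graph,
  -- which act by left translation.
  infixl 7 _◃_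
  _◃_ : Field → ℕ × ℕ → Field
  (z ◃ (τ , μ)) t m = z (t + τ) (m + s ^ t * μ)

  ◃-∘ : ∀ z τ μ τ′ μ′ t m → ((z ◃ (τ , μ)) ◃ (τ′ , μ′)) t m ≡ (z ◃ (τ′ + τ , μ′ + s ^ τ′ * μ)) t m
  ◃-∘ z τ μ τ′ μ′ t m = cong₂ z (ℕₚ.+-assoc t τ′ τ)
    (trans (cong (λ w → m + s ^ t * μ′ + w * μ) (ℕₚ.^-distribˡ-+-* s t τ′)) (lemma m (s ^ t) μ′ (s ^ τ′) μ))
    where
    lemma : ∀ m a b c d → m + a * b + a * c * d ≡ m + a * (b + c * d)
    lemma = ℕ-Ring.solve-∀

  -- Conjugation by `(h , 0)`, the element that reverses edges.
  neg : ℕ × ℕ → ℕ × ℕ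
  neg (τ , μ) = τ , s ^ h * μ

  -- The group inverse of `(τ , μ)`, with `s ^ h` in place of -1 and `h + h` as a period of the
  -- powers of `s`. The truncated subtraction makes this correct for `τ ≤ h + h`.
  inv : ℕ × ℕ → ℕ × ℕ
  inv (τ , μ) = h + h ∸ τ , s ^ h * (s ^ (h + h ∸ τ) * μ)

  ◃-Periodic : ∀ {z} → Periodic (h + h) z → ∀ g → Periodic (h + h) (z ◃ g)
  ◃-Periodic {z} p (τ , μ) .resp t eq = p .resp (t + τ) (≈-+ {b = s ^ t * μ} eq refl)
  ◃-Periodic {z} p (τ , μ) .per t m = begin
    z (h + h + t + τ) (m + s ^ (h + h + t) * μ)     ≡⟨ cong (λ k → z k (m + s ^ (h + h + t) * μ)) (ℕₚ.+-assoc (h + h) t τ) ⟩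
    z (h + h + (t + τ)) (m + s ^ (h + h + t) * μ)   ≡⟨ p .per (t + τ) _ ⟩
    z (t + τ) (m + s ^ (h + h + t) * μ)             ≡⟨ p .resp (t + τ) (≈-+ {m} {m} refl eq) ⟩
    z (t + τ) (m + s ^ t * μ)                       ∎
    where
    open ≡-Reasoning
    eq : s ^ (h + h + t) * μ ≈ s ^ t * μ
    eq = trans (≈-≡ (trans (cong (_* μ) (ℕₚ.^-distribˡ-+-* s (h + h) t)) (ℕₚ.*-assoc (s ^ (h + h)) (s ^ t) μ))) (s²ʰx≈x (s ^ t * μ))

  -- Translation by `g` does not preserve evenness, since `s ^ t * μ` changes sign when `t` grows by
  -- `h`. Sums therefore run over oriented edges and count every edge twice.
  ∑∑ : Field → ℤ
  ∑∑ F = ∑ (h + h) (λ t → ∑ n (F t))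

  ∑∑-cong : ∀ {F G : Field} → (∀ t m → F t m ≡ G t m) → ∑∑ F ≡ ∑∑ G
  ∑∑-cong eq = ∑-cong (h + h) (λ t → ∑-cong n (eq t))

  ∑∑-+ : ∀ (F G : Field) → ∑∑ (λ t m → F t m +ᶻ G t m) ≡ ∑∑ F +ᶻ ∑∑ G
  ∑∑-+ F G = trans (∑-cong (h + h) (λ t → ∑-+ n (F t) (G t))) (∑-+ (h + h) _ _)

  ∑∑-*ˡ : ∀ c (F : Field) → ∑∑ (λ t m → c *ᶻ F t m) ≡ c *ᶻ ∑∑ F
  ∑∑-*ˡ c F = trans (∑-cong (h + h) (λ t → ∑-*ˡ n c (F t))) (∑-*ˡ (h + h) c _)

  ∑-translate : ∀ {F : Field} t → (∀ {a b} → a ≈ b → F t a ≡ F t b) → ∀ k → ∑ n (λ m → F t (m + k)) ≡ ∑ n (F t)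
  ∑-translate {F} t rsp = ∑-shift n (F t) (λ i → rsp (≈-n+ i))

  ∑∑-◃ : ∀ {F : Field} → Periodic (h + h) F → ∀ g → ∑∑ (F ◃ g) ≡ ∑∑ F
  ∑∑-◃ {F} p (τ , μ) = trans
    (∑-cong (h + h) (λ t → ∑-translate {F} (t + τ) (p .resp (t + τ)) (s ^ t * μ)))
    (∑-shift (h + h) (λ t → ∑ n (F t)) (λ t → ∑-cong n (p .per t)) τ)

  _·_ : Field → Field → Field
  (u · v) t m = u t m *ᶻ v t m

  ·-Periodic : ∀ {k u v} → Periodic k u → Periodic k v → Periodic k (u · v)
  ·-Periodic p q .resp t eq = cong₂ _*ᶻ_ (p .resp t eq) (q .resp t eq)
  ·-Periodic p q .per t m = cong₂ _*ᶻ_ (p .per t m) (q .per t m)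

  ⟪_,_⟫ : Field → Field → ℤ
  ⟪ u , v ⟫ = ∑∑ (u · v)

  ⟪⟫-cong : ∀ {u u′ v v′ : Field} → (∀ t m → u t m ≡ u′ t m) → (∀ t m → v t m ≡ v′ t m) → ⟪ u , v ⟫ ≡ ⟪ u′ , v′ ⟫
  ⟪⟫-cong p q = ∑∑-cong (λ t m → cong₂ _*ᶻ_ (p t m) (q t m))

  ⟪⟫-congʳ : ∀ {u v v′ : Field} → (∀ t m → v t m ≡ v′ t m) → ⟪ u , v ⟫ ≡ ⟪ u , v′ ⟫
  ⟪⟫-congʳ {u} = ⟪⟫-cong {u} {u} (λ _ _ → refl)

  ⟪⟫-comm : ∀ u v → ⟪ u , v ⟫ ≡ ⟪ v , u ⟫
  ⟪⟫-comm u v = ∑∑-cong (λ t m → ℤₚ.*-comm (u t m) (v t m))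

  ⟪⟫-+ʳ : ∀ u v w → ⟪ u , (λ t m → v t m +ᶻ w t m) ⟫ ≡ ⟪ u , v ⟫ +ᶻ ⟪ u , w ⟫
  ⟪⟫-+ʳ u v w = trans (∑∑-cong (λ t m → ℤₚ.*-distribˡ-+ (u t m) (v t m) (w t m))) (∑∑-+ (u · v) (u · w))

  ⟪⟫-*ʳ : ∀ c u v → ⟪ u , (λ t m → c *ᶻ v t m) ⟫ ≡ c *ᶻ ⟪ u , v ⟫
  ⟪⟫-*ʳ c u v = trans (∑∑-cong (λ t m → lemma (u t m) c (v t m))) (∑∑-*ˡ c (u · v))
    where
    lemma : ∀ a b c → a *ᶻ (b *ᶻ c) ≡ b *ᶻ (a *ᶻ c)
    lemma = solve-∀

  0≤x*x : ∀ x → 0ℤ ≤ᶻ x *ᶻ x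
  0≤x*x (+ m) = subst (0ℤ ≤ᶻ_) (ℤₚ.pos-* m m) (+≤+ z≤n)
  0≤x*x -[1+ m ] = +≤+ z≤n

  ⟪⟫-≥0 : ∀ u → 0ℤ ≤ᶻ ⟪ u , u ⟫
  ⟪⟫-≥0 u = ∑-≥0 (h + h) (λ t → ∑-≥0 n (λ m → 0≤x*x (u t m)))

  adjoint : ∀ {u v} → Periodic (h + h) u → Periodic (h + h) v → ∀ {τ} μ → τ ≤ h + h →
            ⟪ u , v ◃ inv (τ , μ) ⟫ ≡ ⟪ u ◃ (τ , μ) , v ⟫
  adjoint {u} {v} pu pv {τ} μ τ≤ = begin
    ⟪ u , v ◃ inv g ⟫              ≡⟨ ∑∑-◃ (·-Periodic pu (◃-Periodic pv (inv g))) g ⟨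
    ⟪ u ◃ g , (v ◃ inv g) ◃ g ⟫    ≡⟨ ⟪⟫-congʳ {u ◃ g} undo ⟩
    ⟪ u ◃ g , v ⟫                  ∎
    where
    open ≡-Reasoning
    g = τ , μ
    k = h + h ∸ τ
    undo : ∀ t m → ((v ◃ inv g) ◃ g) t m ≡ v t m
    undo t m = begin
      v (t + τ + k) (m + s ^ t * μ + s ^ (t + τ) * (s ^ h * (s ^ k * μ)))
        ≡⟨ cong (λ j → v j (m + s ^ t * μ + s ^ (t + τ) * (s ^ h * (s ^ k * μ)))) (trans (ℕₚ.+-assoc t τ k) (trans (cong (λ k → t + k) (ℕₚ.m+[n∸m]≡n τ≤)) (ℕₚ.+-comm t (h + h)))) ⟩
      v (h + h + t) (m + s ^ t * μ + s ^ (t + τ) * (s ^ h * (s ^ k * μ)))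
        ≡⟨ pv .per t _ ⟩
      v t (m + s ^ t * μ + s ^ (t + τ) * (s ^ h * (s ^ k * μ)))
        ≡⟨ pv .resp t (trans (≈-+ {m + s ^ t * μ} refl eq) (trans (≈-≡ (ℕₚ.+-assoc m _ _)) (cancelʰ m (s ^ t * μ)))) ⟩
      v t m ∎
      where
      rearrange : ∀ a b c d e → a * b * (c * (d * e)) ≡ b * d * (c * (a * e))
      rearrange = ℕ-Ring.solve-∀
      eq : s ^ (t + τ) * (s ^ h * (s ^ k * μ)) ≈ s ^ h * (s ^ t * μ)
      eq = trans (≈-≡ (begin
        s ^ (t + τ) * (s ^ h * (s ^ k * μ))     ≡⟨ cong (_* (s ^ h * (s ^ k * μ))) (ℕₚ.^-distribˡ-+-* s t τ) ⟩
        s ^ t * s ^ τ * (s ^ h * (s ^ k * μ))   ≡⟨ rearrange (s ^ t) (s ^ τ) (s ^ h) (s ^ k) μ ⟩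
        s ^ τ * s ^ k * (s ^ h * (s ^ t * μ))   ≡⟨ cong (_* (s ^ h * (s ^ t * μ))) (ℕₚ.^-distribˡ-+-* s τ k) ⟨
        s ^ (τ + k) * (s ^ h * (s ^ t * μ))     ≡⟨ cong (λ j → s ^ j * (s ^ h * (s ^ t * μ))) (ℕₚ.m+[n∸m]≡n τ≤) ⟩
        s ^ (h + h) * (s ^ h * (s ^ t * μ))     ∎)) (s²ʰx≈x _)

  double-cancel : ∀ x y → 0ℤ ≤ᶻ (x -ᶻ y) +ᶻ (x -ᶻ y) → y ≤ᶻ x
  double-cancel x y le = ℤₚ.0≤i-j⇒j≤i (ℤₚ.*-cancelˡ-≤-pos 0ℤ (x -ᶻ y) (+ 2) (subst (0ℤ ≤ᶻ_) (lemma (x -ᶻ y)) le))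
    where
    lemma : ∀ x → x +ᶻ x ≡ + 2 *ᶻ x
    lemma = solve-∀

  -- Cauchy-Schwarz for a translation: `z` and `z ◃ g` have equal norms, so expanding the norm of
  -- their difference gives the bound. The sum gives the lower bound in the same way.
  ⟪⟫-◃-≤ : ∀ {z} → Periodic (h + h) z → ∀ g → ⟪ z , z ◃ g ⟫ ≤ᶻ ⟪ z , z ⟫
  ⟪⟫-◃-≤ {z} p g = double-cancel N c (subst (0ℤ ≤ᶻ_) eq (⟪⟫-≥0 d))
    where
    open ≡-Reasoning
    N = ⟪ z , z ⟫
    c = ⟪ z , z ◃ g ⟫
    d : Field
    d t m = z t m -ᶻ (z ◃ g) t m
    square : ∀ a b → (a -ᶻ b) *ᶻ (a -ᶻ b) ≡ a *ᶻ a +ᶻ b *ᶻ b +ᶻ - (+ 2) *ᶻ (a *ᶻ b)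
    square = solve-∀
    collect : ∀ N c → N +ᶻ N +ᶻ - (+ 2) *ᶻ c ≡ (N -ᶻ c) +ᶻ (N -ᶻ c)
    collect = solve-∀
    eq : ⟪ d , d ⟫ ≡ (N -ᶻ c) +ᶻ (N -ᶻ c)
    eq = begin
      ⟪ d , d ⟫ ≡⟨ ∑∑-cong (λ t m → square (z t m) ((z ◃ g) t m)) ⟩
      ∑∑ (λ t m → (z · z) t m +ᶻ ((z ◃ g) · (z ◃ g)) t m +ᶻ - (+ 2) *ᶻ (z · (z ◃ g)) t m)
        ≡⟨ ∑∑-+ _ _ ⟩
      ∑∑ (λ t m → (z · z) t m +ᶻ ((z ◃ g) · (z ◃ g)) t m) +ᶻ ∑∑ (λ t m → - (+ 2) *ᶻ (z · (z ◃ g)) t m)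
        ≡⟨ cong₂ _+ᶻ_ (∑∑-+ _ _) (∑∑-*ˡ (- (+ 2)) _) ⟩
      N +ᶻ ⟪ z ◃ g , z ◃ g ⟫ +ᶻ - (+ 2) *ᶻ c
        ≡⟨ cong (λ M → N +ᶻ M +ᶻ - (+ 2) *ᶻ c) (∑∑-◃ (·-Periodic p p) g) ⟩
      N +ᶻ N +ᶻ - (+ 2) *ᶻ c ≡⟨ collect N c ⟩
      (N -ᶻ c) +ᶻ (N -ᶻ c) ∎

  ⟪⟫-◃-≥ : ∀ {z} → Periodic (h + h) z → ∀ g → - ⟪ z , z ⟫ ≤ᶻ ⟪ z , z ◃ g ⟫
  ⟪⟫-◃-≥ {z} p g = double-cancel c (- N) (subst (0ℤ ≤ᶻ_) eq (⟪⟫-≥0 d))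
    where
    open ≡-Reasoning
    N = ⟪ z , z ⟫
    c = ⟪ z , z ◃ g ⟫
    d : Field
    d t m = z t m +ᶻ (z ◃ g) t m
    square : ∀ a b → (a +ᶻ b) *ᶻ (a +ᶻ b) ≡ a *ᶻ a +ᶻ b *ᶻ b +ᶻ + 2 *ᶻ (a *ᶻ b)
    square = solve-∀
    collect : ∀ N c → N +ᶻ N +ᶻ + 2 *ᶻ c ≡ (c -ᶻ - N) +ᶻ (c -ᶻ - N)
    collect = solve-∀
    eq : ⟪ d , d ⟫ ≡ (c -ᶻ - N) +ᶻ (c -ᶻ - N)
    eq = begin
      ⟪ d , d ⟫ ≡⟨ ∑∑-cong (λ t m → square (z t m) ((z ◃ g) t m)) ⟩
      ∑∑ (λ t m → (z · z) t m +ᶻ ((z ◃ g) · (z ◃ g)) t m +ᶻ + 2 *ᶻ (z · (z ◃ g)) t m)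
        ≡⟨ ∑∑-+ _ _ ⟩
      ∑∑ (λ t m → (z · z) t m +ᶻ ((z ◃ g) · (z ◃ g)) t m) +ᶻ ∑∑ (λ t m → + 2 *ᶻ (z · (z ◃ g)) t m)
        ≡⟨ cong₂ _+ᶻ_ (∑∑-+ _ _) (∑∑-*ˡ (+ 2) _) ⟩
      N +ᶻ ⟪ z ◃ g , z ◃ g ⟫ +ᶻ + 2 *ᶻ c
        ≡⟨ cong (λ M → N +ᶻ M +ᶻ + 2 *ᶻ c) (∑∑-◃ (·-Periodic p p) g) ⟩
      N +ᶻ N +ᶻ + 2 *ᶻ c ≡⟨ collect N c ⟩
      (c -ᶻ - N) +ᶻ (c -ᶻ - N) ∎

  -- For `u = z` this is the autocorrelation: at `g` it sums the product of the values at `e` and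
  -- `e g` over all oriented edges `e`. It carries all that an invariant quadratic form sees of `z`.
  cor : Field → Field → Field
  cor u z τ μ = ⟪ u , z ◃ (τ , μ) ⟫

  cor-Even : ∀ u {z} → Even z → Even (cor u z)
  cor-Even u {z} e .resp τ {a} {b} eq = ⟪⟫-congʳ {u} λ t m → e .resp (t + τ) (≈-+ {m} refl (≈-* {s ^ t} refl eq))
  cor-Even u {z} e .per τ μ = ⟪⟫-congʳ {u} λ t m →
    trans (cong (λ k → z k (m + s ^ t * μ)) (swap t)) (e .per (t + τ) (m + s ^ t * μ))
    where
    swap : ∀ t → t + (h + τ) ≡ h + (t + τ)
    swap t = trans (sym (ℕₚ.+-assoc t h τ)) (trans (cong (_+ τ) (ℕₚ.+-comm t h)) (ℕₚ.+-assoc h t τ))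

  cor-neg : ∀ {x} → Even x → ∀ g → ⟪ x , x ◃ neg g ⟫ ≡ ⟪ x , x ◃ g ⟫
  cor-neg {x} e g@(τ , μ) = trans
    (∑-cong (h + h) (λ t → ∑-cong n (λ m → cong₂ _*ᶻ_ (sym (trans (cong (λ k → x k m) (ℕₚ.+-comm t h)) (e .per t m))) (sym (shift t m)))))
    (∑-shift (h + h) (λ t → ∑ n ((x · (x ◃ g)) t)) (λ t → ∑-cong n (·-Periodic (double e) (◃-Periodic (double e) g) .per t)) h)
    where
    shift : ∀ t m → (x ◃ g) (t + h) m ≡ (x ◃ neg g) t m
    shift t m = trans (cong₂ (λ k w → x k (m + w)) (trans (cong (_+ τ) (ℕₚ.+-comm t h)) (ℕₚ.+-assoc h t τ))
                        (trans (cong (_* μ) (ℕₚ.^-distribˡ-+-* s t h)) (ℕₚ.*-assoc (s ^ t) (s ^ h) μ)))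
                      (e .per (t + τ) _)

  cor-inv : ∀ {x} → Even x → ∀ {τ} μ → τ ≤ h + h → ⟪ x , x ◃ inv (τ , μ) ⟫ ≡ ⟪ x , x ◃ (τ , μ) ⟫
  cor-inv {x} e {τ} μ τ≤ = trans (adjoint (double e) (double e) μ τ≤) (⟪⟫-comm (x ◃ (τ , μ)) x)

  infixr 8 _∗_
  _∗_ : List (ℕ × ℕ) → Field → Field
  ([] ∗ z) t m = 0ℤ
  ((g ∷ gs) ∗ z) t m = (z ◃ g) t m +ᶻ (gs ∗ z) t m

  ∗-cong : ∀ gs {y z : Field} → (∀ t m → y t m ≡ z t m) → ∀ t m → (gs ∗ y) t m ≡ (gs ∗ z) t m
  ∗-cong [] eq t m = refl
  ∗-cong ((τ , μ) ∷ gs) eq t m = cong₂ _+ᶻ_ (eq (t + τ) (m + s ^ t * μ)) (∗-cong gs eq t m)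

  ∗-resp : ∀ gs {z} → (∀ t {a b} → a ≈ b → z t a ≡ z t b) → ∀ t {a b} → a ≈ b → (gs ∗ z) t a ≡ (gs ∗ z) t b
  ∗-resp [] r t eq = refl
  ∗-resp ((τ , μ) ∷ gs) r t eq = cong₂ _+ᶻ_ (r (t + τ) (≈-+ {b = s ^ t * μ} eq refl)) (∗-resp gs r t eq)

  -- Associativity of the semidirect product, in the form of `◃-∘`: translating the index of the
  -- correlation is the same as translating `z`.
  ∗-cor : ∀ gs u z τ μ → (gs ∗ cor u z) τ μ ≡ cor u (gs ∗ z) τ μ
  ∗-cor [] u z τ μ = sym (trans (∑∑-cong (λ t m → ℤₚ.*-zeroʳ (u t m))) (trans (∑∑-cong {λ _ _ → 0ℤ} {λ _ _ → 0ℤ *ᶻ 0ℤ} (λ _ _ → refl)) (∑∑-*ˡ 0ℤ (λ _ _ → 0ℤ))))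
  ∗-cor ((τ′ , μ′) ∷ gs) u z τ μ = trans
    (cong₂ _+ᶻ_ (⟪⟫-congʳ {u} (λ t m → sym (◃-∘ z τ′ μ′ τ μ t m))) (∗-cor gs u z τ μ))
    (sym (⟪⟫-+ʳ u _ _))

  flip-◃ : ∀ {z} → Even z → ∀ τ μ t m → (z ◃ (τ , μ)) (h + t) m ≡ (z ◃ (τ , s ^ h * μ)) t m
  flip-◃ {z} e τ μ t m = trans (cong (λ k → z k (m + s ^ (h + t) * μ)) (ℕₚ.+-assoc h t τ)) (trans (e .per (t + τ) _)
    (cong (λ w → z (t + τ) (m + w)) (trans (cong (_* μ) (ℕₚ.^-distribˡ-+-* s h t)) (lemma (s ^ h) (s ^ t) μ))))
    where
    lemma : ∀ a b c → a * b * c ≡ b * (a * c)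
    lemma = ℕ-Ring.solve-∀

  ◃-respˡ : ∀ {z} → (∀ t {a b} → a ≈ b → z t a ≡ z t b) → ∀ {τ a b} → a ≈ b → ∀ t m → (z ◃ (τ , a)) t m ≡ (z ◃ (τ , b)) t m
  ◃-respˡ r {τ} eq t m = r (t + τ) (≈-+ {m} refl (≈-* {s ^ t} refl eq))

  paired : List (ℕ × ℕ) → List (ℕ × ℕ)
  paired [] = []
  paired (g ∷ gs) = g ∷ inv g ∷ paired gs

  signed : List (ℕ × ℕ) → List (ℕ × ℕ)
  signed [] = []
  signed (g ∷ gs) = g ∷ neg g ∷ signed gs

  -- By `flip-◃`, raising `t` by `h` replaces every `g` by `neg g`. This only permutes the four
  -- terms that come from one generator.
  ∗-per : ∀ gs {z} → Even z → ∀ t m → (paired (signed gs) ∗ z) (h + t) m ≡ (paired (signed gs) ∗ z) t m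
  ∗-per [] e t m = refl
  ∗-per (g@(τ , μ) ∷ gs) {z} e t m = trans
    (cong₂ _+ᶻ_ (flip-◃ e τ μ t m) (cong₂ _+ᶻ_ (trans (flip-◃ e τ′ (inv g .proj₂) t m) (◃-respˡ (e .resp) {τ′} (≈-≡ (lemma (s ^ h) (s ^ τ′) μ)) t m))
      (cong₂ _+ᶻ_ (trans (flip-◃ e τ (s ^ h * μ) t m) (◃-respˡ (e .resp) {τ} (sʰsʰx≈x μ) t m))
        (cong₂ _+ᶻ_ (trans (flip-◃ e τ′ (inv (neg g) .proj₂) t m) (◃-respˡ (e .resp) {τ′} (trans (sʰsʰx≈x _) (≈-≡ (lemma₂ (s ^ h) (s ^ τ′) μ))) t m))
          (∗-per gs e t m)))))
    (reorder ((z ◃ neg g) t m) ((z ◃ inv (neg g)) t m) ((z ◃ g) t m) ((z ◃ inv g) t m) _)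
    where
    τ′ = h + h ∸ τ
    lemma : ∀ a b c → a * (a * (b * c)) ≡ a * (b * (a * c))
    lemma = ℕ-Ring.solve-∀
    lemma₂ : ∀ a b c → b * (a * c) ≡ a * (b * c)
    lemma₂ = ℕ-Ring.solve-∀
    reorder : ∀ a b c d e → a +ᶻ (b +ᶻ (c +ᶻ (d +ᶻ e))) ≡ c +ᶻ (d +ᶻ (a +ᶻ (b +ᶻ e)))
    reorder = solve-∀

  ∗-adjoint : ∀ {u v} → Periodic (h + h) u → Periodic (h + h) v → ∀ {gs} → All (λ g → proj₁ g ≤ h + h) gs →
              ⟪ u , paired gs ∗ v ⟫ ≡ ⟪ v , paired gs ∗ u ⟫
  ∗-adjoint {u} {v} pu pv [] = trans (∑∑-cong (λ t m → ℤₚ.*-zeroʳ (u t m))) (sym (∑∑-cong (λ t m → ℤₚ.*-zeroʳ (v t m))))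
  ∗-adjoint {u} {v} pu pv {g@(τ , μ) ∷ gs} (τ≤ ∷ τs) = begin
    ⟪ u , paired (g ∷ gs) ∗ v ⟫
      ≡⟨ trans (⟪⟫-+ʳ u (v ◃ g) _) (cong (⟪ u , v ◃ g ⟫ +ᶻ_) (⟪⟫-+ʳ u (v ◃ inv g) _)) ⟩
    ⟪ u , v ◃ g ⟫ +ᶻ (⟪ u , v ◃ inv g ⟫ +ᶻ ⟪ u , paired gs ∗ v ⟫)
      ≡⟨ cong₂ _+ᶻ_ (trans (⟪⟫-comm u _) (sym (adjoint pv pu μ τ≤))) (cong₂ _+ᶻ_ (trans (adjoint pu pv μ τ≤) (⟪⟫-comm _ v)) (∗-adjoint pu pv τs)) ⟩
    ⟪ v , u ◃ inv g ⟫ +ᶻ (⟪ v , u ◃ g ⟫ +ᶻ ⟪ v , paired gs ∗ u ⟫)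
      ≡⟨ swap ⟪ v , u ◃ inv g ⟫ ⟪ v , u ◃ g ⟫ _ ⟩
    ⟪ v , u ◃ g ⟫ +ᶻ (⟪ v , u ◃ inv g ⟫ +ᶻ ⟪ v , paired gs ∗ u ⟫)
      ≡⟨ trans (⟪⟫-+ʳ v (u ◃ g) _) (cong (⟪ v , u ◃ g ⟫ +ᶻ_) (⟪⟫-+ʳ v (u ◃ inv g) _)) ⟨
    ⟪ v , paired (g ∷ gs) ∗ u ⟫ ∎
    where
    open ≡-Reasoning
    swap : ∀ a b c → a +ᶻ (b +ᶻ c) ≡ b +ᶻ (a +ᶻ c)
    swap = solve-∀

  Even-mod : .{{_ : NonZero h}} → ∀ {Z} → Even Z → ∀ k t m → Z (k % h + t) m ≡ Z (t + k) m
  Even-mod {Z} e k t m = trans (sym (go (k / h) (k % h + t))) (cong (λ i → Z i m) (trans (reorder (k / h * h) (k % h) t) (cong (λ i → t + i) (sym (m≡m%n+[m/n]*n k h)))))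
    where
    go : ∀ j t → Z (j * h + t) m ≡ Z t m
    go zero t = refl
    go (suc j) t = trans (cong (λ i → Z i m) (ℕₚ.+-assoc h (j * h) t)) (trans (e .per (j * h + t) m) (go j t))
    reorder : ∀ a b c → a + (b + c) ≡ c + (b + a)
    reorder = ℕ-Ring.solve-∀

-- Kronecker substitution

-- A row of coefficients is packed into its value at X.  Operations on packed rows have the superscript ᵖ.
module Pack (X : ℕ) .{{_ : NonZero X}} where

  val : List ℕ → ℕ
  val [] = 0
  val (d ∷ ds) = d + X * val ds

  _%X^_ _/X^_ : ℕ → ℕ → ℕ
  v %X^ k = _%_ v (X ^ k) {{m^n≢0 X k}}
  v /X^ k = _/_ v (X ^ k) {{m^n≢0 X k}}

  val-shift : ∀ k ds → val (replicate k 0 ++ ds) ≡ X ^ k * val ds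
  val-shift zero ds = sym (ℕₚ.*-identityˡ (val ds))
  val-shift (suc k) ds = trans (cong (X *_) (val-shift k ds)) (sym (ℕₚ.*-assoc X (X ^ k) (val ds)))

  val-merge : ∀ ds es → val (merge _+_ ds es) ≡ val ds + val es
  val-merge [] es = refl
  val-merge (d ∷ ds) [] = sym (ℕₚ.+-identityʳ _)
  val-merge (d ∷ ds) (e ∷ es) = trans (cong (λ v → d + e + X * v) (val-merge ds es)) (lemma d e X (val ds) (val es))
    where
    lemma : ∀ d e x v w → d + e + x * (v + w) ≡ d + x * v + (e + x * w)
    lemma = ℕ-Ring.solve-∀

  val-scale : ∀ c ds → val (map (c *_) ds) ≡ c * val ds
  val-scale c [] = sym (ℕₚ.*-zeroʳ c)
  val-scale c (d ∷ ds) = trans (cong (λ v → c * d + X * v) (val-scale c ds)) (lemma c d X (val ds))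
    where
    lemma : ∀ c d x v → c * d + x * (c * v) ≡ c * (d + x * v)
    lemma = ℕ-Ring.solve-∀

  Digits : List ℕ → Set
  Digits = All (_< X)

  val-take-drop : ∀ k ds → val ds ≡ val (take k ds) + val (drop k ds) * X ^ k
  val-take-drop zero ds = sym (ℕₚ.*-identityʳ (val ds))
  val-take-drop (suc k) [] = refl
  val-take-drop (suc k) (d ∷ ds) = trans (cong (λ v → d + X * v) (val-take-drop k ds)) (lemma d X (val (take k ds)) (val (drop k ds)) (X ^ k))
    where
    lemma : ∀ d x a b c → d + x * (a + b * c) ≡ d + x * a + b * (x * c)
    lemma = ℕ-Ring.solve-∀

  digit-< : ∀ {d v Y} → d < X → v < Y → d + X * v < X * Y
  digit-< {d} {v} {Y} d<X v<Y = begin-strict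
    d + X * v   <⟨ ℕₚ.+-monoˡ-< (X * v) d<X ⟩
    X + X * v   ≡⟨ ℕₚ.*-suc X v ⟨
    X * suc v   ≤⟨ ℕₚ.*-monoʳ-≤ X v<Y ⟩
    X * Y       ∎
    where open ℕₚ.≤-Reasoning

  val-take-< : ∀ k {ds} → Digits ds → val (take k ds) < X ^ k
  val-take-< zero ds< = s≤s z≤n
  val-take-< (suc k) [] = ℕₚ.m^n>0 X (suc k)
  val-take-< (suc k) (d< ∷ ds<) = digit-< d< (val-take-< k ds<)

  divMod : ∀ {a} b {d} .{{_ : NonZero d}} → a < d → (a + b * d) % d ≡ a × (a + b * d) / d ≡ b
  divMod {a} b {d} a<d =
    trans ([m+kn]%n≡m%n a b d) (m<n⇒m%n≡m a<d) ,
    trans (+-distrib-/-∣ʳ a {b * d} (divides-refl b)) (cong₂ _+_ (m<n⇒m/n≡0 a<d) (m*n/n≡m b d))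

  val-% : ∀ k {ds} → Digits ds → val ds %X^ k ≡ val (take k ds)
  val-% k {ds} ds< = trans (cong (_%X^ k) (val-take-drop k ds)) (divMod (val (drop k ds)) {{m^n≢0 X k}} (val-take-< k ds<) .proj₁)

  val-/ : ∀ k {ds} → Digits ds → val ds /X^ k ≡ val (drop k ds)
  val-/ k {ds} ds< = trans (cong (_/X^ k) (val-take-drop k ds)) (divMod (val (drop k ds)) {{m^n≢0 X k}} (val-take-< k ds<) .proj₂)

  digits : ℕ → ℕ → List ℕ
  digits zero v = []
  digits (suc k) v = v % X ∷ digits k (v / X)

  _∙_ : ℕ → ℤ → ℤ
  c ∙ x = + c *ᶻ x

  row : List ℕ → (ℕ → ℤ) → ℤ
  row = lin _∙_

  row-null : ∀ {ds} → val ds ≡ 0 → ∀ F → row ds F ≡ 0ℤ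
  row-null {[]} eq F = refl
  row-null {d ∷ ds} eq F with ℕₚ.m+n≡0⇒m≡0 d eq
  ... | refl = trans (ℤₚ.+-identityˡ _) (row-null {ds} (ℕₚ.m*n≡0⇒m≡0 (val ds) X (trans (ℕₚ.*-comm (val ds) X) eq)) (F ∘ suc))

  row-digits-null : ∀ k F → row (digits k 0) F ≡ 0ℤ
  row-digits-null zero F = refl
  row-digits-null (suc k) F = trans
    (cong₂ _+ᶻ_ (cong (_∙ F 0) (m<n⇒m%n≡m 0<X)) (trans (cong (λ v → row (digits k v) (F ∘ suc)) (m<n⇒m/n≡0 0<X)) (row-digits-null k (F ∘ suc))))
    (ℤₚ.+-identityʳ _)
    where
    0<X : 0 < X
    0<X = ℕ.>-nonZero⁻¹ X

  -- The equality holds under `row` and not for lists: `digits k` always returns `k` digits, while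
  -- `ds` may be shorter or end in further zeros.
  row-digits : ∀ k {ds} → Digits ds → val ds < X ^ k → ∀ F → row (digits k (val ds)) F ≡ row ds F
  row-digits zero {ds} ds< (s≤s v≤0) F = sym (row-null {ds} (ℕₚ.n≤0⇒n≡0 v≤0) F)
  row-digits (suc k) [] v< F = row-digits-null (suc k) F
  row-digits (suc k) {d ∷ ds} (d< ∷ ds<) v< F = cong₂ _+ᶻ_
    (cong (_∙ F 0) (trans (cong (_% X) swap) (divMod (val ds) d< .proj₁)))
    (trans (cong (λ v → row (digits k v) (F ∘ suc)) (trans (cong (_/ X) swap) (divMod (val ds) d< .proj₂)))
      (row-digits k ds< (ℕₚ.*-cancelˡ-< X _ _ (ℕₚ.≤-<-trans (ℕₚ.m≤n+m _ d) v<)) (F ∘ suc)))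
    where
    swap : d + X * val ds ≡ d + val ds * X
    swap = cong (λ v → d + v) (ℕₚ.*-comm X (val ds))

  total : List ℕ → ℕ
  total = foldr _+_ 0

  row-total : ∀ ds → row ds (λ _ → 1ℤ) ≡ + total ds
  row-total [] = refl
  row-total (d ∷ ds) = trans (cong₂ _+ᶻ_ (ℤₚ.*-identityʳ (+ d)) (row-total ds)) (sym (ℤₚ.pos-+ d (total ds)))

  total-Digits : ∀ ds → total ds < X → Digits ds
  total-Digits [] _ = []
  total-Digits (d ∷ ds) lt = ℕₚ.≤-<-trans (ℕₚ.m≤m+n d _) lt ∷ total-Digits ds (ℕₚ.≤-<-trans (ℕₚ.m≤n+m _ d) lt)

  ∙-+ : ∀ x y b → (x + y) ∙ b ≡ (x ∙ b) +ᶻ (y ∙ b)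
  ∙-+ x y b = trans (cong (_*ᶻ b) (ℤₚ.pos-+ x y)) (ℤₚ.*-distribʳ-+ b (+ x) (+ y))

  row-merge : ∀ xs ys F → row (merge _+_ xs ys) F ≡ row xs F +ᶻ row ys F
  row-merge = lin-merge _∙_ _+_ ∙-+

  ⟦_⟧ : List (List ℕ) → Field → ℤ
  ⟦_⟧ = lin row

  𝟙 : Field
  𝟙 _ _ = 1ℤ

  -- A bound for every digit at once. Coefficients are natural numbers, so the mass is the value of
  -- the functional at the constant field `𝟙`, and it can be followed through all operations without
  -- looking at digits.
  mass : List (List ℕ) → ℕ
  mass G = total (map total G)

  ⟦⟧-mass : ∀ G → ⟦ G ⟧ 𝟙 ≡ + mass G
  ⟦⟧-mass [] = refl
  ⟦⟧-mass (r ∷ rs) = trans (cong₂ _+ᶻ_ (row-total r) (⟦⟧-mass rs)) (sym (ℤₚ.pos-+ (total r) (mass rs)))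

  mass-Digits : ∀ G → mass G < X → All Digits G
  mass-Digits [] _ = []
  mass-Digits (r ∷ rs) lt = total-Digits r (ℕₚ.≤-<-trans (ℕₚ.m≤m+n (total r) _) lt) ∷ mass-Digits rs (ℕₚ.≤-<-trans (ℕₚ.m≤n+m _ (total r)) lt)

  ⟦⟧-cong : ∀ G {Y Z : Field} → (∀ t m → Y t m ≡ Z t m) → ⟦ G ⟧ Y ≡ ⟦ G ⟧ Z
  ⟦⟧-cong G eq = lin-cong row G (λ r t → lin-cong _∙_ r (λ d m → cong (d ∙_) (eq t m)))

  ⟦⟧-+ : ∀ G {Y Z : Field} → ⟦ G ⟧ (λ t m → Y t m +ᶻ Z t m) ≡ ⟦ G ⟧ Y +ᶻ ⟦ G ⟧ Z
  ⟦⟧-+ G {Y} {Z} = lin-+ row G (λ r t → lin-+ _∙_ r (λ d m → ℤₚ.*-distribˡ-+ (+ d) (Y t m) (Z t m)))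

  ⟦⟧-zero : ∀ G → ⟦ G ⟧ (λ _ _ → 0ℤ) ≡ 0ℤ
  ⟦⟧-zero G = lin-* row 0ℤ G {λ _ _ → 0ℤ} (λ r t → lin-* _∙_ 0ℤ r {λ _ → 0ℤ} (λ d m → ℤₚ.*-zeroʳ (+ d)))

  infixr 6 _⊞_
  _⊞_ : List (List ℕ) → List (List ℕ) → List (List ℕ)
  _⊞_ = merge (merge _+_)

  ⟦⟧-⊞ : ∀ G H Z → ⟦ G ⊞ H ⟧ Z ≡ ⟦ G ⟧ Z +ᶻ ⟦ H ⟧ Z
  ⟦⟧-⊞ = lin-merge row (merge _+_) row-merge

  map-val-⊞ : ∀ G H → map val (G ⊞ H) ≡ merge _+_ (map val G) (map val H)
  map-val-⊞ [] H = refl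
  map-val-⊞ (r ∷ rs) [] = refl
  map-val-⊞ (r ∷ rs) (q ∷ qs) = cong₂ _∷_ (val-merge r q) (map-val-⊞ rs qs)

  ⟦⟧-digits : ∀ k {G} → All Digits G → All (λ v → v < X ^ k) (map val G) → ∀ Z → ⟦ map (digits k) (map val G) ⟧ Z ≡ ⟦ G ⟧ Z
  ⟦⟧-digits k {[]} [] [] Z = refl
  ⟦⟧-digits k {r ∷ G} (r< ∷ G<) (v< ∷ vs<) Z = cong₂ _+ᶻ_ (row-digits k r< v< (Z 0)) (⟦⟧-digits k G< vs< (Z ∘ suc))

  square : ℕ → ℕ
  square v = v * v

  -- Repeated squaring, because _^_ is linear in the exponent.
  pow₂ : ℕ → ℕ → ℕ
  pow₂ zero e = X ^ e
  pow₂ (suc k) e = square (pow₂ k (e / 2)) * X ^ (e % 2)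

  pow₂-^ : ∀ k e → pow₂ k e ≡ X ^ e
  pow₂-^ zero e = refl
  pow₂-^ (suc k) e = begin
    square (pow₂ k (e / 2)) * X ^ (e % 2)          ≡⟨ cong (λ v → square v * X ^ (e % 2)) (pow₂-^ k (e / 2)) ⟩
    X ^ (e / 2) * X ^ (e / 2) * X ^ (e % 2)       ≡⟨ cong (_* X ^ (e % 2)) (ℕₚ.^-distribˡ-+-* X (e / 2) (e / 2)) ⟨
    X ^ (e / 2 + e / 2) * X ^ (e % 2)             ≡⟨ ℕₚ.^-distribˡ-+-* X (e / 2 + e / 2) (e % 2) ⟨
    X ^ (e / 2 + e / 2 + e % 2)                   ≡⟨ cong (X ^_) (trans (lemma (e / 2) (e % 2)) (sym (m≡m%n+[m/n]*n e 2))) ⟩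
    X ^ e                                         ∎
    where
    open ≡-Reasoning
    lemma : ∀ a b → a + a + b ≡ b + a * 2
    lemma = ℕ-Ring.solve-∀

  -- One application of a sum of translations to unpacked and packed rows

  module Step (n : ℕ) .{{_ : NonZero n}} (s h : ℕ) .{{_ : NonZero h}} (1+sʰ : (1 + s ^ h) % n ≡ 0 % n) where
    open Circulant n s h 1+sʰ

    -- The transpose of translation: the entry in row `t` moves by `s ^ t * e`, hence the factor `s`
    -- from one row to the next.
    shift : ℕ → List (List ℕ) → List (List ℕ)
    shift e [] = []
    shift e (r ∷ rs) = (replicate e 0 ++ r) ∷ shift (s * e % n) rs

    shiftᵖ : ℕ → List ℕ → List ℕ
    shiftᵖ e [] = []
    -- Ten halvings bring every exponent below 1024 to 0, which covers the residues modulo 785.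
    shiftᵖ e (v ∷ vs) = pow₂ 10 e * v ∷ shiftᵖ (s * e % n) vs

    act : List (List ℕ) → ℕ × ℕ → List (List ℕ)
    act G (τ , μ) = replicate (τ % h) [] ++ shift (μ % n) G

    actᵖ : List ℕ → ℕ × ℕ → List ℕ
    actᵖ R (τ , μ) = replicate (τ % h) 0 ++ shiftᵖ (μ % n) R

    acts : List (ℕ × ℕ) → List (List ℕ) → List (List ℕ)
    acts [] G = []
    acts (g ∷ gs) G = act G g ⊞ acts gs G

    actsᵖ : List (ℕ × ℕ) → List ℕ → List ℕ
    actsᵖ [] R = []
    actsᵖ (g ∷ gs) R = merge _+_ (actᵖ R g) (actsᵖ gs R)

    -- Rows from `h` on, and in `fold` columns from `n` on, are added back to the beginning. This
    -- does not change the value on even fields and keeps the packed rows short.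
    wrap : List (List ℕ) → List (List ℕ)
    wrap G = take h G ⊞ drop h G

    wrapᵖ : List ℕ → List ℕ
    wrapᵖ R = merge _+_ (take h R) (drop h R)

    fold : List ℕ → List ℕ
    fold r = merge _+_ (take n r) (drop n r)

    foldᵖ : ℕ → ℕ
    foldᵖ v = (v %X^ n) + (v /X^ n)

    step : List (ℕ × ℕ) → List (List ℕ) → List (List ℕ)
    step gs G = map fold (wrap (acts gs G))

    stepᵖ : List (ℕ × ℕ) → List ℕ → List ℕ
    stepᵖ gs R = map foldᵖ (wrapᵖ (actsᵖ gs R))

    map-val-shift : ∀ e G → map val (shift e G) ≡ shiftᵖ e (map val G)
    map-val-shift e [] = refl
    map-val-shift e (r ∷ rs) = cong₂ _∷_ (trans (val-shift e r) (cong (_* val r) (sym (pow₂-^ 10 e)))) (map-val-shift (s * e % n) rs)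

    map-val-act : ∀ G g → map val (act G g) ≡ actᵖ (map val G) g
    map-val-act G (τ , μ) = trans (map-++ val (replicate (τ % h) []) _) (cong₂ _++_ (map-replicate val (τ % h) []) (map-val-shift (μ % n) G))

    map-val-acts : ∀ gs G → map val (acts gs G) ≡ actsᵖ gs (map val G)
    map-val-acts [] G = refl
    map-val-acts (g ∷ gs) G = trans (map-val-⊞ (act G g) (acts gs G)) (cong₂ (merge _+_) (map-val-act G g) (map-val-acts gs G))

    map-val-wrap : ∀ G → map val (wrap G) ≡ wrapᵖ (map val G)
    map-val-wrap G = trans (map-val-⊞ (take h G) (drop h G)) (sym (cong₂ (merge _+_) (take-map h G) (drop-map h G)))

    map-val-fold : ∀ {G} → All Digits G → map val (map fold G) ≡ map foldᵖ (map val G)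
    map-val-fold [] = refl
    map-val-fold {r ∷ G} (r< ∷ G<) = cong₂ _∷_ (trans (val-merge (take n r) (drop n r)) (sym (cong₂ _+_ (val-% n r<) (val-/ n r<)))) (map-val-fold G<)

    ⟦⟧-shift : ∀ e G {Z} → (∀ t {a b} → a ≈ b → Z t a ≡ Z t b) → ⟦ shift e G ⟧ Z ≡ ⟦ G ⟧ (λ t m → Z t (m + s ^ t * e))
    ⟦⟧-shift e [] rsp = refl
    ⟦⟧-shift e (r ∷ rs) {Z} rsp = cong₂ _+ᶻ_
      (trans (lin-replicate _∙_ e 0 r (Z 0) (λ _ → refl))
        (lin-cong _∙_ r (λ d m → cong (λ k → d ∙ Z 0 k) (trans (ℕₚ.+-comm e m) (cong (λ k → m + k) (sym (ℕₚ.*-identityˡ e)))))))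
      (trans (⟦⟧-shift (s * e % n) rs {Z ∘ suc} (rsp ∘ suc))
        (⟦⟧-cong rs (λ t m → rsp (suc t) (≈-+ {m} refl (trans (≈-* {s ^ t} refl (≈-% (s * e))) (≈-≡ (lemma (s ^ t) s e)))))))
      where
      lemma : ∀ a b c → a * (b * c) ≡ b * a * c
      lemma = ℕ-Ring.solve-∀

    ⟦⟧-act : ∀ G g {Z} → Even Z → ⟦ act G g ⟧ Z ≡ ⟦ G ⟧ (Z ◃ g)
    ⟦⟧-act G (τ , μ) {Z} e = trans
      (lin-replicate row (τ % h) [] (shift (μ % n) G) Z (λ _ → refl))
      (trans (⟦⟧-shift (μ % n) G {λ t → Z (τ % h + t)} (λ t → e .resp (τ % h + t)))
        (⟦⟧-cong G (λ t m → trans (Even-mod e τ t _) (e .resp (t + τ) (≈-+ {m} refl (≈-* {s ^ t} refl (≈-% μ)))))))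

    ⟦⟧-acts : ∀ gs G {Z} → Even Z → ⟦ acts gs G ⟧ Z ≡ ⟦ G ⟧ (gs ∗ Z)
    ⟦⟧-acts [] G e = sym (⟦⟧-zero G)
    ⟦⟧-acts (g ∷ gs) G {Z} e = trans (⟦⟧-⊞ (act G g) (acts gs G) Z) (trans (cong₂ _+ᶻ_ (⟦⟧-act G g e) (⟦⟧-acts gs G e)) (sym (⟦⟧-+ G {Z ◃ g} {gs ∗ Z})))

    ⟦⟧-wrap : ∀ G {Z} → Even Z → ⟦ wrap G ⟧ Z ≡ ⟦ G ⟧ Z
    ⟦⟧-wrap G {Z} e = trans (⟦⟧-⊞ (take h G) (drop h G) Z) (trans
      (cong (⟦ take h G ⟧ Z +ᶻ_) (⟦⟧-cong (drop h G) (λ t m → sym (e .per t m))))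
      (sym (lin-take-drop row h G Z)))

    row-fold : ∀ r {F : ℕ → ℤ} → (∀ m → F (n + m) ≡ F m) → row (fold r) F ≡ row r F
    row-fold r {F} per = trans (row-merge (take n r) (drop n r) F) (trans
      (cong (row (take n r) F +ᶻ_) (lin-cong _∙_ (drop n r) (λ d m → cong (d ∙_) (sym (per m)))))
      (sym (lin-take-drop _∙_ n r F)))

    ⟦⟧-fold : ∀ G {Z} → Even Z → ⟦ map fold G ⟧ Z ≡ ⟦ G ⟧ Z
    ⟦⟧-fold G {Z} e = go G Z (e .resp)
      where
      go : ∀ G Z → (∀ t {a b} → a ≈ b → Z t a ≡ Z t b) → ⟦ map fold G ⟧ Z ≡ ⟦ G ⟧ Z
      go [] Z rsp = refl
      go (r ∷ rs) Z rsp = cong₂ _+ᶻ_ (row-fold r (λ m → rsp 0 (≈-n+ m))) (go rs (Z ∘ suc) (rsp ∘ suc))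

    ⟦⟧-step : ∀ gs G {Z} → Even Z → ⟦ step gs G ⟧ Z ≡ ⟦ G ⟧ (gs ∗ Z)
    ⟦⟧-step gs G e = trans (⟦⟧-fold (wrap (acts gs G)) e) (trans (⟦⟧-wrap (acts gs G) e) (⟦⟧-acts gs G e))

    𝟙-Even : Even 𝟙
    𝟙-Even .resp t eq = refl
    𝟙-Even .per t m = refl

    ∗-𝟙 : ∀ gs t m → (gs ∗ 𝟙) t m ≡ + length gs *ᶻ 𝟙 t m
    ∗-𝟙 gs t m = trans (go gs) (sym (ℤₚ.*-identityʳ (+ length gs)))
      where
      go : ∀ gs → (gs ∗ 𝟙) t m ≡ + length gs
      go [] = refl
      go (g ∷ gs) = trans (cong (1ℤ +ᶻ_) (go gs)) (sym (ℤₚ.pos-+ 1 (length gs)))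

    ⟦⟧-∗𝟙 : ∀ gs G → ⟦ G ⟧ (gs ∗ 𝟙) ≡ + (length gs * mass G)
    ⟦⟧-∗𝟙 gs G = trans (lin-* row (+ length gs) G (λ r t → lin-* _∙_ (+ length gs) r {𝟙 t} (λ d m → trans (cong (d ∙_) (∗-𝟙 gs t m)) (lemma (+ d) (+ length gs) 1ℤ))))
      (trans (cong (+ length gs *ᶻ_) (⟦⟧-mass G)) (sym (ℤₚ.pos-* (length gs) (mass G))))
      where
      lemma : ∀ a b c → a *ᶻ (b *ᶻ c) ≡ b *ᶻ (a *ᶻ c)
      lemma = solve-∀

    mass-step : ∀ gs G → mass (step gs G) ≡ length gs * mass G
    mass-step gs G = ℤₚ.+-injective (trans (sym (⟦⟧-mass (step gs G))) (trans (⟦⟧-step gs G 𝟙-Even) (⟦⟧-∗𝟙 gs G)))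

    -- Adding and shifting packed rows is always exact. Only splitting them at `X ^ n` needs digits
    -- below `X`, and the mass of the wrapped rows bounds these digits.
    map-val-step : ∀ gs G → length gs * mass G < X → map val (step gs G) ≡ stepᵖ gs (map val G)
    map-val-step gs G lt = trans (map-val-fold (mass-Digits W (subst (_< X) (sym mass-W) lt)))
      (cong (map foldᵖ) (trans (map-val-wrap (acts gs G)) (cong wrapᵖ (map-val-acts gs G))))
      where
      W = wrap (acts gs G)
      mass-W : mass W ≡ length gs * mass G
      mass-W = ℤₚ.+-injective (trans (sym (⟦⟧-mass W)) (trans (trans (⟦⟧-wrap (acts gs G) 𝟙-Even) (⟦⟧-acts gs G 𝟙-Even)) (⟦⟧-∗𝟙 gs G)))

-- Spectral gap

-- In the applications `a j` is a moment of the operator, so this is the polynomial of the operator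
-- inside a scalar product.
poly : List ℤ → (ℕ → ℤ) → ℤ
poly = lin _*ᶻ_

polymul : List ℤ → List ℤ → List ℤ
polymul [] q = []
polymul (c ∷ p) q = merge _+ᶻ_ (map (c *ᶻ_) q) (0ℤ ∷ polymul p q)

poly-merge : ∀ p q a → poly (merge _+ᶻ_ p q) a ≡ poly p a +ᶻ poly q a
poly-merge = lin-merge _*ᶻ_ _+ᶻ_ (λ x y b → ℤₚ.*-distribʳ-+ b x y)

poly-scale : ∀ c q a → poly (map (c *ᶻ_) q) a ≡ c *ᶻ poly q a
poly-scale c [] a = sym (ℤₚ.*-zeroʳ c)
poly-scale c (x ∷ q) a = trans (cong₂ _+ᶻ_ (ℤₚ.*-assoc c x (a 0)) (poly-scale c q (a ∘ suc))) (sym (ℤₚ.*-distribˡ-+ c (x *ᶻ a 0) _))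

poly-cong : ∀ q {a b : ℕ → ℤ} → (∀ j → a j ≡ b j) → poly q a ≡ poly q b
poly-cong q eq = lin-cong _*ᶻ_ q (λ c j → cong (c *ᶻ_) (eq j))

poly-polymul : ∀ p q a → poly (polymul p q) a ≡ poly p (λ i → poly q (λ j → a (i + j)))
poly-polymul [] q a = refl
poly-polymul (c ∷ p) q a = trans (poly-merge (map (c *ᶻ_) q) (0ℤ ∷ polymul p q) a)
  (cong₂ _+ᶻ_ (poly-scale c q a) (trans (ℤₚ.+-identityˡ _) (poly-polymul p q (a ∘ suc))))

-- Packed rows hold natural numbers only, so a polynomial is evaluated as the difference of its
-- positive and negative parts.
pos neg⁻ : ℤ → ℕ
pos (+ k) = k
pos -[1+ k ] = 0
neg⁻ (+ k) = 0
neg⁻ -[1+ k ] = suc k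

pos-neg : ∀ c x → c *ᶻ x ≡ (+ pos c *ᶻ x) -ᶻ (+ neg⁻ c *ᶻ x)
pos-neg (+ k) x = sym (ℤₚ.+-identityʳ _)
pos-neg -[1+ k ] x = trans (sym (ℤₚ.neg-distribˡ-* (+ suc k) x)) (sym (ℤₚ.+-identityˡ _))

part : (ℤ → ℕ) → List ℤ → (ℕ → ℤ) → ℤ
part f = lin (λ c x → + f c *ᶻ x)

poly-parts : ∀ p a → poly p a ≡ part pos p a -ᶻ part neg⁻ p a
poly-parts [] a = refl
poly-parts (c ∷ p) a = trans (cong₂ _+ᶻ_ (pos-neg c (a 0)) (poly-parts p (a ∘ suc))) (lemma (+ pos c *ᶻ a 0) (+ neg⁻ c *ᶻ a 0) (part pos p (a ∘ suc)) (part neg⁻ p (a ∘ suc)))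
  where
  lemma : ∀ a b c d → (a -ᶻ b) +ᶻ (c -ᶻ d) ≡ (a +ᶻ c) -ᶻ (b +ᶻ d)
  lemma = solve-∀

grid : List (List ℤ) → Field → ℤ
grid = lin poly

grid-merge : ∀ p q F → grid (merge (merge _+ᶻ_) p q) F ≡ grid p F +ᶻ grid q F
grid-merge = lin-merge poly (merge _+ᶻ_) poly-merge

norm : List ℤ → ℕ
norm [] = 0
norm (c ∷ cs) = ℤ.∣ c ∣ + norm cs

norms : List (List ℤ) → ℕ
norms [] = 0
norms (r ∷ rs) = norm r + norms rs

gap : List (List ℤ) → ℤ
gap ((c ∷ cs) ∷ rs) = c -ᶻ + (norm cs + norms rs)
gap rs = - (+ norms rs)

module _ {N : ℤ} where

  Bounded : ℤ → Set
  Bounded x = (- N ≤ᶻ x) × (x ≤ᶻ N)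

  *-bound : ∀ c {x} → Bounded x → - (+ ℤ.∣ c ∣ *ᶻ N) ≤ᶻ c *ᶻ x
  *-bound (+ k) {x} (lo , hi) = subst (_≤ᶻ + k *ᶻ x) (sym (ℤₚ.neg-distribʳ-* (+ k) N)) (ℤₚ.*-monoˡ-≤-nonNeg (+ k) lo)
  *-bound -[1+ k ] {x} (lo , hi) = subst (_≤ᶻ -[1+ k ] *ᶻ x) (sym (ℤₚ.neg-distribˡ-* (+ suc k) N)) (ℤₚ.*-monoˡ-≤-nonPos -[1+ k ] hi)

  neg-sum : ∀ a b → - (+ a *ᶻ N) +ᶻ - (+ b *ᶻ N) ≡ - (+ (a + b) *ᶻ N)
  neg-sum a b = trans (lemma (+ a) (+ b) N) (cong (λ k → - (k *ᶻ N)) (sym (ℤₚ.pos-+ a b)))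
    where
    lemma : ∀ a b N → - (a *ᶻ N) +ᶻ - (b *ᶻ N) ≡ - ((a +ᶻ b) *ᶻ N)
    lemma = solve-∀

  poly-bound : ∀ cs {a} → (∀ i → Bounded (a i)) → - (+ norm cs *ᶻ N) ≤ᶻ poly cs a
  poly-bound [] bd = ℤₚ.≤-refl
  poly-bound (c ∷ cs) {a} bd = subst (_≤ᶻ poly (c ∷ cs) a) (neg-sum ℤ.∣ c ∣ (norm cs)) (ℤₚ.+-mono-≤ (*-bound c (bd 0)) (poly-bound cs (bd ∘ suc)))

  grid-bound : ∀ rs {F} → (∀ t m → Bounded (F t m)) → - (+ norms rs *ᶻ N) ≤ᶻ grid rs F
  grid-bound [] bd = ℤₚ.≤-refl
  grid-bound (r ∷ rs) {F} bd = subst (_≤ᶻ grid (r ∷ rs) F) (neg-sum (norm r) (norms rs)) (ℤₚ.+-mono-≤ (poly-bound r (bd 0)) (grid-bound rs (bd ∘ suc)))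

  -- Diagonal dominance for an invariant matrix: the diagonal entry meets `F 0 0`, which is `N`
  -- itself, and every other entry costs at most its absolute value times `N`.
  gap-bound : ∀ rs {F : Field} → F 0 0 ≡ N → (∀ t m → Bounded (F t m)) → gap rs *ᶻ N ≤ᶻ grid rs F
  gap-bound [] eq bd = ℤₚ.≤-refl
  gap-bound ([] ∷ rs) {F} eq bd = subst (_≤ᶻ grid ([] ∷ rs) F) (ℤₚ.neg-distribˡ-* (+ norms rs) N) (grid-bound ([] ∷ rs) bd)
  gap-bound ((c ∷ cs) ∷ rs) {F} eq bd = subst₂ _≤ᶻ_ split (sym (ℤₚ.+-assoc (c *ᶻ F 0 0) _ _))
    (ℤₚ.+-mono-≤ (ℤₚ.≤-reflexive (cong (c *ᶻ_) (sym eq))) (ℤₚ.+-mono-≤ (poly-bound cs (bd 0 ∘ suc)) (grid-bound rs (bd ∘ suc))))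
    where
    lemma : ∀ c k N → c *ᶻ N +ᶻ - (k *ᶻ N) ≡ (c -ᶻ k) *ᶻ N
    lemma = solve-∀
    split : c *ᶻ N +ᶻ (- (+ norm cs *ᶻ N) +ᶻ - (+ norms rs *ᶻ N)) ≡ (c -ᶻ + (norm cs + norms rs)) *ᶻ N
    split = trans (cong (c *ᶻ N +ᶻ_) (neg-sum (norm cs) (norms rs))) (lemma c (+ (norm cs + norms rs)) N)

module Spectral (n : ℕ) .{{_ : NonZero n}} (s h : ℕ) .{{_ : NonZero h}} (1+sʰ : (1 + s ^ h) % n ≡ 0 % n)
                (bs : List (ℕ × ℕ)) (bs≤ : All (λ g → proj₁ g ≤ h + h) bs) where
  open Circulant n s h 1+sʰ

  -- The edges in a common triangle with the edge (0 , 0), given up to inversion and negation by bs; the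
  -- orbit of (0 , 1) is half as long as the others.
  L : List (ℕ × ℕ)
  L = paired ((0 , 1) ∷ signed bs)

  L-Even : ∀ {z} → Even z → Even (L ∗ z)
  L-Even e .resp = ∗-resp L (e .resp)
  L-Even {z} e .per t m = trans
    (cong₂ _+ᶻ_ (trans (flip-◃ e 0 1 t m) (cong₂ z (ℕₚ.+-identityʳ t) refl))
      (cong₂ _+ᶻ_ (trans (flip-◃ e (h + h) (s ^ h * (s ^ (h + h) * 1)) t m)
          (trans (◃-respˡ (e .resp) {h + h} (trans (sʰsʰx≈x (s ^ (h + h) * 1)) (s²ʰx≈x 1)) t m)
            (unwind (m + s ^ t * 1))))
        (∗-per bs e t m)))
    (trans (reorder (z t (m + s ^ t * (s ^ h * 1))) (z t (m + s ^ t * 1)) ((paired (signed bs) ∗ z) t m))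
      (cong₂ (λ x y → x +ᶻ (y +ᶻ (paired (signed bs) ∗ z) t m)) (cong (λ k → z k (m + s ^ t * 1)) (sym (ℕₚ.+-identityʳ t)))
        (sym (trans (◃-respˡ (e .resp) {h + h} (≈-* {s ^ h} refl (s²ʰx≈x 1)) t m) (unwind (m + s ^ t * (s ^ h * 1)))))))
    where
    unwind : ∀ k → z (t + (h + h)) k ≡ z t k
    unwind k = trans (cong (λ i → z i k) (ℕₚ.+-comm t (h + h))) (double e .per t k)
    reorder : ∀ a b c → a +ᶻ (b +ᶻ c) ≡ b +ᶻ (a +ᶻ c)
    reorder = solve-∀

  signed≤ : ∀ {gs} → All (λ g → proj₁ g ≤ h + h) gs → All (λ g → proj₁ g ≤ h + h) (signed gs)
  signed≤ [] = []
  signed≤ (p ∷ ps) = p ∷ p ∷ signed≤ ps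

  L-adjoint : ∀ {u v} → Even u → Even v → ⟪ u , L ∗ v ⟫ ≡ ⟪ L ∗ u , v ⟫
  L-adjoint {u} {v} eu ev = trans (∗-adjoint (double eu) (double ev) (z≤n ∷ signed≤ bs≤)) (⟪⟫-comm v (L ∗ u))

  pow : ℕ → Field → Field
  pow zero z = z
  pow (suc j) z = L ∗ pow j z

  pow-Even : ∀ j {z} → Even z → Even (pow j z)
  pow-Even zero e = e
  pow-Even (suc j) e = L-Even (pow-Even j e)

  moment : Field → ℕ → ℤ
  moment z j = ⟪ z , pow j z ⟫

  pow-pow : ∀ i j {z} → Even z → ⟪ pow i z , pow j z ⟫ ≡ moment z (i + j)
  pow-pow zero j e = refl
  pow-pow (suc i) j {z} e = trans (sym (L-adjoint (pow-Even i e) (pow-Even j e))) (trans (pow-pow i (suc j) e) (cong (moment z) (ℕₚ.+-suc i j)))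

  pow-cor : ∀ j u z t m → pow j (cor u z) t m ≡ cor u (pow j z) t m
  pow-cor zero u z t m = refl
  pow-cor (suc j) u z t m = trans (∗-cong L (pow-cor j u z) t m) (∗-cor L u (pow j z) t m)

  cor-00 : ∀ u z → cor u z 0 0 ≡ ⟪ u , z ⟫
  cor-00 u z = ⟪⟫-congʳ {u} (λ t m → cong₂ z (ℕₚ.+-identityʳ t) (trans (cong (λ k → m + k) (ℕₚ.*-zeroʳ (s ^ t))) (ℕₚ.+-identityʳ m)))

  -- This is what replaces the matrix by a row: the powers act on the autocorrelation and are read
  -- off at the origin alone.
  moment-cor : ∀ z j → pow j (cor z z) 0 0 ≡ moment z j
  moment-cor z j = trans (pow-cor j z z 0 0) (cor-00 z (pow j z))

  ⟪⟫-poly : ∀ q u (v : ℕ → Field) → ⟪ u , (λ t m → poly q (λ j → v j t m)) ⟫ ≡ poly q (λ j → ⟪ u , v j ⟫)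
  ⟪⟫-poly [] u v = trans (⟪⟫-*ʳ 0ℤ u (λ _ _ → 0ℤ)) refl
  ⟪⟫-poly (c ∷ q) u v = trans (⟪⟫-+ʳ u (λ t m → c *ᶻ v 0 t m) _) (cong₂ _+ᶻ_ (⟪⟫-*ʳ c u (v 0)) (⟪⟫-poly q u (v ∘ suc)))

  -- The left-out square is the norm of q(A) z; self-adjointness collects its scalar products into
  -- moments.
  square-≥0 : ∀ q {z} → Even z → 0ℤ ≤ᶻ poly (polymul q q) (moment z)
  square-≥0 q {z} e = subst (0ℤ ≤ᶻ_) eq (⟪⟫-≥0 w)
    where
    open ≡-Reasoning
    w : Field
    w t m = poly q (λ j → pow j z t m)
    eq : ⟪ w , w ⟫ ≡ poly (polymul q q) (moment z)
    eq = begin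
      ⟪ w , w ⟫                                             ≡⟨ ⟪⟫-poly q w (λ j → pow j z) ⟩
      poly q (λ j → ⟪ w , pow j z ⟫)                        ≡⟨ poly-cong q (λ j → trans (⟪⟫-comm w (pow j z)) (⟪⟫-poly q (pow j z) (λ i → pow i z))) ⟩
      poly q (λ j → poly q (λ i → ⟪ pow j z , pow i z ⟫))   ≡⟨ poly-cong q (λ j → poly-cong q (λ i → pow-pow j i e)) ⟩
      poly q (λ j → poly q (λ i → moment z (j + i)))        ≡⟨ poly-polymul q q (moment z) ⟨
      poly (polymul q q) (moment z)                         ∎

positive : ℤ → Bool
positive (+ suc _) = true
positive _ = false

-- Computing the row of P(A) and checking its dominance

module Certificate (n : ℕ) .{{_ : NonZero n}} (s h : ℕ) .{{_ : NonZero h}} (1+sʰ : (1 + s ^ h) % n ≡ 0 % n)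
                   (bs : List (ℕ × ℕ)) (bs≤ : All (λ g → proj₁ g ≤ h + h) bs)
                   (X : ℕ) .{{_ : NonZero X}} where
  open Circulant n s h 1+sʰ
  open Spectral n s h 1+sʰ bs bs≤
  open Pack X
  open Step n s h 1+sʰ

  powers : List ℤ → List (List ℕ) → List (List (List ℕ))
  powers [] G = []
  powers (_ ∷ p) G = G ∷ powers p (step L G)

  powersᵖ : List ℤ → List ℕ → List (List ℕ)
  powersᵖ [] R = []
  powersᵖ (_ ∷ p) R = R ∷ powersᵖ p (stepᵖ L R)

  combine : List ℕ → List (List (List ℕ)) → List (List ℕ)
  combine (c ∷ cs) (G ∷ Gs) = map (map (c *_)) G ⊞ combine cs Gs
  combine _ _ = []

  combineᵖ : List ℕ → List (List ℕ) → List ℕ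
  combineᵖ (c ∷ cs) (R ∷ Rs) = merge _+_ (map (c *_) R) (combineᵖ cs Rs)
  combineᵖ _ _ = []

  map-val-combine : ∀ cs Gs → map val (combine cs Gs) ≡ combineᵖ cs (map (map val) Gs)
  map-val-combine [] Gs = refl
  map-val-combine (c ∷ cs) [] = refl
  map-val-combine (c ∷ cs) (G ∷ Gs) = trans (map-val-⊞ (map (map (c *_)) G) (combine cs Gs))
    (cong₂ (merge _+_) (trans (sym (map-∘ G)) (trans (map-cong (val-scale c) G) (map-∘ G))) (map-val-combine cs Gs))

  map-val-powers : ∀ p G → length L ^ length p * mass G < X → map (map val) (powers p G) ≡ powersᵖ p (map val G)
  map-val-powers [] G lt = refl
  map-val-powers (c ∷ p) G lt = cong (map val G ∷_) (trans
    (map-val-powers p (step L G) (ℕₚ.≤-<-trans (ℕₚ.≤-reflexive eq) lt))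
    (cong (powersᵖ p) (map-val-step L G (ℕₚ.≤-<-trans le lt))))
    where
    eq : length L ^ length p * mass (step L G) ≡ length L ^ suc (length p) * mass G
    eq = trans (cong (length L ^ length p *_) (mass-step L G)) (lemma (length L) (length L ^ length p) (mass G))
      where
      lemma : ∀ a b c → b * (a * c) ≡ a * b * c
      lemma = ℕ-Ring.solve-∀
    le : length L * mass G ≤ length L ^ suc (length p) * mass G
    le = ℕₚ.*-monoˡ-≤ (mass G) (ℕₚ.m≤m*n (length L) (length L ^ length p) {{m^n≢0 (length L) (length p)}})

  row-scale : ∀ c r F → row (map (c *_) r) F ≡ + c *ᶻ row r F
  row-scale c [] F = sym (ℤₚ.*-zeroʳ (+ c))
  row-scale c (d ∷ r) F = trans
    (cong₂ _+ᶻ_ (trans (cong (_*ᶻ F 0) (ℤₚ.pos-* c d)) (ℤₚ.*-assoc (+ c) (+ d) (F 0))) (row-scale c r (F ∘ suc)))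
    (sym (ℤₚ.*-distribˡ-+ (+ c) (d ∙ F 0) _))

  ⟦⟧-scale : ∀ c G Z → ⟦ map (map (c *_)) G ⟧ Z ≡ + c *ᶻ ⟦ G ⟧ Z
  ⟦⟧-scale c [] Z = sym (ℤₚ.*-zeroʳ (+ c))
  ⟦⟧-scale c (r ∷ G) Z = trans (cong₂ _+ᶻ_ (row-scale c r (Z 0)) (⟦⟧-scale c G (Z ∘ suc))) (sym (ℤₚ.*-distribˡ-+ (+ c) (row r (Z 0)) _))

  ⟦⟧-combine : ∀ f p G {Z} → Even Z → ⟦ combine (map f p) (powers p G) ⟧ Z ≡ part f p (λ j → ⟦ G ⟧ (pow j Z))
  ⟦⟧-combine f [] G e = refl
  ⟦⟧-combine f (c ∷ p) G {Z} e = trans (⟦⟧-⊞ (map (map (f c *_)) G) (combine (map f p) (powers p (step L G))) Z)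
    (cong₂ _+ᶻ_ (⟦⟧-scale (f c) G Z) (trans (⟦⟧-combine f p (step L G) e)
      (lin-cong _ p (λ d j → cong (+ f d *ᶻ_) (⟦⟧-step L G (pow-Even j e))))))

  ∗-const : ∀ gs {z : Field} {c} → (∀ t m → z t m ≡ c) → ∀ t m → (gs ∗ z) t m ≡ + length gs *ᶻ c
  ∗-const [] eq t m = refl
  ∗-const (g ∷ gs) {z} {c} eq t m = trans (cong₂ _+ᶻ_ (eq _ _) (∗-const gs eq t m)) (sym (ℤₚ.suc-* (+ length gs) c))

  pow-𝟙 : ∀ j t m → pow j 𝟙 t m ≡ + (length L ^ j)
  pow-𝟙 zero t m = refl
  pow-𝟙 (suc j) t m = trans (∗-const L (pow-𝟙 j) t m) (sym (ℤₚ.pos-* (length L) (length L ^ j)))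

  origin : List (List ℕ)
  origin = (1 ∷ []) ∷ []

  ⟦origin⟧ : ∀ Z → ⟦ origin ⟧ Z ≡ Z 0 0
  ⟦origin⟧ Z = trans (ℤₚ.+-identityʳ _) (trans (ℤₚ.+-identityʳ _) (ℤₚ.*-identityˡ (Z 0 0)))

  weight : (ℤ → ℕ) → List ℤ → ℤ
  weight f p = part f p (λ j → + (length L ^ j))

  coefficients : (ℤ → ℕ) → List ℤ → List (List ℕ) → List (List ℕ)
  coefficients f p Rs = map (digits n) (combineᵖ (map f p) Rs)

  -- Adding `κ` changes the entries but not the form, because `κ` pairs to zero with the
  -- autocorrelations to which the result is applied.
  difference : List ℤ → List (List ℤ) → List (List ℕ) → List (List ℤ)
  difference p κ Rs = merge (merge _+ᶻ_)
    (merge (merge _+ᶻ_) (map (map (λ d → + d)) (coefficients pos p Rs)) (map (map (λ d → - (+ d))) (coefficients neg⁻ p Rs))) κ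

  fits : List ℕ → Bool
  fits = all (λ v → v ℕ.<ᵇ X ^ n)

  -- The two tests by `fits` say that the packed rows have at most `n` digits, so that `digits n`
  -- loses nothing.
  certify : List ℤ → List (List ℤ) → List (List ℕ) → Bool
  certify p κ Rs = fits (combineᵖ (map pos p) Rs) ∧ (fits (combineᵖ (map neg⁻ p) Rs) ∧ positive (gap (difference p κ Rs)))

  module _ (p : List ℤ) (κ : List (List ℤ)) (powers-fit : length L ^ length p * 1 < X) where

    Rs : List (List ℕ)
    Rs = powersᵖ p (1 ∷ [])

    -- Overflow is excluded twice: by `powers-fit` for the powers and by `weight` for their
    -- combination. The latter is its exact mass, since each application of `L` multiplies the
    -- constant field by `length L`.
    ⟦coefficients⟧ : ∀ f → weight f p <ᶻ + X → T (fits (combineᵖ (map f p) Rs)) →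
                     ∀ {Z} → Even Z → ⟦ coefficients f p Rs ⟧ Z ≡ part f p (λ j → pow j Z 0 0)
    ⟦coefficients⟧ f w< fit {Z} e = begin
      ⟦ map (digits n) (combineᵖ (map f p) Rs) ⟧ Z   ≡⟨ cong (λ R → ⟦ map (digits n) R ⟧ Z) hom ⟨
      ⟦ map (digits n) (map val D) ⟧ Z               ≡⟨ ⟦⟧-digits n (mass-Digits D mass<) fit′ Z ⟩
      ⟦ D ⟧ Z                                        ≡⟨ D-part e ⟩
      part f p (λ j → pow j Z 0 0)                   ∎
      where
      open ≡-Reasoning
      D = combine (map f p) (powers p origin)
      D-part : ∀ {Z} → Even Z → ⟦ D ⟧ Z ≡ part f p (λ j → pow j Z 0 0)
      D-part {Z} e = trans (⟦⟧-combine f p origin e) (lin-cong _ p (λ d j → cong (+ f d *ᶻ_) (⟦origin⟧ (pow j Z))))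
      hom : map val D ≡ combineᵖ (map f p) Rs
      hom = trans (map-val-combine (map f p) (powers p origin))
        (cong (combineᵖ (map f p)) (trans (map-val-powers p origin powers-fit) (cong (λ v → powersᵖ p (1 + v ∷ [])) (ℕₚ.*-zeroʳ X))))
      mass< : mass D < X
      mass< = ℤₚ.drop‿+<+ (subst (_<ᶻ + X) (trans (lin-cong _ p (λ d j → cong (+ f d *ᶻ_) (sym (pow-𝟙 j 0 0)))) (trans (sym (D-part 𝟙-Even)) (⟦⟧-mass D))) w<)
      fit′ : All (λ v → v < X ^ n) (map val D)
      fit′ = subst (All _) (sym hom) (All.map (ℕₚ.<ᵇ⇒< _ _) (all⁺ _ _ fit))

    grid-difference : ∀ Z → grid (difference p κ Rs) Z ≡ ⟦ coefficients pos p Rs ⟧ Z -ᶻ ⟦ coefficients neg⁻ p Rs ⟧ Z +ᶻ grid κ Z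
    grid-difference Z = trans (grid-merge (merge (merge _+ᶻ_) P M) κ Z) (cong (_+ᶻ grid κ Z) (trans (grid-merge P M Z) (cong₂ _+ᶻ_ plus (minus (coefficients neg⁻ p Rs) Z))))
      where
      P = map (map (λ d → + d)) (coefficients pos p Rs)
      M = map (map (λ d → - (+ d))) (coefficients neg⁻ p Rs)
      plus : grid P Z ≡ ⟦ coefficients pos p Rs ⟧ Z
      plus = lin-map poly row (map (λ d → + d)) (λ r F → lin-map _*ᶻ_ _∙_ (λ d → + d) (λ _ _ → refl) r F) (coefficients pos p Rs) Z
      minus-row : ∀ r F → poly (map (λ d → - (+ d)) r) F ≡ - row r F
      minus-row [] F = refl
      minus-row (d ∷ r) F = trans (cong₂ _+ᶻ_ (sym (ℤₚ.neg-distribˡ-* (+ d) (F 0))) (minus-row r (F ∘ suc))) (sym (ℤₚ.neg-distrib-+ (d ∙ F 0) _))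
      minus : ∀ G Z → grid (map (map (λ d → - (+ d))) G) Z ≡ - ⟦ G ⟧ Z
      minus [] Z = refl
      minus (r ∷ G) Z = trans (cong₂ _+ᶻ_ (minus-row r (Z 0)) (minus G (Z ∘ suc))) (sym (ℤₚ.neg-distrib-+ (row r (Z 0)) _))

  module _ (q : List ℤ) (C d : ℤ) (κ : List (List ℤ)) where

    residual : List ℤ
    residual = merge _+ᶻ_ (C *ᶻ d ∷ C ∷ []) (map (- 1ℤ *ᶻ_) (polymul q q))

    poly-residual : ∀ a → poly residual a ≡ C *ᶻ (d *ᶻ a 0 +ᶻ a 1) -ᶻ poly (polymul q q) a
    poly-residual a = trans (poly-merge (C *ᶻ d ∷ C ∷ []) (map (- 1ℤ *ᶻ_) (polymul q q)) a)
      (trans (cong (poly (C *ᶻ d ∷ C ∷ []) a +ᶻ_) (poly-scale (- 1ℤ) (polymul q q) a)) (lemma C d (a 0) (a 1) (poly (polymul q q) a)))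
      where
      lemma : ∀ C d a b w → (C *ᶻ d *ᶻ a +ᶻ (C *ᶻ b +ᶻ 0ℤ)) +ᶻ - 1ℤ *ᶻ w ≡ C *ᶻ (d *ᶻ a +ᶻ b) -ᶻ w
      lemma = solve-∀

    record Certified : Set where
      field
        powers-fit : length L ^ length residual * 1 < X
        pos-fit    : weight pos residual <ᶻ + X
        neg-fit    : weight neg⁻ residual <ᶻ + X
        dominant   : certify residual κ (powersᵖ residual (1 ∷ [])) ≡ true

    -- From C(A + d) = q(A)² + P(A), where P(A) is diagonally dominant modulo κ.
    spectral-gap : Certified → ∀ {z} → Even z → grid κ (cor z z) ≡ 0ℤ → C *ᶻ (d *ᶻ moment z 0 +ᶻ moment z 1) ≤ᶻ 0ℤ → ⟪ z , z ⟫ ≤ᶻ 0ℤ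
    spectral-gap cert {z} e κ0 le = cancel (gap ρ) pos-gap (ℤₚ.≤-trans (gap-bound ρ {F} (cor-00 z z) (λ t m → ⟪⟫-◃-≥ (double e) (t , m) , ⟪⟫-◃-≤ (double e) (t , m)))
        (ℤₚ.≤-trans (ℤₚ.≤-reflexive eq) residual≤0))
      where
      open ≡-Reasoning
      open Certified cert
      F = cor z z
      R = powersᵖ residual (1 ∷ [])
      ρ = difference residual κ R
      N = ⟪ z , z ⟫
      split : T (fits (combineᵖ (map pos residual) R)) × T (fits (combineᵖ (map neg⁻ residual) R) ∧ positive (gap ρ))
      split = Equivalence.to T-∧ (subst T (sym dominant) tt)
      split′ : T (fits (combineᵖ (map neg⁻ residual) R)) × T (positive (gap ρ))
      split′ = Equivalence.to T-∧ (split .proj₂)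
      pos-gap : T (positive (gap ρ))
      pos-gap = split′ .proj₂
      cancel : ∀ g → T (positive g) → g *ᶻ N ≤ᶻ 0ℤ → N ≤ᶻ 0ℤ
      cancel g@(+ suc k) _ le = ℤₚ.*-cancelˡ-≤-pos N 0ℤ g (subst (g *ᶻ N ≤ᶻ_) (sym (ℤₚ.*-zeroʳ g)) le)
      F-Even : Even F
      F-Even = cor-Even z e
      moments : ∀ f → part f residual (λ j → pow j F 0 0) ≡ part f residual (moment z)
      moments f = lin-cong _ residual (λ c j → cong (+ f c *ᶻ_) (moment-cor z j))
      eq : grid ρ F ≡ poly residual (moment z)
      eq = begin
        grid ρ F
          ≡⟨ grid-difference residual κ powers-fit F ⟩
        ⟦ coefficients pos residual R ⟧ F -ᶻ ⟦ coefficients neg⁻ residual R ⟧ F +ᶻ grid κ F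
          ≡⟨ cong₂ _+ᶻ_ (cong₂ _-ᶻ_
               (trans (⟦coefficients⟧ residual κ powers-fit pos pos-fit (split .proj₁) F-Even) (moments pos))
               (trans (⟦coefficients⟧ residual κ powers-fit neg⁻ neg-fit (split′ .proj₁) F-Even) (moments neg⁻))) κ0 ⟩
        part pos residual (moment z) -ᶻ part neg⁻ residual (moment z) +ᶻ 0ℤ
          ≡⟨ ℤₚ.+-identityʳ _ ⟩
        part pos residual (moment z) -ᶻ part neg⁻ residual (moment z)
          ≡⟨ poly-parts residual (moment z) ⟨
        poly residual (moment z) ∎
      residual≤0 : poly residual (moment z) ≤ᶻ 0ℤ
      residual≤0 = subst (_≤ᶻ 0ℤ) (sym (poly-residual (moment z)))
        (ℤₚ.+-mono-≤ le (ℤₚ.neg-mono-≤ (square-≥0 q e)))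

-- Averaging over the fibres of reduction modulo 5

-- The sum of H (i + c j) over j is invariant under i ↦ i + c, hence under i ↦ i + c k = i + 1.
∑-step : ∀ r (H : ℕ → ℤ) → (∀ i → H (r + i) ≡ H i) → ∀ c k e → c * k ≡ 1 + r * e → .{{NonZero r}} →
         ∑ r (λ j → H (c * j)) ≡ ∑ r H
∑-step r H per c k e ck = ℤₚ.*-cancelˡ-≡ (+ r) _ _ (begin
  + r *ᶻ W 0                                 ≡⟨ ∑-const r (W 0) ⟨
  ∑ r (λ _ → W 0)                            ≡⟨ ∑-cong r (λ i → sym (W-const i)) ⟩
  ∑ r (λ i → ∑ r (λ j → H (i + c * j)))      ≡⟨ ∑-swap r r (λ i j → H (i + c * j)) ⟩
  ∑ r (λ j → ∑ r (λ i → H (i + c * j)))      ≡⟨ ∑-cong r (λ j → ∑-shift r H per (c * j)) ⟩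
  ∑ r (λ _ → ∑ r H)                          ≡⟨ ∑-const r (∑ r H) ⟩
  + r *ᶻ ∑ r H                               ∎)
  where
  open ≡-Reasoning
  W : ℕ → ℤ
  W i = ∑ r (λ j → H (i + c * j))
  pers : ∀ i e → H (i + r * e) ≡ H i
  pers i zero = cong H (trans (cong (λ k → i + k) (ℕₚ.*-zeroʳ r)) (ℕₚ.+-identityʳ i))
  pers i (suc e) = trans (cong H (lemma i r e)) (trans (per (i + r * e)) (pers i e))
    where
    lemma : ∀ i r e → i + r * suc e ≡ r + (i + r * e)
    lemma = ℕ-Ring.solve-∀
  W-c : ∀ i → W (i + c) ≡ W i
  W-c i = trans (∑-cong r (λ j → cong H (lemma i c j))) (∑-shift₁ r (λ j → H (i + c * j))
    (trans (cong (λ k → H (i + k)) (ℕₚ.*-comm c r)) (trans (pers i c) (cong H (sym (trans (cong (λ k → i + k) (ℕₚ.*-zeroʳ c)) (ℕₚ.+-identityʳ i)))))))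
    where
    lemma : ∀ i c j → i + c + c * j ≡ i + c * suc j
    lemma = ℕ-Ring.solve-∀
  W-ck : ∀ k i → W (i + c * k) ≡ W i
  W-ck zero i = cong W (trans (cong (λ k → i + k) (ℕₚ.*-zeroʳ c)) (ℕₚ.+-identityʳ i))
  W-ck (suc k) i = trans (cong W (lemma i c k)) (trans (W-c (i + c * k)) (W-ck k i))
    where
    lemma : ∀ i c k → i + c * suc k ≡ i + c * k + c
    lemma = ℕ-Ring.solve-∀
  W-1 : ∀ i → W (suc i) ≡ W i
  W-1 i = trans (sym (∑-cong r (λ j → trans (cong H (lemma i (c * j) (r * e))) (pers (suc i + c * j) e)))) (trans (cong W (cong (λ k → i + k) (sym ck))) (W-ck k i))
    where
    lemma : ∀ i b d → i + suc d + b ≡ suc i + b + d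
    lemma = ℕ-Ring.solve-∀
  W-const : ∀ i → W i ≡ W 0
  W-const zero = refl
  W-const (suc i) = trans (W-1 i) (W-const i)

lin-concat : ∀ {A B : Set} (_·_ : A → B → ℤ) r ks (f : ℕ → B) →
             lin _·_ (concat (replicate r ks)) f ≡ ∑ r (λ j → lin _·_ ks (λ k → f (j * length ks + k)))
lin-concat _·_ zero ks f = refl
lin-concat _·_ (suc r) ks f = trans (lin-++ _·_ ks (concat (replicate r ks)) f) (cong (lin _·_ ks f +ᶻ_)
  (trans (lin-concat _·_ r ks (λ i → f (length ks + i))) (∑-cong r (λ j → lin-cong′ ks (λ k → cong f (sym (ℕₚ.+-assoc (length ks) (j * length ks) k)))))))
  where
  lin-cong′ : ∀ ks {f g} → (∀ i → f i ≡ g i) → lin _·_ ks f ≡ lin _·_ ks g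
  lin-cong′ ks eq = lin-cong _·_ ks (λ x i → cong (x ·_) (eq i))

poly-∑ : ∀ ks r (f : ℕ → ℕ → ℤ) → ∑ r (λ j → poly ks (f j)) ≡ poly ks (λ k → ∑ r (λ j → f j k))
poly-∑ [] r f = ∑-zero r
poly-∑ (c ∷ ks) r f = trans (∑-+ r (λ j → c *ᶻ f j 0) _) (cong₂ _+ᶻ_ (∑-*ˡ r c (λ j → f j 0)) (poly-∑ ks r (λ j → f j ∘ suc)))

grid-∑ : ∀ rs r (F : ℕ → Field) → ∑ r (λ j → grid rs (F j)) ≡ grid rs (λ t m → ∑ r (λ j → F j t m))
grid-∑ [] r F = ∑-zero r
grid-∑ (c ∷ rs) r F = trans (∑-+ r (λ j → poly c (F j 0)) _) (cong₂ _+ᶻ_ (poly-∑ c r (λ j → F j 0)) (grid-∑ rs r (λ j → F j ∘ suc)))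

tile : ℕ → ℕ → List (List ℤ) → List (List ℤ)
tile p r rows = concat (replicate p (map (concat ∘ replicate r) rows))

poly-zero : ∀ ks → poly ks (λ _ → 0ℤ) ≡ 0ℤ
poly-zero ks = lin-* _*ᶻ_ 0ℤ ks {λ _ → 0ℤ} (λ x _ → ℤₚ.*-zeroʳ x)

-- The coefficients depend on residue classes only, so the functional factors through the sums of
-- `F` over these classes.
grid-tile : ∀ p r b rows → All (λ ks → length ks ≡ b) rows → ∀ F →
            (∀ t m → ∑ p (λ i → ∑ r (λ j → F (i * length rows + t) (j * b + m))) ≡ 0ℤ) → grid (tile p r rows) F ≡ 0ℤ
grid-tile p r b rows len F null = begin
  grid (tile p r rows) F
    ≡⟨ lin-concat poly p (map (concat ∘ replicate r) rows) F ⟩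
  ∑ p (λ i → grid (map (concat ∘ replicate r) rows) (λ t → F (i * length (map (concat ∘ replicate r) rows) + t)))
    ≡⟨ grid-∑ (map (concat ∘ replicate r) rows) p _ ⟩
  grid (map (concat ∘ replicate r) rows) G
    ≡⟨ go rows len G (λ t m → trans (swap t m) (null t m)) ⟩
  0ℤ ∎
  where
  open ≡-Reasoning
  G : Field
  G t m = ∑ p (λ i → F (i * length (map (concat ∘ replicate r) rows) + t) m)
  swap : ∀ t m → ∑ r (λ j → G t (j * b + m)) ≡ ∑ p (λ i → ∑ r (λ j → F (i * length rows + t) (j * b + m)))
  swap t m = trans (∑-swap r p _) (∑-cong p (λ i → ∑-cong r (λ j → cong (λ l → F (i * l + t) (j * b + m)) (length-map (concat ∘ replicate r) rows))))
  go : ∀ rows → All (λ ks → length ks ≡ b) rows → ∀ G → (∀ t m → ∑ r (λ j → G t (j * b + m)) ≡ 0ℤ) → grid (map (concat ∘ replicate r) rows) G ≡ 0ℤ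
  go [] [] G eq = refl
  go (ks ∷ rows) (refl ∷ len) G eq = cong₂ _+ᶻ_
    (trans (lin-concat _*ᶻ_ r ks (G 0)) (trans (poly-∑ ks r _) (trans (poly-cong ks (eq 0)) (poly-zero ks))))
    (go rows len (G ∘ suc) (eq ∘ suc))

module Average (n : ℕ) .{{_ : NonZero n}} (s h : ℕ) .{{_ : NonZero h}} (1+sʰ : (1 + s ^ h) % n ≡ 0 % n)
               (bs : List (ℕ × ℕ)) (bs≤ : All (λ g → proj₁ g ≤ h + h) bs)
               (a p b r k : ℕ) (2h≡pa : h + h ≡ p * a) (n≡rb : n ≡ r * b) (sᵃ≡ : s ^ a ≡ 1 + k * b) where
  open Circulant n s h 1+sʰ
  open Spectral n s h 1+sʰ bs bs≤

  -- Right multiplication moves the step a past sᵗ, and sᵃ ≡ 1 modulo b makes Π commute with L ∗_.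
  Π : Field → Field
  Π x t m = ∑ p (λ i → ∑ r (λ j → x (t + i * a) (m + j * b)))

  -- For `a = 4` and `b = 5` these are the functions pulled back from the edges of K₅.
  record Coarse (y : Field) : Set where
    field
      even : Even y
      perₐ : ∀ t m → y (a + t) m ≡ y t m
      perᵦ : ∀ t m → y t (b + m) ≡ y t m
  open Coarse public

  Coarse-shift : ∀ {y} → Coarse y → ∀ i j t m → y (t + i * a) (m + j * b) ≡ y t m
  Coarse-shift {y} c zero zero t m = cong₂ y (ℕₚ.+-identityʳ t) (ℕₚ.+-identityʳ m)
  Coarse-shift {y} c zero (suc j) t m = trans (cong (y (t + 0)) (lemma m b (j * b))) (trans (c .perᵦ (t + 0) (m + j * b)) (Coarse-shift c zero j t m))
    where
    lemma : ∀ m b d → m + (b + d) ≡ b + (m + d)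
    lemma = ℕ-Ring.solve-∀
  Coarse-shift {y} c (suc i) j t m = trans (cong (λ l → y l (m + j * b)) (lemma t a (i * a))) (trans (c .perₐ (t + i * a) (m + j * b)) (Coarse-shift c i j t m))
    where
    lemma : ∀ m b d → m + (b + d) ≡ b + (m + d)
    lemma = ℕ-Ring.solve-∀

  Π-Coarse : ∀ {x} → Even x → Coarse (Π x)
  Π-Coarse {x} e .even .resp t eq = ∑-cong p (λ i → ∑-cong r (λ j → e .resp (t + i * a) (≈-+ {b = j * b} eq refl)))
  Π-Coarse {x} e .even .per t m = ∑-cong p (λ i → ∑-cong r (λ j → trans (cong (λ l → x l (m + j * b)) (ℕₚ.+-assoc h t (i * a))) (e .per (t + i * a) (m + j * b))))
  Π-Coarse {x} e .perₐ t m = trans (∑-cong p (λ i → cong g (lemma a t (i * a))))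
    (∑-shift₁ p (λ i → g (t + i * a)) (trans (cong g (trans (cong (λ l → t + l) (sym 2h≡pa)) (ℕₚ.+-comm t (h + h))))
      (trans (∑-cong r (λ j → double e .per t (m + j * b))) (cong g (sym (ℕₚ.+-identityʳ t))))))
    where
    g : ℕ → ℤ
    g t = ∑ r (λ j → x t (m + j * b))
    lemma : ∀ a t d → a + t + d ≡ t + (a + d)
    lemma = ℕ-Ring.solve-∀
  Π-Coarse {x} e .perᵦ t m = ∑-cong p (λ i → trans (∑-cong r (λ j → cong (x (t + i * a)) (lemma b m (j * b))))
    (∑-shift₁ r (λ j → x (t + i * a) (m + j * b)) (e .resp (t + i * a) (trans (≈-≡ (trans (cong (λ l → m + l) (sym n≡rb)) (trans (ℕₚ.+-comm m n) (cong (λ l → n + l) (sym (ℕₚ.+-identityʳ m)))))) (≈-n+ (m + 0))))))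
    where
    lemma : ∀ a t d → a + t + d ≡ t + (a + d)
    lemma = ℕ-Ring.solve-∀

  S : ℤ
  S = + p *ᶻ + r

  ∑∑-size : ∀ c → ∑ p (λ _ → ∑ r (λ _ → c)) ≡ S *ᶻ c
  ∑∑-size c = trans (∑-cong p (λ _ → ∑-const r c)) (trans (∑-const p (+ r *ᶻ c)) (sym (ℤₚ.*-assoc (+ p) (+ r) c)))

  Π-id : ∀ {y} → Coarse y → ∀ t m → Π y t m ≡ S *ᶻ y t m
  Π-id {y} c t m = trans (∑-cong p (λ i → ∑-cong r (λ j → Coarse-shift c i j t m))) (∑∑-size (y t m))

  ∑∑-translate : ∀ {F : Field} → Periodic (h + h) F → ∀ i j → ∑∑ (λ t m → F (t + i) (m + j)) ≡ ∑∑ F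
  ∑∑-translate {F} pF i j = trans
    (∑-cong (h + h) (λ t → ∑-translate {F} (t + i) (pF .resp (t + i)) j))
    (∑-shift (h + h) (λ t → ∑ n (F t)) (λ t → ∑-cong n (pF .per t)) i)

  ∑∑-∑ : ∀ k (F : ℕ → Field) → ∑∑ (λ t m → ∑ k (λ i → F i t m)) ≡ ∑ k (λ i → ∑∑ (F i))
  ∑∑-∑ k F = trans (∑-cong (h + h) (λ t → ∑-swap n k (λ m i → F i t m))) (∑-swap (h + h) k (λ t i → ∑ n (F i t)))

  -- Translating both factors leaves `u` unchanged. Together with `Π-id` this makes `Π` the
  -- orthogonal projection onto coarse fields, times `S`.
  Π-inner : ∀ {u x} → Coarse u → Even x → ⟪ u , Π x ⟫ ≡ S *ᶻ ⟪ u , x ⟫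
  Π-inner {u} {x} c e = begin
    ⟪ u , Π x ⟫
      ≡⟨ ∑∑-cong (λ t m → trans (sym (∑-*ˡ p (u t m) _)) (∑-cong p (λ i → trans (sym (∑-*ˡ r (u t m) _)) (∑-cong r (λ j → cong (_*ᶻ x (t + i * a) (m + j * b)) (sym (Coarse-shift c i j t m))))))) ⟩
    ∑∑ (λ t m → ∑ p (λ i → ∑ r (λ j → (u · x) (t + i * a) (m + j * b))))
      ≡⟨ trans (∑∑-∑ p _) (∑-cong p (λ i → ∑∑-∑ r _)) ⟩
    ∑ p (λ i → ∑ r (λ j → ∑∑ (λ t m → (u · x) (t + i * a) (m + j * b))))
      ≡⟨ ∑-cong p (λ i → ∑-cong r (λ j → ∑∑-translate (double (·-Periodic (c .even) e)) (i * a) (j * b))) ⟩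
    ∑ p (λ i → ∑ r (λ j → ⟪ u , x ⟫))
      ≡⟨ ∑∑-size ⟪ u , x ⟫ ⟩
    S *ᶻ ⟪ u , x ⟫ ∎
    where open ≡-Reasoning

  ∗-Coarse : ∀ {y} → Coarse y → Coarse (L ∗ y)
  ∗-Coarse {y} c .even = L-Even (c .even)
  ∗-Coarse {y} c .perₐ = go L
    where
    many : ∀ j t m → y t (m + j * b) ≡ y t m
    many j t m = trans (cong (λ l → y l (m + j * b)) (sym (ℕₚ.+-identityʳ t))) (Coarse-shift c 0 j t m)
    lemma : ∀ m k b w μ → m + (1 + k * b) * w * μ ≡ m + w * μ + k * w * μ * b
    lemma = ℕ-Ring.solve-∀
    go : ∀ gs t m → (gs ∗ y) (a + t) m ≡ (gs ∗ y) t m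
    go [] t m = refl
    go ((τ , μ) ∷ gs) t m = cong₂ _+ᶻ_
      (trans (cong₂ y (ℕₚ.+-assoc a t τ) (trans (cong (λ w → m + w * μ) (trans (ℕₚ.^-distribˡ-+-* s a t) (cong (_* s ^ t) sᵃ≡))) (lemma m k b (s ^ t) μ)))
        (trans (c .perₐ (t + τ) _) (many (k * s ^ t * μ) (t + τ) (m + s ^ t * μ))))
      (go gs t m)
  ∗-Coarse {y} c .perᵦ = go L
    where
    go : ∀ gs t m → (gs ∗ y) t (b + m) ≡ (gs ∗ y) t m
    go [] t m = refl
    go ((τ , μ) ∷ gs) t m = cong₂ _+ᶻ_ (trans (cong (y (t + τ)) (ℕₚ.+-assoc b m _)) (c .perᵦ (t + τ) _)) (go gs t m)

  module _ (d : ℤ) where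

    B : Field → Field
    B z t m = d *ᶻ z t m +ᶻ (L ∗ z) t m

    ⟪⟫-B : ∀ u z → ⟪ u , B z ⟫ ≡ d *ᶻ ⟪ u , z ⟫ +ᶻ ⟪ u , L ∗ z ⟫
    ⟪⟫-B u z = trans (⟪⟫-+ʳ u (λ t m → d *ᶻ z t m) (L ∗ z)) (cong (_+ᶻ ⟪ u , L ∗ z ⟫) (⟪⟫-*ʳ d u z))

    B-comm : ∀ {u v} → Even u → Even v → ⟪ u , B v ⟫ ≡ ⟪ v , B u ⟫
    B-comm {u} {v} eu ev = trans (⟪⟫-B u v) (trans
      (cong₂ (λ x y → d *ᶻ x +ᶻ y) (⟪⟫-comm u v) (trans (L-adjoint eu ev) (⟪⟫-comm (L ∗ u) v))) (sym (⟪⟫-B v u)))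

    B-Coarse : ∀ {y} → Coarse y → Coarse (B y)
    B-Coarse c .even .resp t eq = cong₂ (λ x y → d *ᶻ x +ᶻ y) (c .even .resp t eq) (L-Even (c .even) .resp t eq)
    B-Coarse c .even .per t m = cong₂ (λ x y → d *ᶻ x +ᶻ y) (c .even .per t m) (L-Even (c .even) .per t m)
    B-Coarse c .perₐ t m = cong₂ (λ x y → d *ᶻ x +ᶻ y) (c .perₐ t m) (∗-Coarse c .perₐ t m)
    B-Coarse c .perᵦ t m = cong₂ (λ x y → d *ᶻ x +ᶻ y) (c .perᵦ t m) (∗-Coarse c .perᵦ t m)

    -- The component orthogonal to the coarse fields, times `S` to avoid division.
    centre : Field → Field
    centre x t m = S *ᶻ x t m -ᶻ Π x t m

    ∗-centre : ∀ gs x t m → (gs ∗ centre x) t m ≡ S *ᶻ (gs ∗ x) t m -ᶻ (gs ∗ Π x) t m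
    ∗-centre [] x t m = sym (trans (ℤₚ.+-identityʳ _) (ℤₚ.*-zeroʳ S))
    ∗-centre (g ∷ gs) x t m = trans (cong ((centre x ◃ g) t m +ᶻ_) (∗-centre gs x t m)) (lemma S ((x ◃ g) t m) ((Π x ◃ g) t m) ((gs ∗ x) t m) ((gs ∗ Π x) t m))
      where
      lemma : ∀ S x y u v → (S *ᶻ x -ᶻ y) +ᶻ (S *ᶻ u -ᶻ v) ≡ S *ᶻ (x +ᶻ u) -ᶻ (y +ᶻ v)
      lemma = solve-∀

    centre-Even : ∀ {x} → Even x → Even (centre x)
    centre-Even e .resp t eq = cong₂ (λ x y → S *ᶻ x -ᶻ y) (e .resp t eq) (Π-Coarse e .even .resp t eq)
    centre-Even e .per t m = cong₂ (λ x y → S *ᶻ x -ᶻ y) (e .per t m) (Π-Coarse e .even .per t m)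

    Π-centre : ∀ {x} → Even x → ∀ t m → Π (centre x) t m ≡ 0ℤ
    Π-centre {x} e t m = begin
      Π (centre x) t m
        ≡⟨ ∑-cong p (λ i → trans (∑-+ r _ _) (cong₂ _+ᶻ_ (∑-*ˡ r S _) (trans (∑-cong r (λ j → sym (ℤₚ.-1*i≡-i (Π x (t + i * a) (m + j * b))))) (∑-*ˡ r (- 1ℤ) _)))) ⟩
      ∑ p (λ i → S *ᶻ ∑ r (λ j → x (t + i * a) (m + j * b)) +ᶻ - 1ℤ *ᶻ ∑ r (λ j → Π x (t + i * a) (m + j * b)))
        ≡⟨ trans (∑-+ p _ _) (cong₂ _+ᶻ_ (∑-*ˡ p S _) (∑-*ˡ p (- 1ℤ) _)) ⟩
      S *ᶻ Π x t m +ᶻ - 1ℤ *ᶻ Π (Π x) t m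
        ≡⟨ cong (λ w → S *ᶻ Π x t m +ᶻ - 1ℤ *ᶻ w) (Π-id (Π-Coarse e) t m) ⟩
      S *ᶻ Π x t m +ᶻ - 1ℤ *ᶻ (S *ᶻ Π x t m)
        ≡⟨ lemma (S *ᶻ Π x t m) ⟩
      0ℤ ∎
      where
      open ≡-Reasoning
      lemma : ∀ w → w +ᶻ - 1ℤ *ᶻ w ≡ 0ℤ
      lemma = solve-∀

    -- `B` is self-adjoint and preserves coarse fields, so `S` times each cross term is the form at
    -- `Π x`.
    centre-form : ∀ {x} → Even x → ⟪ centre x , B (centre x) ⟫ ≡ S *ᶻ S *ᶻ ⟪ x , B x ⟫ -ᶻ ⟪ Π x , B (Π x) ⟫
    centre-form {x} e = begin
      ⟪ centre x , B (centre x) ⟫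
        ≡⟨ ∑∑-cong (λ t m → trans (cong (λ w → centre x t m *ᶻ (d *ᶻ centre x t m +ᶻ w)) (∗-centre L x t m)) (expand S d (x t m) (y t m) ((L ∗ x) t m) ((L ∗ y) t m))) ⟩
      ∑∑ (λ t m → S *ᶻ S *ᶻ (x · B x) t m +ᶻ (- S *ᶻ (x · B y) t m +ᶻ (- S *ᶻ (y · B x) t m +ᶻ (y · B y) t m)))
        ≡⟨ trans (∑∑-+ _ _) (cong₂ _+ᶻ_ (∑∑-*ˡ (S *ᶻ S) _) (trans (∑∑-+ _ _) (cong₂ _+ᶻ_ (∑∑-*ˡ (- S) _) (trans (∑∑-+ _ _) (cong (_+ᶻ ⟪ y , B y ⟫) (∑∑-*ˡ (- S) _)))))) ⟩
      S *ᶻ S *ᶻ ⟪ x , B x ⟫ +ᶻ (- S *ᶻ ⟪ x , B y ⟫ +ᶻ (- S *ᶻ ⟪ y , B x ⟫ +ᶻ ⟪ y , B y ⟫))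
        ≡⟨ cong₂ (λ v w → S *ᶻ S *ᶻ ⟪ x , B x ⟫ +ᶻ (v +ᶻ (w +ᶻ ⟪ y , B y ⟫))) cross (trans (cong (- S *ᶻ_) (B-comm ey e)) cross) ⟩
      S *ᶻ S *ᶻ ⟪ x , B x ⟫ +ᶻ (- ⟪ y , B y ⟫ +ᶻ (- ⟪ y , B y ⟫ +ᶻ ⟪ y , B y ⟫))
        ≡⟨ collect (S *ᶻ S *ᶻ ⟪ x , B x ⟫) ⟪ y , B y ⟫ ⟩
      S *ᶻ S *ᶻ ⟪ x , B x ⟫ -ᶻ ⟪ y , B y ⟫ ∎
      where
      open ≡-Reasoning
      y = Π x
      ey = Π-Coarse e .even
      cross : - S *ᶻ ⟪ x , B y ⟫ ≡ - ⟪ y , B y ⟫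
      cross = trans (sym (ℤₚ.neg-distribˡ-* S _)) (cong -_ (trans (cong (S *ᶻ_) (⟪⟫-comm x (B y)))
        (trans (sym (Π-inner (B-Coarse (Π-Coarse e)) e)) (⟪⟫-comm (B y) y))))
      expand : ∀ S d x y u v → (S *ᶻ x -ᶻ y) *ᶻ (d *ᶻ (S *ᶻ x -ᶻ y) +ᶻ (S *ᶻ u -ᶻ v)) ≡
               S *ᶻ S *ᶻ (x *ᶻ (d *ᶻ x +ᶻ u)) +ᶻ (- S *ᶻ (x *ᶻ (d *ᶻ y +ᶻ v)) +ᶻ (- S *ᶻ (y *ᶻ (d *ᶻ x +ᶻ u)) +ᶻ y *ᶻ (d *ᶻ y +ᶻ v)))
      expand = solve-∀
      collect : ∀ a b → a +ᶻ (- b +ᶻ (- b +ᶻ b)) ≡ a -ᶻ b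
      collect = solve-∀

-- Whether the edge of K₅ in class (τ , μ) shares exactly one endpoint with the one in class (0 , 0).
touching : ℕ → ℕ → Bool
touching 0 1 = true
touching 0 4 = true
touching 1 1 = true
touching 1 2 = true
touching 1 3 = true
touching 1 4 = true
touching _ _ = false

over : List (ℕ × ℕ) → (ℕ × ℕ → ℤ) → ℤ
over [] c = 0ℤ
over (g ∷ gs) c = c g +ᶻ over gs c

-- The quadratic form on K₅ and rigidity of its zeros

module Rigid (n : ℕ) .{{_ : NonZero n}} (s h : ℕ) .{{_ : NonZero h}} (1+sʰ : (1 + s ^ h) % n ≡ 0 % n)
             (bs : List (ℕ × ℕ)) (bs≤ : All (λ g → proj₁ g ≤ h + h) bs)
             (p r k : ℕ) .{{_ : NonZero p}} .{{_ : NonZero r}} (2h≡4p : h + h ≡ p * 4) (n≡5r : n ≡ r * 5) (s⁴≡ : s ^ 4 ≡ 1 + k * 5)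
             (h≡2p : h ≡ p * 2) (p½ : ℕ) (p-odd : 2 * p½ ≡ 1 + p * 1) (1<n : 1 % n ≡ 1)
             (s≡3 : s % 5 ≡ 3) (sʰ≡4 : s ^ h % 5 ≡ 4) (h≡2 : h % 4 ≡ 2) (0<h : 1 ≤ h + h)
             (inv₁ : (h + h ∸ 1) % 2 ≡ 1) (inv₂ : s ^ h * (s ^ (h + h ∸ 1) * 1) % 5 ≡ 3) where
  open Circulant n s h 1+sʰ
  open Spectral n s h 1+sʰ bs bs≤
  open Average n s h 1+sʰ bs bs≤ 4 p 5 r k 2h≡4p n≡5r s⁴≡

  -- The four translations that come from one generator have equal correlations on an even field.
  cor-signed : ∀ {x} → Even x → ∀ {gs} → All (λ g → proj₁ g ≤ h + h) gs →
               ⟪ x , paired (signed gs) ∗ x ⟫ ≡ + 4 *ᶻ over gs (λ g → ⟪ x , x ◃ g ⟫)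
  cor-signed {x} e [] = ⟪⟫-*ʳ 0ℤ x (λ _ _ → 0ℤ)
  cor-signed {x} e {g@(τ , μ) ∷ gs} (τ≤ ∷ τs) = begin
    ⟪ x , paired (signed (g ∷ gs)) ∗ x ⟫
      ≡⟨ trans (⟪⟫-+ʳ x (x ◃ g) _) (cong (⟪ x , x ◃ g ⟫ +ᶻ_) (trans (⟪⟫-+ʳ x (x ◃ inv g) _) (cong (⟪ x , x ◃ inv g ⟫ +ᶻ_)
           (trans (⟪⟫-+ʳ x (x ◃ neg g) _) (cong (⟪ x , x ◃ neg g ⟫ +ᶻ_) (⟪⟫-+ʳ x (x ◃ inv (neg g)) _)))))) ⟩
    c +ᶻ (⟪ x , x ◃ inv g ⟫ +ᶻ (⟪ x , x ◃ neg g ⟫ +ᶻ (⟪ x , x ◃ inv (neg g) ⟫ +ᶻ ⟪ x , paired (signed gs) ∗ x ⟫)))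
      ≡⟨ cong (c +ᶻ_) (cong₂ _+ᶻ_ (cor-inv e μ τ≤) (cong₂ _+ᶻ_ (cor-neg e g)
           (cong₂ _+ᶻ_ (trans (cor-inv e (s ^ h * μ) τ≤) (cor-neg e g)) (cor-signed e τs)))) ⟩
    c +ᶻ (c +ᶻ (c +ᶻ (c +ᶻ + 4 *ᶻ over gs (λ g → ⟪ x , x ◃ g ⟫))))
      ≡⟨ lemma c _ ⟩
    + 4 *ᶻ over (g ∷ gs) (λ g → ⟪ x , x ◃ g ⟫) ∎
    where
    open ≡-Reasoning
    c = ⟪ x , x ◃ g ⟫
    lemma : ∀ c w → c +ᶻ (c +ᶻ (c +ᶻ (c +ᶻ + 4 *ᶻ w))) ≡ + 4 *ᶻ (c +ᶻ w)
    lemma = solve-∀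

  cor-L : ∀ {x} → Even x → ⟪ x , L ∗ x ⟫ ≡ + 2 *ᶻ ⟪ x , x ◃ (0 , 1) ⟫ +ᶻ + 4 *ᶻ over bs (λ g → ⟪ x , x ◃ g ⟫)
  cor-L {x} e = trans (trans (⟪⟫-+ʳ x (x ◃ (0 , 1)) _) (cong (⟪ x , x ◃ (0 , 1) ⟫ +ᶻ_) (⟪⟫-+ʳ x (x ◃ inv (0 , 1)) _)))
    (trans (cong₂ (λ v w → ⟪ x , x ◃ (0 , 1) ⟫ +ᶻ (v +ᶻ w)) (cor-inv e 1 z≤n) (cor-signed e bs≤)) (lemma ⟪ x , x ◃ (0 , 1) ⟫ _))
    where
    lemma : ∀ c w → c +ᶻ (c +ᶻ w) ≡ + 2 *ᶻ c +ᶻ w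
    lemma = solve-∀

  module _ {y : Field} (cy : Coarse y) where

    -- The periods `h` and 4 combine, as `h` is 2 modulo 4. In K₅ the reason is that 3² is -1 modulo
    -- 5, which only reverses edges.
    by-2 : ∀ t m → y (2 + t) m ≡ y t m
    by-2 t m = trans (sym (Coarse-shift cy (h / 4) 0 (2 + t) m)) (trans
      (cong₂ y (trans (lemma t (h / 4 * 4)) (cong (_+ t) (trans (cong (_+ h / 4 * 4) (sym h≡2)) (sym (m≡m%n+[m/n]*n h 4))))) (ℕₚ.+-identityʳ m))
      (cy .even .per t m))
      where
      lemma : ∀ t w → 2 + t + w ≡ 2 + w + t
      lemma = ℕ-Ring.solve-∀

    residue : ∀ t m → y t m ≡ y (t % 2) (m % 5)
    residue t m = trans (cong₂ y (m≡m%n+[m/n]*n t 2) (m≡m%n+[m/n]*n m 5)) (go (t / 2) (t % 2))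
      where
      go : ∀ i t → y (t + i * 2) (m % 5 + m / 5 * 5) ≡ y t (m % 5)
      go zero t = trans (cong (λ i → y i (m % 5 + m / 5 * 5)) (sym (ℕₚ.+-assoc t 0 0))) (trans (Coarse-shift cy 0 (m / 5) (t + 0) (m % 5)) (cong (λ i → y i (m % 5)) (ℕₚ.+-identityʳ t)))
      go (suc i) t = trans (cong (λ j → y j (m % 5 + m / 5 * 5)) (lemma t (i * 2))) (trans (by-2 (t + i * 2) _) (go i t))
        where
        lemma : ∀ t w → t + (2 + w) ≡ 2 + (t + w)
        lemma = ℕ-Ring.solve-∀

    coarse-cong : ∀ {t t′ m m′} → t % 2 ≡ t′ % 2 → m % 5 ≡ m′ % 5 → y t m ≡ y t′ m′
    coarse-cong {t} {t′} {m} {m′} p q = trans (residue t m) (trans (cong₂ y p q) (sym (residue t′ m′)))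

    +-cong-% : ∀ d .{{_ : NonZero d}} {a a′ b b′} → a % d ≡ a′ % d → b % d ≡ b′ % d → (a + b) % d ≡ (a′ + b′) % d
    +-cong-% d {a} {a′} {b} {b′} p q = trans (%-distribˡ-+ a b d) (trans (cong₂ (λ x y → (x + y) % d) p q) (sym (%-distribˡ-+ a′ b′ d)))

    *-cong-% : ∀ d .{{_ : NonZero d}} {a a′ b b′} → a % d ≡ a′ % d → b % d ≡ b′ % d → (a * b) % d ≡ (a′ * b′) % d
    *-cong-% d {a} {a′} {b} {b′} p q = trans (%-distribˡ-* a b d) (trans (cong₂ (λ x y → (x * y) % d) p q) (sym (%-distribˡ-* a′ b′ d)))

    ◃-coarse : ∀ {τ τ′ μ μ′} → τ % 2 ≡ τ′ % 2 → μ % 5 ≡ μ′ % 5 → ∀ t m → (y ◃ (τ , μ)) t m ≡ (y ◃ (τ′ , μ′)) t m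
    ◃-coarse {τ} {τ′} {μ} {μ′} p q t m = coarse-cong (+-cong-% 2 {t} {t} {τ} {τ′} refl p)
      (+-cong-% 5 {m} {m} {s ^ t * μ} {s ^ t * μ′} refl (*-cong-% 5 {s ^ t} {s ^ t} {μ} {μ′} refl q))

    c : ℕ → ℕ → ℤ
    c τ μ = ⟪ y , y ◃ (τ , μ) ⟫

    c-cong : ∀ {τ τ′ μ μ′} → τ % 2 ≡ τ′ % 2 → μ % 5 ≡ μ′ % 5 → c τ μ ≡ c τ′ μ′
    c-cong p q = ⟪⟫-congʳ {y} (◃-coarse p q)

    c-neg : ∀ τ μ μ′ → (4 * μ) % 5 ≡ μ′ % 5 → c τ μ ≡ c τ μ′
    c-neg τ μ μ′ q = trans (sym (cor-neg (cy .even) (τ , μ))) (c-cong {τ} refl (trans (*-cong-% 5 {s ^ h} {4} {μ} {μ} sʰ≡4 refl) q))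

    -- Negation identifies the classes 1, 4 and the classes 2, 3. Inversion sends `(1 , 1)` to the
    -- class of `(1 , 3)` and so joins the two pairs.
    c₁₂ : c 1 2 ≡ c 1 1
    c₁₂ = trans (c-neg 1 2 3 refl) (trans (sym (c-cong inv₁ inv₂)) (cor-inv (cy .even) 1 0<h))

    c-rel : ∀ τ μ τ′ μ′ τ″ μ″ → (τ + τ′) % 2 ≡ τ″ % 2 → (μ + s ^ τ * μ′) % 5 ≡ μ″ % 5 → ⟪ y ◃ (τ , μ) , y ◃ (τ″ , μ″) ⟫ ≡ c τ′ μ′
    c-rel τ μ τ′ μ′ τ″ μ″ p q = trans
      (⟪⟫-congʳ {y ◃ (τ , μ)} (λ t m → sym (trans (◃-∘ y τ′ μ′ τ μ t m) (◃-coarse p q t m))))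
      (∑∑-◃ (double (·-Periodic (cy .even) (cy .even)) ▹ (τ′ , μ′)) (τ , μ))
      where
      _▹_ : Periodic (h + h) (y · y) → ∀ g → Periodic (h + h) (y · (y ◃ g))
      _ ▹ g = ·-Periodic (double (cy .even)) (◃-Periodic (double (cy .even)) g)

    -- Each edge of K₅ shares an endpoint v with three others; the sum of y over the edges at v, squared
    -- and summed over all (edge, v), is the quadratic form of A(K₅) + 2 up to a factor.
    vertex-≥0 : 0ℤ ≤ᶻ c 0 0 +ᶻ c 0 1 +ᶻ + 2 *ᶻ c 1 1
    vertex-≥0 = ℤₚ.*-cancelˡ-≤-pos 0ℤ _ (+ 4) (subst₂ _≤ᶻ_ (sym (ℤₚ.*-zeroʳ (+ 4))) eq (⟪⟫-≥0 w))
      where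
      open ≡-Reasoning
      -- With `(t , m)` as the edge from m + 3ᵗ · 3 to m + 3ᵗ · 2 modulo 5, the four translations
      -- are the edges from 3 to 4, 0, 1 and, for `y₀`, 2.
      y₁ = y ◃ (0 , 1)
      y₂ = y ◃ (1 , 4)
      y₃ = y ◃ (1 , 2)
      y₀ = y ◃ (0 , 0)
      w : Field
      w t m = y₀ t m +ᶻ y₁ t m +ᶻ y₂ t m +ᶻ y₃ t m
      square : ∀ a b c d → (a +ᶻ b +ᶻ c +ᶻ d) *ᶻ (a +ᶻ b +ᶻ c +ᶻ d) ≡
        (a *ᶻ a +ᶻ (b *ᶻ b +ᶻ (c *ᶻ c +ᶻ d *ᶻ d))) +ᶻ + 2 *ᶻ (a *ᶻ b +ᶻ (a *ᶻ c +ᶻ (a *ᶻ d +ᶻ (b *ᶻ c +ᶻ (b *ᶻ d +ᶻ c *ᶻ d)))))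
      square = solve-∀
      collect : ∀ a b c → (a +ᶻ (a +ᶻ (a +ᶻ a))) +ᶻ + 2 *ᶻ (b +ᶻ (c +ᶻ (c +ᶻ (c +ᶻ (c +ᶻ b))))) ≡ + 4 *ᶻ (a +ᶻ b +ᶻ + 2 *ᶻ c)
      collect = solve-∀
      s≡ : ∀ x → (x + s ^ 1 * 1) % 5 ≡ (x + 3) % 5
      s≡ x = +-cong-% 5 {x} {x} {s ^ 1 * 1} {3} refl (trans (cong (_% 5) (trans (ℕₚ.*-identityʳ (s ^ 1)) (ℕₚ.*-identityʳ s))) s≡3)
      same : ∀ τ μ → ⟪ y ◃ (τ , μ) , y ◃ (τ , μ) ⟫ ≡ c 0 0
      same τ μ = c-rel τ μ 0 0 τ μ (cong (_% 2) (ℕₚ.+-identityʳ τ)) (cong (_% 5) (trans (cong (λ k → μ + k) (ℕₚ.*-zeroʳ (s ^ τ))) (ℕₚ.+-identityʳ μ)))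
      c₁₄ : c 1 4 ≡ c 1 1
      c₁₄ = c-neg 1 4 1 refl
      c₁₃ : c 1 3 ≡ c 1 1
      c₁₃ = trans (c-neg 1 3 2 refl) c₁₂
      eq : ⟪ w , w ⟫ ≡ + 4 *ᶻ (c 0 0 +ᶻ c 0 1 +ᶻ + 2 *ᶻ c 1 1)
      eq = begin
        ⟪ w , w ⟫
          ≡⟨ ∑∑-cong (λ t m → square (y₀ t m) (y₁ t m) (y₂ t m) (y₃ t m)) ⟩
        ∑∑ (λ t m → ((y₀ · y₀) t m +ᶻ ((y₁ · y₁) t m +ᶻ ((y₂ · y₂) t m +ᶻ (y₃ · y₃) t m)))
          +ᶻ + 2 *ᶻ ((y₀ · y₁) t m +ᶻ ((y₀ · y₂) t m +ᶻ ((y₀ · y₃) t m +ᶻ ((y₁ · y₂) t m +ᶻ ((y₁ · y₃) t m +ᶻ (y₂ · y₃) t m))))))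
          ≡⟨ trans (∑∑-+ _ _) (cong₂ _+ᶻ_
               (trans (∑∑-+ _ _) (cong₂ _+ᶻ_ (same 0 0) (trans (∑∑-+ _ _) (cong₂ _+ᶻ_ (same 0 1) (trans (∑∑-+ _ _) (cong₂ _+ᶻ_ (same 1 4) (same 1 2)))))))
               (trans (∑∑-*ˡ (+ 2) _) (cong (+ 2 *ᶻ_)
                 (trans (∑∑-+ _ _) (cong₂ _+ᶻ_ (c-rel 0 0 0 1 0 1 refl refl)
                 (trans (∑∑-+ _ _) (cong₂ _+ᶻ_ (trans (c-rel 0 0 1 4 1 4 refl refl) c₁₄)
                 (trans (∑∑-+ _ _) (cong₂ _+ᶻ_ (trans (c-rel 0 0 1 2 1 2 refl refl) c₁₂)
                 (trans (∑∑-+ _ _) (cong₂ _+ᶻ_ (trans (c-rel 0 1 1 3 1 4 refl refl) c₁₃)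
                 (trans (∑∑-+ _ _) (cong₂ _+ᶻ_ (c-rel 0 1 1 1 1 2 refl refl)
                 (c-rel 1 4 0 1 1 2 refl (s≡ 4))))))))))))))) ⟩
        (c 0 0 +ᶻ (c 0 0 +ᶻ (c 0 0 +ᶻ c 0 0))) +ᶻ + 2 *ᶻ (c 0 1 +ᶻ (c 1 1 +ᶻ (c 1 1 +ᶻ (c 1 1 +ᶻ (c 1 1 +ᶻ c 0 1)))))
          ≡⟨ collect (c 0 0) (c 0 1) (c 1 1) ⟩
        + 4 *ᶻ (c 0 0 +ᶻ c 0 1 +ᶻ + 2 *ᶻ c 1 1) ∎

    c-class : ∀ τ μ → touching (τ % 2) (μ % 5) ≡ true → c τ μ ≡ c (τ % 2) 1
    c-class τ μ ok = trans (c-cong {τ} {τ % 2} (sym (m%n%n≡m%n τ 2)) (sym (m%n%n≡m%n μ 5))) (cases (τ % 2) (μ % 5) ok)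
      where
      cases : ∀ τ μ → touching τ μ ≡ true → c τ μ ≡ c τ 1
      cases 0 1 _ = refl
      cases 0 4 _ = c-neg 0 4 1 refl
      cases 1 1 _ = refl
      cases 1 2 _ = c₁₂
      cases 1 3 _ = trans (c-neg 1 3 2 refl) c₁₂
      cases 1 4 _ = c-neg 1 4 1 refl

    over-class : ∀ {gs} → All (λ g → touching (proj₁ g % 2) (proj₂ g % 5) ≡ true) gs →
                 over gs (λ g → ⟪ y , y ◃ g ⟫) ≡ over gs (λ g → c (proj₁ g % 2) 1)
    over-class [] = refl
    over-class {(τ , μ) ∷ gs} (ok ∷ oks) = cong₂ _+ᶻ_ (c-class τ μ ok) (over-class oks)

  -- On coarse fields A is 7 A(K₅): the classes of `(0 , 1)` and `(1 , 1)` receive 2 + 4 · 3 = 14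
  -- and 4 · 7 = 28 translations, against 2 and 4 in K₅. The constant 14 is thus 7 · 2.
  form-≥0 : ∀ {y} → Coarse y → All (λ g → touching (proj₁ g % 2) (proj₂ g % 5) ≡ true) bs →
            (∀ (c : ℕ → ℤ) → over bs (λ g → c (proj₁ g % 2)) ≡ + 3 *ᶻ c 0 +ᶻ + 7 *ᶻ c 1) → 0ℤ ≤ᶻ ⟪ y , B (+ 14) y ⟫
  form-≥0 {y} cy ok count = subst (0ℤ ≤ᶻ_) (sym eq) (subst (_≤ᶻ + 14 *ᶻ v) (ℤₚ.*-zeroʳ (+ 14)) (ℤₚ.*-monoˡ-≤-nonNeg (+ 14) (vertex-≥0 cy)))
    where
    open ≡-Reasoning
    v = c cy 0 0 +ᶻ c cy 0 1 +ᶻ + 2 *ᶻ c cy 1 1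
    collect : ∀ a b c → + 14 *ᶻ a +ᶻ (+ 2 *ᶻ b +ᶻ + 4 *ᶻ (+ 3 *ᶻ b +ᶻ + 7 *ᶻ c)) ≡ + 14 *ᶻ (a +ᶻ b +ᶻ + 2 *ᶻ c)
    collect = solve-∀
    eq : ⟪ y , B (+ 14) y ⟫ ≡ + 14 *ᶻ v
    eq = begin
      ⟪ y , B (+ 14) y ⟫
        ≡⟨ ⟪⟫-B (+ 14) y y ⟩
      + 14 *ᶻ ⟪ y , y ⟫ +ᶻ ⟪ y , L ∗ y ⟫
        ≡⟨ cong₂ (λ a b → + 14 *ᶻ a +ᶻ b) (sym (cor-00 y y))
             (trans (cor-L (cy .even)) (cong (λ w → + 2 *ᶻ c cy 0 1 +ᶻ + 4 *ᶻ w) (trans (over-class cy ok) (count (λ τ → c cy τ 1))))) ⟩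
      + 14 *ᶻ c cy 0 0 +ᶻ (+ 2 *ᶻ c cy 0 1 +ᶻ + 4 *ᶻ (+ 3 *ᶻ c cy 0 1 +ᶻ + 7 *ᶻ c cy 1 1))
        ≡⟨ collect (c cy 0 0) (c cy 0 1) (c cy 1 1) ⟩
      + 14 *ᶻ v ∎

  ≈1⇒ : ∀ {w} → w ≈ 1 → w ≡ 1 + r * (w / n * 5)
  ≈1⇒ {w} eq = trans (m≡m%n+[m/n]*n w n) (cong₂ _+_ (trans eq 1<n) (trans (cong (w / n *_) n≡5r) (lemma (w / n) r)))
    where
    lemma : ∀ q r → q * (r * 5) ≡ r * (q * 5)
    lemma = ℕ-Ring.solve-∀

  sᵗ-inverse : ∀ t → s ^ t * s ^ ((h + h ∸ 1) * t) ≈ 1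
  sᵗ-inverse t = trans (≈-≡ (trans (sym (ℕₚ.^-distribˡ-+-* s t ((h + h ∸ 1) * t))) (cong (λ l → s ^ (l * t)) (ℕₚ.m+[n∸m]≡n 0<h)))) (go t)
    where
    go : ∀ t → s ^ ((h + h) * t) ≈ 1
    go zero = ≈-≡ (cong (s ^_) (ℕₚ.*-zeroʳ (h + h)))
    go (suc t) = trans (≈-≡ (trans (cong (s ^_) (ℕₚ.*-suc (h + h) t)) (ℕₚ.^-distribˡ-+-* s (h + h) ((h + h) * t)))) (trans (s²ʰx≈x _) (go t))

  cor-tile : ∀ {z} → Even z → (∀ t m → Π z t m ≡ 0ℤ) → ∀ t m → ∑ p (λ i → ∑ r (λ j → cor z z (i * 2 + t) (j * 5 + m))) ≡ 0ℤ
  cor-tile {z} e null t₀ m₀ = begin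
    ∑ p (λ i → ∑ r (λ j → cor z z (i * 2 + t₀) (j * 5 + m₀)))
      ≡⟨ trans (∑∑-∑ p _) (∑-cong p (λ i → ∑∑-∑ r _)) ⟨
    ∑∑ (λ t m → ∑ p (λ i → ∑ r (λ j → z t m *ᶻ z (t + (i * 2 + t₀)) (m + s ^ t * (j * 5 + m₀)))))
      ≡⟨ ∑∑-cong (λ t m → trans (trans (∑-cong p (λ i → ∑-*ˡ r (z t m) _)) (∑-*ˡ p (z t m) _)) (trans (cong (z t m *ᶻ_) (inner t m)) (ℤₚ.*-zeroʳ (z t m)))) ⟩
    ∑∑ (λ t m → 0ℤ)
      ≡⟨ ∑∑-*ˡ 0ℤ (λ _ _ → 0ℤ) ⟩
    0ℤ ∎
    where
    open ≡-Reasoning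
    inner : ∀ t m → ∑ p (λ i → ∑ r (λ j → z (t + (i * 2 + t₀)) (m + s ^ t * (j * 5 + m₀)))) ≡ 0ℤ
    inner t m = begin
      ∑ p (λ i → ∑ r (λ j → z (t + (i * 2 + t₀)) (m + s ^ t * (j * 5 + m₀))))
        ≡⟨ ∑-cong p (λ i → ∑-cong r (λ j → cong₂ z (t-eq t i t₀) (m-eq m (s ^ t) j m₀))) ⟩
      ∑ p (λ i → ∑ r (λ j → z (t₁ + i * 2) (m₁ + s ^ t * j * 5)))
        -- Multiplication by `s ^ t` permutes the residues modulo `r`, since `s ^ t` is invertible
        -- modulo `n`.
        ≡⟨ ∑-cong p (λ i → ∑-step r (λ j → z (t₁ + i * 2) (m₁ + j * 5)) (λ j → e .resp (t₁ + i * 2) (wrap-r j)) (s ^ t) (s ^ ((h + h ∸ 1) * t)) _ (≈1⇒ (sᵗ-inverse t))) ⟩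
      ∑ p (λ i → row (t₁ + i * 2))
        -- The correlation moves `t` in steps of 2 and `Π` in steps of 4. By evenness the steps of 2
        -- have period `p`, which is odd, so doubling permutes them.
        ≡⟨ ∑-step p (λ i → row (t₁ + i * 2)) wrap-p 2 p½ 1 p-odd ⟨
      ∑ p (λ i → row (t₁ + 2 * i * 2))
        ≡⟨ ∑-cong p (λ i → cong (λ l → row (t₁ + l)) (four i)) ⟩
      Π z t₁ m₁
        ≡⟨ null t₁ m₁ ⟩
      0ℤ ∎
      where
      t₁ = t + t₀
      m₁ = m + s ^ t * m₀
      row : ℕ → ℤ
      row t = ∑ r (λ j → z t (m₁ + j * 5))
      t-eq : ∀ t i t₀ → t + (i * 2 + t₀) ≡ t + t₀ + i * 2
      t-eq = ℕ-Ring.solve-∀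
      m-eq : ∀ m a j m₀ → m + a * (j * 5 + m₀) ≡ m + a * m₀ + a * j * 5
      m-eq = ℕ-Ring.solve-∀
      four : ∀ i → 2 * i * 2 ≡ i * 4
      four = ℕ-Ring.solve-∀
      wrap-r : ∀ j → m₁ + (r + j) * 5 ≈ m₁ + j * 5
      wrap-r j = trans (≈-≡ (trans (lemma m₁ r j) (cong (_+ (m₁ + j * 5)) (sym n≡5r)))) (≈-n+ (m₁ + j * 5))
        where
        lemma : ∀ m₁ r j → m₁ + (r + j) * 5 ≡ r * 5 + (m₁ + j * 5)
        lemma = ℕ-Ring.solve-∀
      wrap-p : ∀ i → row (t₁ + (p + i) * 2) ≡ row (t₁ + i * 2)
      wrap-p i = ∑-cong r (λ j → trans (cong (λ l → z l (m₁ + j * 5)) (trans (lemma t₁ p i) (cong (_+ (t₁ + i * 2)) (sym h≡2p)))) (e .per (t₁ + i * 2) (m₁ + j * 5)))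
        where
        lemma : ∀ t₁ p i → t₁ + (p + i) * 2 ≡ p * 2 + (t₁ + i * 2)
        lemma = ℕ-Ring.solve-∀

  null-norm : ∀ {z} → Even z → ⟪ z , z ⟫ ≤ᶻ 0ℤ → ∀ t m → z t m ≡ 0ℤ
  null-norm {z} e le t m = trans (sym (trans (Even-mod e t 0 (m % n)) (e .resp t (≈-% m))))
    (trans (cong (λ l → z l (m % n)) (ℕₚ.+-identityʳ (t % h))) (root (z (t % h) (m % n)) (∑≤0⇒≡0 n (λ i → 0≤x*x (z (t % h) i)) (ℤₚ.≤-reflexive
      (∑≤0⇒≡0 (h + h) (λ i → ∑-≥0 n (λ j → 0≤x*x (z i j))) le (t % h) (ℕₚ.<-≤-trans (m%n<n t h) (ℕₚ.m≤m+n h h)))) (m % n) (m%n<n m n))))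
    where
    root : ∀ x → x *ᶻ x ≡ 0ℤ → x ≡ 0ℤ
    root x eq with ℤₚ.i*j≡0⇒i≡0∨j≡0 x eq
    ... | inj₁ p = p
    ... | inj₂ p = p

  -- Where the form vanishes, `centre-form` and `form-≥0` leave a nonpositive form on the centred
  -- part, and the gap forces that part to be zero.
  rigid : All (λ g → touching (proj₁ g % 2) (proj₂ g % 5) ≡ true) bs →
          (∀ (c : ℕ → ℤ) → over bs (λ g → c (proj₁ g % 2)) ≡ + 3 *ᶻ c 0 +ᶻ + 7 *ᶻ c 1) →
          (∀ {z} → Even z → (∀ t m → Π z t m ≡ 0ℤ) → ⟪ z , B (+ 14) z ⟫ ≤ᶻ 0ℤ → ⟪ z , z ⟫ ≤ᶻ 0ℤ) →
          ∀ {x} → Even x → ⟪ x , B (+ 14) x ⟫ ≡ 0ℤ → ∀ {t t′ m m′} → t % 2 ≡ t′ % 2 → m % 5 ≡ m′ % 5 → x t m ≡ x t′ m′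
  rigid ok count gap {x} e form {t} {t′} {m} {m′} t≡ m≡ = ℤₚ.*-cancelˡ-≡ S _ _ {{S≢0}} (begin
    S *ᶻ x t m      ≡⟨ mean t m ⟩
    Π x t m         ≡⟨ coarse-cong (Π-Coarse e) t≡ m≡ ⟩
    Π x t′ m′       ≡⟨ mean t′ m′ ⟨
    S *ᶻ x t′ m′    ∎)
    where
    open ≡-Reasoning
    S≢0 : ℤ.NonZero S
    S≢0 = ℤₚ.i*j≢0 (+ p) (+ r)
    z = centre (+ 14) x
    ez = centre-Even (+ 14) e
    negative : ⟪ z , B (+ 14) z ⟫ ≤ᶻ 0ℤ
    negative = subst (_≤ᶻ 0ℤ) (sym (trans (centre-form (+ 14) e) (cong (λ w → S *ᶻ S *ᶻ w -ᶻ ⟪ Π x , B (+ 14) (Π x) ⟫) form)))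
      (subst (_≤ᶻ 0ℤ) (sym (trans (cong (_-ᶻ ⟪ Π x , B (+ 14) (Π x) ⟫) (ℤₚ.*-zeroʳ (S *ᶻ S))) (ℤₚ.+-identityˡ _))) (ℤₚ.neg-mono-≤ (form-≥0 (Π-Coarse e) ok count)))
    mean : ∀ t m → S *ᶻ x t m ≡ Π x t m
    mean t m = ℤₚ.i-j≡0⇒i≡j _ _ (null-norm ez (gap ez (Π-centre (+ 14) e) negative) t m)

-- Colourings without monochromatic triangles

nae : Bool → Bool → Bool → Bool
nae true true true = false
nae false false false = false
nae _ _ _ = true

nae-swap₁₂ : ∀ a b c → nae a b c ≡ nae b a c
nae-swap₁₂ true true c = refl
nae-swap₁₂ true false c = refl
nae-swap₁₂ false true c = refl
nae-swap₁₂ false false c = refl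

nae-swap₂₃ : ∀ a b c → nae a b c ≡ nae a c b
nae-swap₂₃ true true true = refl
nae-swap₂₃ true true false = refl
nae-swap₂₃ true false true = refl
nae-swap₂₃ true false false = refl
nae-swap₂₃ false true true = refl
nae-swap₂₃ false true false = refl
nae-swap₂₃ false false true = refl
nae-swap₂₃ false false false = refl

sgn : Bool → ℤ
sgn true = 1ℤ
sgn false = - 1ℤ

sgn-injective : ∀ {a b} → sgn a ≡ sgn b → a ≡ b
sgn-injective {true} {true} eq = refl
sgn-injective {false} {false} eq = refl

-- The value is -1, written as a square so that summation gives the negative norm without counting
-- edges.
sgn-nae : ∀ a b c → nae a b c ≡ true → sgn a *ᶻ sgn b +ᶻ (sgn a *ᶻ sgn c +ᶻ sgn b *ᶻ sgn c) ≡ - (sgn a *ᶻ sgn a)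
sgn-nae true true false _ = refl
sgn-nae true false true _ = refl
sgn-nae true false false _ = refl
sgn-nae false true true _ = refl
sgn-nae false true false _ = refl
sgn-nae false false true _ = refl

-- Refuting not-all-equal clauses by branching

Clause : Set
Clause = ℕ × ℕ × ℕ

nae-at : (ℕ → Bool) → Clause → Set
nae-at α (i , j , k) = nae (α i) (α j) (α k) ≡ true

_‼_ : List Bool → ℕ → Maybe Bool
[] ‼ i = nothing
(b ∷ bs) ‼ zero = just b
(b ∷ bs) ‼ suc i = bs ‼ i

-- A clause with an unassigned variable counts as not violated, so the test is sound for every
-- extension of the prefix.
violated : List Bool → List Clause → Bool
violated bs [] = false
violated bs ((i , j , k) ∷ cs) with bs ‼ i | bs ‼ j | bs ‼ k
... | just a | just b | just c = go (nae a b c)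
  where
  go : Bool → Bool
  go true = violated bs cs
  go false = true
... | _ | _ | _ = violated bs cs

-- The result of the test is an argument of `branch`, so that soundness can replace it by `false`
-- before the case distinction.
refutes : List Clause → ℕ → List Bool → Bool
branch : List Clause → ℕ → List Bool → Bool → Bool
refutes cs k bs = branch cs k bs (violated bs cs)
branch cs k bs true = true
branch cs zero bs false = false
branch cs (suc k) bs false = refutes cs k (bs ++ true ∷ []) ∧ refutes cs k (bs ++ false ∷ [])

Prefix : (ℕ → Bool) → List Bool → Set
Prefix α bs = ∀ i {b} → bs ‼ i ≡ just b → α i ≡ b

Prefix-∷ʳ : ∀ {α bs} → Prefix α bs → Prefix α (bs ++ α (length bs) ∷ [])
Prefix-∷ʳ {α} {[]} pre zero refl = refl
Prefix-∷ʳ {α} {x ∷ bs} pre zero refl = pre 0 refl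
Prefix-∷ʳ {α} {x ∷ bs} pre (suc i) eq = Prefix-∷ʳ {α ∘ suc} {bs} (λ i → pre (suc i)) i eq

violated-sound : ∀ {α bs} → Prefix α bs → ∀ cs → All (nae-at α) cs → violated bs cs ≡ false
violated-sound pre [] [] = refl
violated-sound {α} {bs} pre ((i , j , k) ∷ cs) (ok ∷ oks) with bs ‼ i in p | bs ‼ j in q | bs ‼ k in r
... | just a | just b | just c rewrite sym (pre i p) | sym (pre j q) | sym (pre k r) | ok = violated-sound pre cs oks
... | just _ | just _ | nothing = violated-sound pre cs oks
... | just _ | nothing | _ = violated-sound pre cs oks
... | nothing | _ | _ = violated-sound pre cs oks

refutes-sound : ∀ {α} cs → All (nae-at α) cs → ∀ k {bs} → Prefix α bs → refutes cs k bs ≡ true → ⊥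
branch-sound : ∀ {α} cs → All (nae-at α) cs → ∀ k {bs} → Prefix α bs → branch cs k bs false ≡ true → ⊥
refutes-sound {α} cs ok k {bs} pre eq = branch-sound cs ok k pre (subst (λ v → branch cs k bs v ≡ true) (violated-sound {α} {bs} pre cs ok) eq)
branch-sound {α} cs ok (suc k) {bs} pre eq with α (length bs) in q
... | true = refutes-sound cs ok k (subst (λ b → Prefix α (bs ++ b ∷ [])) q (Prefix-∷ʳ {α} {bs} pre)) (left eq)
  where
  left : ∀ {a b} → a ∧ b ≡ true → a ≡ true
  left {true} eq = refl
... | false = refutes-sound cs ok k (subst (λ b → Prefix α (bs ++ b ∷ [])) q (Prefix-∷ʳ {α} {bs} pre)) (right eq)
  where
  right : ∀ {a b} → a ∧ b ≡ true → b ≡ true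
  right {true} eq = eq

-- The colouring as a field and the relations from its triangles

module Colouring (n : ℕ) .{{_ : NonZero n}} (s h : ℕ) .{{_ : NonZero h}} (1+sʰ : (1 + s ^ h) % n ≡ 0 % n)
                 (u u′ : ℕ) (swap₁ : (s ^ h * u) % n ≡ u′ % n) (swap₂ : (s ^ h * u′) % n ≡ u % n)
                 (pc : ℕ → ℕ → Bool) (pc-sym : ∀ i j → pc i j ≡ pc j i) where
  open Circulant n s h 1+sʰ

  -- The colour of the image of the pair `a`, `b` under the automorphism v ↦ m + sᵗ v.
  edge : ℕ → ℕ → ℕ → ℕ → Bool
  edge a b t m = pc ((m + s ^ t * a) % n) ((m + s ^ t * b) % n)

  -- In the application `u` = 393 and `u′` = 392 are 1/2 and -1/2 modulo 785, which makes `m` the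
  -- midpoint.
  x : Field
  x t m = sgn (edge u u′ t m)

  x-Even : Even x
  x-Even .resp t p = cong sgn (cong₂ pc (≈-+ {b = s ^ t * u} p refl) (≈-+ {b = s ^ t * u′} p refl))
  x-Even .per t m = cong sgn (trans
    (cong₂ pc (≈-+ {m} refl (rot u u′ swap₁)) (≈-+ {m} refl (rot u′ u swap₂)))
    (pc-sym _ _))
    where
    lemma : ∀ a b c → a * b * c ≡ b * (a * c)
    lemma = ℕ-Ring.solve-∀
    rot : ∀ v w → s ^ h * v ≈ w → s ^ (h + t) * v ≈ s ^ t * w
    rot v w p = trans (≈-≡ (trans (cong (_* v) (ℕₚ.^-distribˡ-+-* s h t)) (lemma (s ^ h) (s ^ t) v))) (≈-* {s ^ t} refl p)

  x-◃ : ∀ {τ μ a b} → μ + s ^ τ * u ≈ a → μ + s ^ τ * u′ ≈ b → ∀ t m → (x ◃ (τ , μ)) t m ≡ sgn (edge a b t m)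
  x-◃ {τ} {μ} p q t m = cong sgn (cong₂ pc (vertex u p) (vertex u′ q))
    where
    lemma : ∀ m a μ b u → m + a * μ + a * b * u ≡ m + a * (μ + b * u)
    lemma = ℕ-Ring.solve-∀
    vertex : ∀ v {a} → μ + s ^ τ * v ≈ a → m + s ^ t * μ + s ^ (t + τ) * v ≈ m + s ^ t * a
    vertex v p = trans (≈-≡ (trans (cong (λ w → m + s ^ t * μ + w * v) (ℕₚ.^-distribˡ-+-* s t τ)) (lemma m (s ^ t) μ (s ^ τ) v)))
      (≈-+ {m} refl (≈-* {s ^ t} refl p))

  x-◃-cong : ∀ {τ τ′ μ μ′} → τ % h ≡ τ′ % h → μ ≈ μ′ → ∀ t m → (x ◃ (τ , μ)) t m ≡ (x ◃ (τ′ , μ′)) t m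
  x-◃-cong {τ} {τ′} p q t m = trans (sym (Even-mod x-Even τ t _)) (trans (cong (λ l → x (l + t) _) p)
    (trans (Even-mod x-Even τ′ t _) (x-Even .resp (t + τ′) (≈-+ {m} refl (≈-* {s ^ t} refl q)))))

  -- A translation class of triangles on {u, u′, c}: its other two edges are the images of the edge
  -- {u, u′} under f₁ and f₂, and g carries the first of these to the second.
  record Triangle (c : ℕ) (f₁ f₂ g : ℕ × ℕ) : Set where
    field
      first   : proj₂ f₁ + s ^ proj₁ f₁ * u ≈ u
      first′  : proj₂ f₁ + s ^ proj₁ f₁ * u′ ≈ c
      second  : proj₂ f₂ + s ^ proj₁ f₂ * u ≈ u′
      second′ : proj₂ f₂ + s ^ proj₁ f₂ * u′ ≈ c
      third   : (proj₁ f₁ + proj₁ g) % h ≡ proj₁ f₂ % h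
      third′  : proj₂ f₁ + s ^ proj₁ f₁ * proj₂ g ≈ proj₂ f₂
  open Triangle public

  -- The relation of `sgn-nae`, summed over all images of one triangle; each product becomes a
  -- correlation after translation.
  cor-Triangle : ∀ {c f₁ f₂ g} → Triangle c f₁ f₂ g →
                 (∀ t m → nae (edge u u′ t m) (edge u c t m) (edge u′ c t m) ≡ true) →
                 ⟪ x , x ◃ f₁ ⟫ +ᶻ (⟪ x , x ◃ f₂ ⟫ +ᶻ ⟪ x , x ◃ g ⟫) ≡ - ⟪ x , x ⟫
  cor-Triangle {c} {f₁} {f₂} {g} △ ok = begin
    ⟪ x , x ◃ f₁ ⟫ +ᶻ (⟪ x , x ◃ f₂ ⟫ +ᶻ ⟪ x , x ◃ g ⟫)
      ≡⟨ cong (λ w → ⟪ x , x ◃ f₁ ⟫ +ᶻ (⟪ x , x ◃ f₂ ⟫ +ᶻ w)) (sym relative) ⟩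
    ⟪ x , x ◃ f₁ ⟫ +ᶻ (⟪ x , x ◃ f₂ ⟫ +ᶻ ⟪ x ◃ f₁ , x ◃ f₂ ⟫)
      ≡⟨ trans (∑∑-+ _ _) (cong (⟪ x , x ◃ f₁ ⟫ +ᶻ_) (∑∑-+ _ _)) ⟨
    ∑∑ (λ t m → (x · (x ◃ f₁)) t m +ᶻ ((x · (x ◃ f₂)) t m +ᶻ ((x ◃ f₁) · (x ◃ f₂)) t m))
      ≡⟨ ∑∑-cong (λ t m → trans (cong₂ (λ v w → x t m *ᶻ v +ᶻ (x t m *ᶻ w +ᶻ v *ᶻ w)) (x-◃ (△ .first) (△ .first′) t m) (x-◃ (△ .second) (△ .second′) t m))
           (trans (sgn-nae (edge u u′ t m) _ _ (ok t m)) (sym (ℤₚ.-1*i≡-i (x t m *ᶻ x t m))))) ⟩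
    ∑∑ (λ t m → - 1ℤ *ᶻ (x · x) t m)
      ≡⟨ trans (∑∑-*ˡ (- 1ℤ) (x · x)) (ℤₚ.-1*i≡-i ⟪ x , x ⟫) ⟩
    - ⟪ x , x ⟫ ∎
    where
    open ≡-Reasoning
    relative : ⟪ x ◃ f₁ , x ◃ f₂ ⟫ ≡ ⟪ x , x ◃ g ⟫
    relative = trans
      (⟪⟫-congʳ {x ◃ f₁} (λ t m → sym (trans (◃-∘ x (proj₁ g) (proj₂ g) (proj₁ f₁) (proj₂ f₁) t m) (x-◃-cong (△ .third) (△ .third′) t m))))
      (∑∑-◃ (·-Periodic (double x-Even) (◃-Periodic (double x-Even) g)) f₁)

  nae-◃ : ∀ {c f₁ f₂ g} → Triangle c f₁ f₂ g → (∀ t m → nae (edge u u′ t m) (edge u c t m) (edge u′ c t m) ≡ true) →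
          ∀ t m → nae (edge u u′ t m) (edge u u′ (t + proj₁ f₁) (m + s ^ t * proj₂ f₁)) (edge u u′ (t + proj₁ f₂) (m + s ^ t * proj₂ f₂)) ≡ true
  nae-◃ △ ok t m = trans (cong₂ (nae (edge u u′ t m)) (sgn-injective (x-◃ (△ .first) (△ .first′) t m)) (sgn-injective (x-◃ (△ .second) (△ .second′) t m))) (ok t m)

module Pullback (n : ℕ) .{{_ : NonZero n}} (s h : ℕ) .{{_ : NonZero h}} (1+sʰ : (1 + s ^ h) % n ≡ 0 % n)
             (f₀ a₁ a₂ a₃ b₁ b₂ b₃ d₁ d₂ d₃ : ℕ × ℕ)
             (bs≤ : All (λ g → proj₁ g ≤ h + h) (f₀ ∷ a₁ ∷ a₂ ∷ a₃ ∷ b₁ ∷ b₂ ∷ b₃ ∷ d₁ ∷ d₂ ∷ d₃ ∷ []))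
             (p r k : ℕ) .{{_ : NonZero p}} .{{_ : NonZero r}} (2h≡4p : h + h ≡ p * 4) (n≡5r : n ≡ r * 5) (s⁴≡ : s ^ 4 ≡ 1 + k * 5)
             (h≡2p : h ≡ p * 2) (p½ : ℕ) (p-odd : 2 * p½ ≡ 1 + p * 1) (1<n : 1 % n ≡ 1)
             (s≡3 : s % 5 ≡ 3) (sʰ≡4 : s ^ h % 5 ≡ 4) (h≡2 : h % 4 ≡ 2) (0<h : 1 ≤ h + h)
             (inv₁ : (h + h ∸ 1) % 2 ≡ 1) (inv₂ : s ^ h * (s ^ (h + h ∸ 1) * 1) % 5 ≡ 3)
             (u u′ : ℕ) (swap₁ : (s ^ h * u) % n ≡ u′ % n) (swap₂ : (s ^ h * u′) % n ≡ u % n)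
             (pc : ℕ → ℕ → Bool) (pc-sym : ∀ i j → pc i j ≡ pc j i) where
  bs : List (ℕ × ℕ)
  bs = f₀ ∷ a₁ ∷ a₂ ∷ a₃ ∷ b₁ ∷ b₂ ∷ b₃ ∷ d₁ ∷ d₂ ∷ d₃ ∷ []

  open Circulant n s h 1+sʰ
  open Spectral n s h 1+sʰ bs bs≤
  open Average n s h 1+sʰ bs bs≤ 4 p 5 r k 2h≡4p n≡5r s⁴≡
  open Rigid n s h 1+sʰ bs bs≤ p r k 2h≡4p n≡5r s⁴≡ h≡2p p½ p-odd 1<n s≡3 sʰ≡4 h≡2 0<h inv₁ inv₂
  open Colouring n s h 1+sʰ u u′ swap₁ swap₂ pc pc-sym

  NaeTriangle : ℕ → Set
  NaeTriangle c = ∀ t m → nae (edge u u′ t m) (edge u c t m) (edge u′ c t m) ≡ true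

  module _ {c₀ c₁ c₂ c₃ f₀′ g₀} (T₀ : Triangle c₀ f₀ f₀′ g₀) (T₁ : Triangle c₁ a₁ a₂ a₃) (T₂ : Triangle c₂ b₁ b₂ b₃) (T₃ : Triangle c₃ d₁ d₂ d₃)
           (f₀′≈ : proj₁ f₀ % h ≡ proj₁ f₀′ % h) (f₀′≈′ : s ^ h * proj₂ f₀ ≈ proj₂ f₀′)
           (g₀≈ : 0 % h ≡ proj₁ g₀ % h) (g₀≈′ : s ^ h * 1 ≈ proj₂ g₀)
           (N₀ : NaeTriangle c₀) (N₁ : NaeTriangle c₁) (N₂ : NaeTriangle c₂) (N₃ : NaeTriangle c₃) where

    -- In the application this is the triangle on 1/2, -1/2 and 0. Negation exchanges its edges at
    -- 0, so `f₀` occurs twice and the third relation is that of the short orbit `(0 , 1)`.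
    cor₀ : ⟪ x , x ◃ f₀ ⟫ +ᶻ (⟪ x , x ◃ f₀ ⟫ +ᶻ ⟪ x , x ◃ (0 , 1) ⟫) ≡ - ⟪ x , x ⟫
    cor₀ = trans (cong₂ (λ v w → ⟪ x , x ◃ f₀ ⟫ +ᶻ (v +ᶻ w))
        (trans (sym (cor-neg x-Even f₀)) (⟪⟫-congʳ {x} (x-◃-cong f₀′≈ f₀′≈′)))
        (trans (sym (cor-neg x-Even (0 , 1))) (⟪⟫-congʳ {x} (x-◃-cong g₀≈ g₀≈′))))
      (cor-Triangle T₀ N₀)

    form-0 : ⟪ x , B (+ 14) x ⟫ ≡ 0ℤ
    form-0 = trans (⟪⟫-B (+ 14) x x) (trans (cong (+ 14 *ᶻ ⟪ x , x ⟫ +ᶻ_) (cor-L x-Even))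
      (sum-up ⟪ x , x ⟫ ⟪ x , x ◃ (0 , 1) ⟫ ⟪ x , x ◃ f₀ ⟫ {γ a₁} {γ a₂} {γ a₃} {γ b₁} {γ b₂} {γ b₃} {γ d₁} {γ d₂} {γ d₃} cor₀
        (cor-Triangle T₁ N₁) (cor-Triangle T₂ N₂) (cor-Triangle T₃ N₃)))
      where
      γ : ℕ × ℕ → ℤ
      γ g = ⟪ x , x ◃ g ⟫
      regroup : ∀ N e c a₁ a₂ a₃ b₁ b₂ b₃ d₁ d₂ d₃ →
        + 14 *ᶻ N +ᶻ (+ 2 *ᶻ e +ᶻ + 4 *ᶻ (c +ᶻ (a₁ +ᶻ (a₂ +ᶻ (a₃ +ᶻ (b₁ +ᶻ (b₂ +ᶻ (b₃ +ᶻ (d₁ +ᶻ (d₂ +ᶻ (d₃ +ᶻ 0ℤ))))))))))) ≡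
        + 14 *ᶻ N +ᶻ (+ 2 *ᶻ (c +ᶻ (c +ᶻ e)) +ᶻ (+ 4 *ᶻ (a₁ +ᶻ (a₂ +ᶻ a₃)) +ᶻ (+ 4 *ᶻ (b₁ +ᶻ (b₂ +ᶻ b₃)) +ᶻ + 4 *ᶻ (d₁ +ᶻ (d₂ +ᶻ d₃)))))
      regroup = solve-∀
      -- 14 = 2 + 3 · 4: the symmetric class of triangles enters with weight 2, the three others
      -- with weight 4.
      vanish : ∀ N → + 14 *ᶻ N +ᶻ (+ 2 *ᶻ - N +ᶻ (+ 4 *ᶻ - N +ᶻ (+ 4 *ᶻ - N +ᶻ + 4 *ᶻ - N))) ≡ 0ℤ
      vanish = solve-∀
      sum-up : ∀ N e c {a₁ a₂ a₃ b₁ b₂ b₃ d₁ d₂ d₃} → c +ᶻ (c +ᶻ e) ≡ - N → a₁ +ᶻ (a₂ +ᶻ a₃) ≡ - N → b₁ +ᶻ (b₂ +ᶻ b₃) ≡ - N → d₁ +ᶻ (d₂ +ᶻ d₃) ≡ - N →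
        + 14 *ᶻ N +ᶻ (+ 2 *ᶻ e +ᶻ + 4 *ᶻ (c +ᶻ (a₁ +ᶻ (a₂ +ᶻ (a₃ +ᶻ (b₁ +ᶻ (b₂ +ᶻ (b₃ +ᶻ (d₁ +ᶻ (d₂ +ᶻ (d₃ +ᶻ 0ℤ))))))))))) ≡ 0ℤ
      sum-up N e c {a₁} {a₂} {a₃} {b₁} {b₂} {b₃} {d₁} {d₂} {d₃} p q r w = trans (regroup N e c a₁ a₂ a₃ b₁ b₂ b₃ d₁ d₂ d₃)
        (trans (cong (+ 14 *ᶻ N +ᶻ_) (cong₂ _+ᶻ_ (cong (+ 2 *ᶻ_) p) (cong₂ _+ᶻ_ (cong (+ 4 *ᶻ_) q) (cong₂ _+ᶻ_ (cong (+ 4 *ᶻ_) r) (cong (+ 4 *ᶻ_) w))))) (vanish N))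

    module _ (X : ℕ) .{{_ : NonZero X}} (q : List ℤ) (C : ℕ) (ks ks′ : List ℤ) (ks-5 : length ks ≡ 5) (ks′-5 : length ks′ ≡ 5)
             (certified : Certificate.Certified n s h 1+sʰ bs bs≤ X q (+ C) (+ 14) (tile p r (ks ∷ ks′ ∷ [])))
             (touch : All (λ g → touching (proj₁ g % 2) (proj₂ g % 5) ≡ true) bs)
             (count : ∀ (c : ℕ → ℤ) → over bs (λ g → c (proj₁ g % 2)) ≡ + 3 *ᶻ c 0 +ᶻ + 7 *ᶻ c 1) where

      gap-L : ∀ {z} → Even z → (∀ t m → Π z t m ≡ 0ℤ) → ⟪ z , B (+ 14) z ⟫ ≤ᶻ 0ℤ → ⟪ z , z ⟫ ≤ᶻ 0ℤ
      gap-L {z} e null le = Certificate.spectral-gap n s h 1+sʰ bs bs≤ X q (+ C) (+ 14) (tile p r (ks ∷ ks′ ∷ [])) certified e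
        (grid-tile p r 5 (ks ∷ ks′ ∷ []) (ks-5 ∷ ks′-5 ∷ []) (cor z z) (cor-tile e null))
        (subst₂ (λ v w → + C *ᶻ v ≤ᶻ w) (⟪⟫-B (+ 14) z z) (ℤₚ.*-zeroʳ (+ C)) (ℤₚ.*-monoˡ-≤-nonNeg (+ C) le))

      edge-residue : ∀ {t t′ m m′} → t % 2 ≡ t′ % 2 → m % 5 ≡ m′ % 5 → edge u u′ t m ≡ edge u u′ t′ m′
      edge-residue {t} {t′} {m} {m′} t≡ m≡ = sgn-injective (rigid touch count gap-L x-Even form-0 {t} {t′} {m} {m′} t≡ m≡)

-- The graph on 786 vertices

bases : List (ℕ × ℕ)
bases = (69 , 589) ∷
        (23 , 217) ∷ (76 , 609) ∷ (53 , 126) ∷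
        (146 , 256) ∷ (81 , 648) ∷ (91 , 53) ∷
        (102 , 301) ∷ (61 , 693) ∷ (115 , 753) ∷ []

bases≤ : All (λ g → proj₁ g ≤ 78 + 78) bases
bases≤ = toWitness {a? = All.all? (λ g → proj₁ g ℕₚ.≤? 78 + 78) bases} tt

-- 2⁻⁷⁶ q approximates the square root of x + 13.67 on the spectrum of A outside the kernel of A + 14.
q : List ℤ
q = + 279365550308115582694186 ∷ + 10212378416041342194385 ∷ - (+ 188927330484399929752) ∷ + 7851761716799158535 ∷
    - (+ 222555955325790046) ∷ - (+ 31251439287710125) ∷ - (+ 1085891785490271) ∷ + 881444222598610 ∷
    - (+ 34996434205924) ∷ - (+ 5441946278170) ∷ + 406893275836 ∷ + 6975221031 ∷ - (+ 1506684333) ∷ + 52144598 ∷ - (+ 591187) ∷ []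

-- Up to sign and rounding, the mean entry of P(A) over pairs of edges with equal, adjacent or disjoint images in K₅.
kₐ kᵦ kᵧ : ℤ
kₐ = + (18751770346042 * 2 ^ 120)
kᵦ = + (18751770190425 * 2 ^ 120)
kᵧ = + (18751770268184 * 2 ^ 120)

κ₀ κ₁ : List ℤ
κ₀ = kₐ ∷ kᵦ ∷ kᵧ ∷ kᵧ ∷ kᵦ ∷ []
κ₁ = kᵧ ∷ kᵦ ∷ kᵦ ∷ kᵦ ∷ kᵦ ∷ []

-- The powers alone would fit below 42²⁹ < 2¹⁵⁷; the larger base makes room for their combination
-- with the coefficients of `residual`.
module Cert = Certificate 785 53 78 refl bases bases≤ (2 ^ 196)

certified : Cert.Certified q (+ (2 ^ 152)) (+ 14) (tile 39 157 (κ₀ ∷ κ₁ ∷ []))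
certified = record
  { powers-fit = toWitness {a? = _ ℕₚ.<? _} tt
  ; pos-fit    = toWitness {a? = _ ℤₚ.<? _} tt
  ; neg-fit    = toWitness {a? = _ ℤₚ.<? _} tt
  ; dominant   = refl
  }

-- Adjacency and absence of K₄

infix 5 _∈ᵇ_
_∈ᵇ_ : ℕ → List ℕ → Bool
a ∈ᵇ xs = any (a ℕ.≡ᵇ_) xs

∈ᵇ⇒∈ : ∀ {a} xs → (a ∈ᵇ xs) ≡ true → a ∈ xs
∈ᵇ⇒∈ {a} (x ∷ xs) eq with a ℕ.≡ᵇ x in p
... | true = here (ℕₚ.≡ᵇ⇒≡ a x (Equivalence.from T-≡ p))
... | false = there (∈ᵇ⇒∈ xs eq)

-- r ↦ r³⁹ maps ⟨53⟩ onto the subgroup {1, 342, -1, -342} of order 4.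
connected : ℕ → Bool
connected r = (r ^ 39 % 785) ∈ᵇ (1 ∷ 342 ∷ 784 ∷ 443 ∷ [])

-- Found by search: a triangle-free set in L whose join with a new vertex extends no colouring that is
-- pulled back from K₅ and has no monochromatic triangle.
apex : List ℕ
apex = 5 ∷ 322 ∷ 21 ∷ 138 ∷ 209 ∷ 290 ∷ 482 ∷ 49 ∷ 546 ∷ 736 ∷ 563 ∷ []

adjacent : ℕ → ℕ → Bool
adjacent i j = if i ℕ.≡ᵇ 785 then j ∈ᵇ apex else if j ℕ.≡ᵇ 785 then i ∈ᵇ apex else connected ℕ.∣ i - j ∣

adjacent-sym : ∀ i j → adjacent i j ≡ adjacent j i
adjacent-sym i j with i ℕ.≡ᵇ 785 in p | j ℕ.≡ᵇ 785 in q
... | true | true = cong (_∈ᵇ apex) (trans (ℕₚ.≡ᵇ⇒≡ j 785 (Equivalence.from T-≡ q)) (sym (ℕₚ.≡ᵇ⇒≡ i 785 (Equivalence.from T-≡ p))))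
... | true | false = refl
... | false | true = refl
... | false | false = cong connected (ℕₚ.∣-∣-comm i j)

adjacent-irrefl : ∀ i → adjacent i i ≡ false
adjacent-irrefl i with i ℕ.≡ᵇ 785 in p
... | true = cong (_∈ᵇ apex) (ℕₚ.≡ᵇ⇒≡ i 785 (Equivalence.from T-≡ p))
... | false = cong connected (ℕₚ.∣n-n∣≡0 i)

G₇₈₆ : SimpleGraph 786
G₇₈₆ .adj i j = adjacent (toℕ i) (toℕ j)
G₇₈₆ .SimpleGraph.sym i j = adjacent-sym (toℕ i) (toℕ j)
G₇₈₆ .irrefl i = adjacent-irrefl (toℕ i)

adjacent-apex : ∀ i → adjacent i 785 ≡ true → i ∈ apex
adjacent-apex i eq with i ℕ.≡ᵇ 785
... | true = contradiction eq λ ()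
... | false = ∈ᵇ⇒∈ apex eq

<⇒≡ᵇ-false : ∀ {i} → i < 785 → (i ℕ.≡ᵇ 785) ≡ false
<⇒≡ᵇ-false {i} i< with i ℕ.≡ᵇ 785 in p
... | true = contradiction (ℕₚ.≡ᵇ⇒≡ i 785 (Equivalence.from T-≡ p)) (ℕₚ.<⇒≢ i<)
... | false = refl

adjacent-< : ∀ {i j} → i < 785 → j < 785 → adjacent i j ≡ connected ℕ.∣ i - j ∣
adjacent-< i< j< rewrite <⇒≡ᵇ-false i< | <⇒≡ᵇ-false j< = refl

adjacent-∸ : ∀ {i j} → i < j → j < 785 → adjacent i j ≡ true → connected (j ∸ i) ≡ true
adjacent-∸ i<j j< eq = trans (cong connected (sym (ℕₚ.m≤n⇒∣m-n∣≡n∸m (ℕₚ.<⇒≤ i<j)))) (trans (sym (adjacent-< (ℕₚ.<-trans i<j j<) j<)) eq)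

neighbours : List ℕ → ℕ → List ℕ
neighbours V i = filterᵇ (λ j → connected (j ∸ i)) V

-- For `j ≤ i` the truncated difference is 0, which is not `connected`, so running over all ordered
-- pairs is harmless.
edgeless : List ℕ → Bool
edgeless V = all (λ i → all (λ j → not (connected (j ∸ i))) V) V

triangle-free : List ℕ → Bool
triangle-free V = all (λ i → edgeless (neighbours V i)) V

all-∈ : ∀ (f : ℕ → Bool) xs {i} → all f xs ≡ true → i ∈ xs → f i ≡ true
all-∈ f xs eq i∈ = Equivalence.to T-≡ (All.lookup (all⁺ f xs (Equivalence.from T-≡ eq)) i∈)

triangle-free-sound : ∀ V → triangle-free V ≡ true → ∀ {i j k} → i ∈ V → j ∈ V → k ∈ V →
                      connected (j ∸ i) ≡ true → connected (k ∸ i) ≡ true → connected (k ∸ j) ≡ true → ⊥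
triangle-free-sound V free {i} {j} {k} i∈ j∈ k∈ ij ik jk = true≢false
  (all-∈ _ N (all-∈ _ N (all-∈ (λ i → edgeless (neighbours V i)) V free i∈) (neighbour j∈ ij)) (neighbour k∈ ik))
  where
  N = neighbours V i
  neighbour : ∀ {l} → l ∈ V → connected (l ∸ i) ≡ true → l ∈ N
  neighbour l∈ eq = ∈-filter⁺ (λ j → T? (connected (j ∸ i))) l∈ (Equivalence.from T-≡ eq)
  true≢false : not (connected (k ∸ j)) ≡ true → ⊥
  true≢false eq rewrite jk with eq
  ... | ()

connections : List ℕ
connections = filterᵇ connected (upTo 785)

apex-triangle-free : triangle-free apex ≡ true
apex-triangle-free = refl

connections-triangle-free : triangle-free connections ≡ true
connections-triangle-free = refl

∈-connections : ∀ {r} → r < 785 → connected r ≡ true → r ∈ connections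
∈-connections r< eq = ∈-filter⁺ (λ r → T? (connected r)) (∈-upTo⁺ r<) (Equivalence.from T-≡ eq)

∸-∸ : ∀ {a b c} → a ≤ b → b ≤ c → (c ∸ a) ∸ (b ∸ a) ≡ c ∸ b
∸-∸ {a} {b} {c} a≤b b≤c = trans (ℕₚ.∸-+-assoc c a (b ∸ a)) (cong (c ∸_) (ℕₚ.m+[n∸m]≡n a≤b))

-- The further vertex has the largest number, so only `d` can be it, and then the others form a
-- triangle in `apex`. Otherwise translating `a` to 0 puts a triangle into the connection set.
K₄-free : ¬ ContainsK4 G₇₈₆
K₄-free (a , b , c , d , a<b , b<c , c<d , ab , ac , ad , bc , bd , cd) with ℕₚ.m≤n⇒m<n∨m≡n (ℕₚ.≤-pred (toℕ<n d))
... | inj₂ d≡ = triangle-free-sound apex apex-triangle-free {toℕ a} {toℕ b} {toℕ c} (end {a} ad) (end {b} bd) (end {c} cd)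
    (adjacent-∸ a<b (ℕₚ.<-≤-trans b<c (ℕₚ.<⇒≤ c<)) ab) (adjacent-∸ (ℕₚ.<-trans a<b b<c) c< ac) (adjacent-∸ b<c c< bc)
  where
  c< : toℕ c < 785
  c< = subst (toℕ c <_) d≡ c<d
  end : ∀ {i} → adjacent (toℕ i) (toℕ d) ≡ true → toℕ {786} i ∈ apex
  end {i} eq = adjacent-apex (toℕ i) (subst (λ k → adjacent (toℕ i) k ≡ true) d≡ eq)
... | inj₁ d< = triangle-free-sound connections connections-triangle-free {toℕ b ∸ toℕ a} {toℕ c ∸ toℕ a} {toℕ d ∸ toℕ a} (in-connections a<b ab b<) (in-connections a<c ac c<) (in-connections a<d ad d<)
    (subst (λ r → connected r ≡ true) (sym (∸-∸ (ℕₚ.<⇒≤ a<b) (ℕₚ.<⇒≤ b<c))) (adjacent-∸ b<c c< bc))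
    (subst (λ r → connected r ≡ true) (sym (∸-∸ (ℕₚ.<⇒≤ a<b) (ℕₚ.<⇒≤ b<d))) (adjacent-∸ b<d d< bd))
    (subst (λ r → connected r ≡ true) (sym (∸-∸ (ℕₚ.<⇒≤ a<c) (ℕₚ.<⇒≤ c<d))) (adjacent-∸ c<d d< cd))
  where
  c< = ℕₚ.<-trans c<d d<
  b< = ℕₚ.<-trans b<c c<
  a<c = ℕₚ.<-trans a<b b<c
  a<d = ℕₚ.<-trans a<c c<d
  b<d = ℕₚ.<-trans b<c c<d
  in-connections : ∀ {i j} → i < j → adjacent i j ≡ true → j < 785 → j ∸ i ∈ connections
  in-connections {i} {j} i<j eq j< = ∈-connections (ℕₚ.≤-<-trans (ℕₚ.m∸n≤m j i) j<) (adjacent-∸ i<j j< eq)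

-- Every colouring has a monochromatic triangle

MonoTriangle? : ∀ {n} (G : SimpleGraph n) (col : EdgeColouring n) → Dec (MonoTriangle G col)
MonoTriangle? G col = any? λ a → any? λ b → any? λ c → colour? (λ k →
  (a Finₚ.<? b) ×-dec (b Finₚ.<? c) ×-dec (adj G a b ≟ true) ×-dec (adj G a c ≟ true) ×-dec (adj G b c ≟ true) ×-dec
  (col a b ≟ k) ×-dec (col a c ≟ k) ×-dec (col b c ≟ k))
  where
  colour? : ∀ {P : Bool → Set} → (∀ k → Dec (P k)) → Dec (∃ P)
  colour? P? with P? true | P? false
  ... | yes p | _ = yes (true , p)
  ... | no _ | yes p = yes (false , p)
  ... | no ¬p | no ¬q = no λ { (true , p) → ¬p p ; (false , q) → ¬q q }

module C = Circulant 785 53 78 refl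

connected-cong : ∀ {a b} → a C.≈ b → connected a ≡ connected b
connected-cong {a} {b} eq = cong (_∈ᵇ (1 ∷ 342 ∷ 784 ∷ 443 ∷ [])) (go 39)
  where
  go : ∀ k → a ^ k C.≈ b ^ k
  go zero = refl
  go (suc k) = C.≈-* {a} {b} {a ^ k} {b ^ k} eq (go k)

^-swap : ∀ a j k → (a ^ j) ^ k ≡ (a ^ k) ^ j
^-swap a j k = trans (ℕₚ.^-*-assoc a j k) (trans (cong (a ^_) (ℕₚ.*-comm j k)) (sym (ℕₚ.^-*-assoc a k j)))

roots : List ℕ
roots = 1 ∷ 342 ∷ 784 ∷ 443 ∷ []

roots-cyclic : ∀ {w} → w ∈ roots → (342 * w) % 785 ∈ roots
roots-cyclic (here refl) = there (here refl)
roots-cyclic (there (here refl)) = there (there (here refl))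
roots-cyclic (there (there (here refl))) = there (there (there (here refl)))
roots-cyclic (there (there (there (here refl)))) = here refl

-- 342 = 53³⁹ mod 785
root-^ : ∀ {a} → a C.≈ 342 → ∀ k → (a ^ k) % 785 ∈ roots
root-^ eq zero = here refl
root-^ {a} eq (suc k) = subst (_∈ roots) (sym (C.≈-* {a} {342} {a ^ k} {(a ^ k) % 785} eq (sym (C.≈-% (a ^ k))))) (roots-cyclic (root-^ eq k))

∈⇒∈ᵇ : ∀ {a} xs → a ∈ xs → (a ∈ᵇ xs) ≡ true
∈⇒∈ᵇ {a} (x ∷ xs) (here refl) rewrite Equivalence.to T-≡ (ℕₚ.≡⇒≡ᵇ a a refl) = refl
∈⇒∈ᵇ {a} (x ∷ xs) (there a∈) rewrite ∈⇒∈ᵇ xs a∈ = ∨-zeroʳ (a ℕ.≡ᵇ x)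

-- Arrowing relies on the powers of 53 being in the connection set, whereas absence of K₄ is
-- computed from `connected` directly.
connected-^ : ∀ k → connected (53 ^ k) ≡ true
connected-^ k = ∈⇒∈ᵇ roots (subst (λ w → w % 785 ∈ roots) (^-swap 53 39 k) (root-^ {53 ^ 39} refl k))

adjacent-edge : ∀ a b k → a C.≈ b + 53 ^ k → ∀ t m → adjacent ((m + 53 ^ t * a) % 785) ((m + 53 ^ t * b) % 785) ≡ true
adjacent-edge a b k eq t m = trans (adjacent-< (m%n<n (m + 53 ^ t * a) 785) (m%n<n (m + 53 ^ t * b) 785))
  (connected-distance {ℕ.∣ i - j ∣} (C.≈-distance {i} {j} (t + k) (C.≈-vertex a b k eq t m)))
  where
  i = (m + 53 ^ t * a) % 785
  j = (m + 53 ^ t * b) % 785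
  connected-distance : ∀ {d} → ∃ (λ e → d C.≈ 53 ^ e) → connected d ≡ true
  connected-distance {d} (e , eq) = trans (connected-cong {d} {53 ^ e} eq) (connected-^ e)

module Coloured (col : EdgeColouring 786) (none : ¬ MonoTriangle G₇₈₆ col) where

  -- Reading the colour in increasing order makes it symmetric, and reduction modulo 786 makes it
  -- total on natural numbers.
  pair : ℕ → ℕ → Bool
  pair i j = if i ℕ.<ᵇ j then col (i mod 786) (j mod 786) else col (j mod 786) (i mod 786)

  pair-< : ∀ {i j} → i < j → pair i j ≡ col (i mod 786) (j mod 786)
  pair-< {i} {j} i<j rewrite Equivalence.to T-≡ (ℕₚ.<⇒<ᵇ i<j) = refl

  pair-> : ∀ {i j} → i < j → pair j i ≡ col (i mod 786) (j mod 786)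
  pair-> {i} {j} i<j with j ℕ.<ᵇ i in eq
  ... | true = contradiction (ℕₚ.<ᵇ⇒< j i (Equivalence.from T-≡ eq)) (ℕₚ.<-asym i<j)
  ... | false = refl

  pair-sym : ∀ i j → pair i j ≡ pair j i
  pair-sym i j with ℕₚ.<-cmp i j
  ... | tri< i<j _ _ = trans (pair-< i<j) (sym (pair-> i<j))
  ... | tri≈ _ refl _ = refl
  ... | tri> _ _ j<i = trans (pair-> j<i) (sym (pair-< j<i))

  toℕ-mod : ∀ {i} → i < 786 → toℕ (i mod 786) ≡ i
  toℕ-mod {i} i< = trans (toℕ-fromℕ< (m%n<n i 786)) (m<n⇒m%n≡m i<)

  nae-sorted : ∀ {i j k} → i < j → j < k → k < 786 → adjacent i j ≡ true → adjacent i k ≡ true → adjacent j k ≡ true →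
               nae (pair i j) (pair i k) (pair j k) ≡ true
  nae-sorted {i} {j} {k} i<j j<k k< ij ik jk with nae (pair i j) (pair i k) (pair j k) in eq
  ... | true = refl
  ... | false = ⊥-elim (none (i mod 786 , j mod 786 , k mod 786 , pair i j ,
        subst₂ _<_ (sym i≡) (sym j≡) i<j , subst₂ _<_ (sym j≡) (sym k≡) j<k ,
        trans (cong₂ adjacent i≡ j≡) ij , trans (cong₂ adjacent i≡ k≡) ik , trans (cong₂ adjacent j≡ k≡) jk ,
        sym (pair-< i<j) ,
        trans (sym (pair-< (ℕₚ.<-trans i<j j<k))) (proj₁ (equal _ _ _ eq)) ,
        trans (sym (pair-< j<k)) (proj₂ (equal _ _ _ eq))))
    where
    j< = ℕₚ.<-trans j<k k<
    i≡ = toℕ-mod (ℕₚ.<-trans i<j j<)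
    j≡ = toℕ-mod j<
    k≡ = toℕ-mod k<
    equal : ∀ a b c → nae a b c ≡ false → (b ≡ a) × (c ≡ a)
    equal true true true _ = refl , refl
    equal false false false _ = refl , refl

  distinct : ∀ {i j} → adjacent i j ≡ true → i ≢ j
  distinct {i} eq refl = contradiction (trans (sym eq) (adjacent-irrefl i)) λ ()

  Nae : ℕ → ℕ → ℕ → Set
  Nae i j k = nae (pair i j) (pair i k) (pair j k) ≡ true

  nae-adjacent : ∀ i j k → i < 786 → j < 786 → k < 786 → adjacent i j ≡ true → adjacent i k ≡ true → adjacent j k ≡ true → Nae i j k
  nae-adjacent i j k i< j< k< ij ik jk with ℕₚ.<-cmp i j | ℕₚ.<-cmp j k | ℕₚ.<-cmp i k
  ... | tri≈ _ i≡j _ | _ | _ = contradiction i≡j (distinct ij)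
  ... | _ | tri≈ _ j≡k _ | _ = contradiction j≡k (distinct jk)
  ... | _ | _ | tri≈ _ i≡k _ = contradiction i≡k (distinct ik)
  ... | tri< i<j _ _ | tri< j<k _ _ | _ = nae-sorted i<j j<k k< ij ik jk
  ... | tri< i<j _ _ | tri> _ _ k<j | tri< i<k _ _ =
    trans (trans (nae-swap₁₂ (pair i j) (pair i k) (pair j k)) (cong (nae (pair i k) (pair i j)) (pair-sym j k))) (nae-sorted i<k k<j j< ik ij (trans (adjacent-sym k j) jk))
  ... | tri< i<j _ _ | tri> _ _ k<j | tri> _ _ k<i =
    trans (trans (nae-swap₂₃ (pair i j) (pair i k) (pair j k)) (trans (nae-swap₁₂ (pair i j) (pair j k) (pair i k)) (trans (nae-swap₂₃ (pair j k) (pair i j) (pair i k)) (trans (nae-swap₁₂ (pair j k) (pair i k) (pair i j)) (cong₂ (λ x y → nae x y (pair i j)) (pair-sym i k) (pair-sym j k))))))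
      (nae-sorted k<i i<j j< (trans (adjacent-sym k i) ik) (trans (adjacent-sym k j) jk) ij)
  ... | tri> _ _ j<i | tri< j<k _ _ | tri< i<k _ _ =
    trans (trans (nae-swap₂₃ (pair i j) (pair i k) (pair j k)) (cong (λ x → nae x (pair j k) (pair i k)) (pair-sym i j))) (nae-sorted j<i i<k k< (trans (adjacent-sym j i) ij) jk ik)
  ... | tri> _ _ j<i | tri< j<k _ _ | tri> _ _ k<i =
    trans (trans (nae-swap₂₃ (pair i j) (pair i k) (pair j k)) (trans (nae-swap₁₂ (pair i j) (pair j k) (pair i k)) (cong₂ (nae (pair j k)) (pair-sym i j) (pair-sym i k)))) (nae-sorted j<k k<i i< jk (trans (adjacent-sym j i) ij) (trans (adjacent-sym k i) ik))
  ... | tri> _ _ j<i | tri> _ _ k<j | _ =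
    trans (trans (nae-swap₁₂ (pair i j) (pair i k) (pair j k)) (trans (nae-swap₂₃ (pair i k) (pair i j) (pair j k)) (trans (nae-swap₁₂ (pair i k) (pair j k) (pair i j)) (trans (cong₂ (λ x y → nae x y (pair i j)) (pair-sym j k) (pair-sym i k)) (cong (nae (pair k j) (pair k i)) (pair-sym i j))))))
      (nae-sorted k<j j<i i< (trans (adjacent-sym k j) jk) (trans (adjacent-sym k i) ik) (trans (adjacent-sym j i) ij))

  open C using (_≈_)
  module K = Colouring 785 53 78 refl 393 392 refl refl pair pair-sym
  module F = Pullback 785 53 78 refl (69 , 589) (23 , 217) (76 , 609) (53 , 126) (146 , 256) (81 , 648) (91 , 53) (102 , 301) (61 , 693) (115 , 753) bases≤
    39 157 1578096 refl refl refl refl 20 refl refl refl refl refl (toWitness {a? = 1 ℕₚ.≤? 156} tt) refl refl 393 392 refl refl pair pair-sym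

  vertex : ℕ → ℕ → ℕ → ℕ
  vertex a t m = (m + 53 ^ t * a) % 785

  vertex< : ∀ a t m → vertex a t m < 786
  vertex< a t m = ℕₚ.m<n⇒m<1+n (m%n<n (m + 53 ^ t * a) 785)

  nae-triangle : ∀ c τ₁ τ₂ → 393 ≈ c + 53 ^ τ₁ → 392 ≈ c + 53 ^ τ₂ →
                 ∀ t m → nae (K.edge 393 392 t m) (K.edge 393 c t m) (K.edge 392 c t m) ≡ true
  nae-triangle c τ₁ τ₂ p q t m = nae-adjacent (vertex 393 t m) (vertex 392 t m) (vertex c t m) (vertex< 393 t m) (vertex< 392 t m) (vertex< c t m)
    (adjacent-edge 393 392 0 refl t m) (adjacent-edge 393 c τ₁ p t m) (adjacent-edge 392 c τ₂ q t m)

  T₀ : K.Triangle 0 (69 , 589) (147 , 196) (78 , 784)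
  T₀ = record { first = refl ; first′ = refl ; second = refl ; second′ = refl ; third = refl ; third′ = refl }

  T₁ : K.Triangle 41 (23 , 217) (76 , 609) (53 , 126)
  T₁ = record { first = refl ; first′ = refl ; second = refl ; second′ = refl ; third = refl ; third′ = refl }

  T₂ : K.Triangle 119 (146 , 256) (81 , 648) (91 , 53)
  T₂ = record { first = refl ; first′ = refl ; second = refl ; second′ = refl ; third = refl ; third′ = refl }

  T₃ : K.Triangle 209 (102 , 301) (61 , 693) (115 , 753)
  T₃ = record { first = refl ; first′ = refl ; second = refl ; second′ = refl ; third = refl ; third′ = refl }

  count : ∀ (c : ℕ → ℤ) → over bases (λ g → c (proj₁ g % 2)) ≡ + 3 *ᶻ c 0 +ᶻ + 7 *ᶻ c 1
  count c = lemma (c 0) (c 1)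
    where
    lemma : ∀ a b → b +ᶻ (b +ᶻ (a +ᶻ (b +ᶻ (a +ᶻ (b +ᶻ (b +ᶻ (a +ᶻ (b +ᶻ (b +ᶻ 0ℤ))))))))) ≡ + 3 *ᶻ a +ᶻ + 7 *ᶻ b
    lemma = solve-∀

  edge-residue : ∀ {t t′ m m′} → t % 2 ≡ t′ % 2 → m % 5 ≡ m′ % 5 → K.edge 393 392 t m ≡ K.edge 393 392 t′ m′
  edge-residue {t} {t′} {m} {m′} = F.edge-residue T₀ T₁ T₂ T₃ refl refl refl refl
    (nae-triangle 0 69 147 refl refl) (nae-triangle 41 23 76 refl refl) (nae-triangle 119 146 81 refl refl) (nae-triangle 209 102 61 refl refl)
    (2 ^ 196) q (2 ^ 152) κ₀ κ₁ refl refl certified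
    (toWitness {a? = All.all? (λ g → touching (proj₁ g % 2) (proj₂ g % 5) ≟ true) bases} tt) count {t} {t′} {m} {m′}

  _at_ : List ℕ → ℕ → ℕ
  [] at i = 0
  (v ∷ vs) at zero = v
  (v ∷ vs) at suc i = vs at i

  -- Variables 0 to 9 are the colours of the edges of K₅, variable 10 + i is that of the edge from the
  -- last vertex to the i-th element of apex.
  index : ℕ → ℕ → ℕ
  index t m = t % 2 * 5 + m % 5

  α : ℕ → Bool
  α v = if v ℕ.<ᵇ 10 then K.edge 393 392 (v / 5) (v % 5) else pair (apex at (v ∸ 10)) 785

  α-edge : ∀ t m → α (index t m) ≡ K.edge 393 392 t m
  α-edge t m = trans (cases (t % 2) (m % 5) (m%n<n t 2) (m%n<n m 5)) (edge-residue {t % 2} {t} {m % 5} {m} (m%n%n≡m%n t 2) (m%n%n≡m%n m 5))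
    where
    cases : ∀ a b → a < 2 → b < 5 → α (a * 5 + b) ≡ K.edge 393 392 a b
    cases 0 0 _ _ = refl
    cases 0 1 _ _ = refl
    cases 0 2 _ _ = refl
    cases 0 3 _ _ = refl
    cases 0 4 _ _ = refl
    cases 1 0 _ _ = refl
    cases 1 1 _ _ = refl
    cases 1 2 _ _ = refl
    cases 1 3 _ _ = refl
    cases 1 4 _ _ = refl
    cases (suc (suc _)) _ (s≤s (s≤s ())) _
    cases _ (suc (suc (suc (suc (suc _))))) _ (s≤s (s≤s (s≤s (s≤s (s≤s ())))))

  K₅-edges : List (ℕ × ℕ)
  K₅-edges = (0 , 0) ∷ (0 , 1) ∷ (0 , 2) ∷ (0 , 3) ∷ (0 , 4) ∷ (1 , 0) ∷ (1 , 1) ∷ (1 , 2) ∷ (1 , 3) ∷ (1 , 4) ∷ []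

  -- Modulo 5 the triangle `T₀` becomes 3, 2, 0, and its ten images are the ten triangles of K₅.
  -- These clauses leave the twelve colourings by two complementary 5-cycles.
  K₅-clause : ℕ × ℕ → Clause
  K₅-clause (t , m) = index t m , index (t + 69) (m + 53 ^ t * 589) , index (t + 147) (m + 53 ^ t * 196)

  K₅-sound : ∀ g → nae-at α (K₅-clause g)
  K₅-sound (t , m) = trans (cong₃ nae (α-edge t m) (α-edge (t + 69) (m + 53 ^ t * 589)) (α-edge (t + 147) (m + 53 ^ t * 196)))
    (K.nae-◃ T₀ (nae-triangle 0 69 147 refl refl) t m)
    where
    cong₃ : ∀ {a a′ b b′ c c′ : Bool} (f : Bool → Bool → Bool → Bool) → a ≡ a′ → b ≡ b′ → c ≡ c′ → f a b c ≡ f a′ b′ c′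
    cong₃ f refl refl refl = refl

  -- Each entry names two positions in `apex` and the edge `(t , m)` that joins the vertices there;
  -- with the last vertex they form a triangle.
  apex-edges : List ((ℕ × ℕ) × (ℕ × ℕ))
  apex-edges =
    ((0 , 2) , (114 , 13)) ∷ ((0 , 7) , (152 , 27)) ∷ ((0 , 3) , (35 , 464)) ∷ ((0 , 10) , (71 , 284)) ∷ ((2 , 1) , (130 , 564)) ∷
    ((2 , 6) , (50 , 644)) ∷ ((7 , 1) , (3 , 578)) ∷ ((7 , 6) , (23 , 658)) ∷ ((7 , 9) , (129 , 0)) ∷ ((3 , 4) , (118 , 566)) ∷
    ((3 , 1) , (24 , 230)) ∷ ((4 , 5) , (110 , 642)) ∷ ((4 , 6) , (3 , 738)) ∷ ((5 , 1) , (45 , 306)) ∷ ((5 , 8) , (150 , 418)) ∷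
    ((5 , 10) , (3 , 34)) ∷ ((5 , 9) , (82 , 513)) ∷ ((6 , 8) , (132 , 514)) ∷ ((6 , 10) , (110 , 130)) ∷ []

  apex-edge : (ℕ × ℕ) × (ℕ × ℕ) → Set
  apex-edge ((i , j) , (t , m)) = (apex at i ≡ vertex 393 t m) × (apex at j ≡ vertex 392 t m) × (adjacent (apex at i) 785 ≡ true) × (adjacent (apex at j) 785 ≡ true)

  apex-edges-ok : All apex-edge apex-edges
  apex-edges-ok = toWitness {a? = All.all? (λ ((i , j) , (t , m)) →
    (apex at i ℕₚ.≟ vertex 393 t m) ×-dec (apex at j ℕₚ.≟ vertex 392 t m) ×-dec (adjacent (apex at i) 785 ≟ true) ×-dec (adjacent (apex at j) 785 ≟ true)) apex-edges} tt

  apex-clause : (ℕ × ℕ) × (ℕ × ℕ) → Clause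
  apex-clause ((i , j) , (t , m)) = index t m , 10 + i , 10 + j

  apex-sound : ∀ {g} → apex-edge g → nae-at α (apex-clause g)
  apex-sound {(i , j) , (t , m)} (i≡ , j≡ , i-785 , j-785) = subst (λ b → nae b (pair (apex at i) 785) (pair (apex at j) 785) ≡ true) (sym (α-edge t m))
    (subst₂ (λ v w → nae (pair (vertex 393 t m) (vertex 392 t m)) (pair v 785) (pair w 785) ≡ true) (sym i≡) (sym j≡)
      (nae-adjacent (vertex 393 t m) (vertex 392 t m) 785 (vertex< 393 t m) (vertex< 392 t m) ℕₚ.≤-refl
        (adjacent-edge 393 392 0 refl t m) (subst (λ v → adjacent v 785 ≡ true) i≡ i-785) (subst (λ v → adjacent v 785 ≡ true) j≡ j-785)))

  clauses : List Clause
  clauses = map K₅-clause K₅-edges ++ map apex-clause apex-edges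

  contradictory : ⊥
  -- There are 21 variables: 10 edges of K₅ and 11 edges at the last vertex.
  contradictory = refutes-sound {α} clauses (++⁺ {P = nae-at α} (map⁺ {P = nae-at α} {f = K₅-clause} K₅-ok) (map⁺ {P = nae-at α} {f = apex-clause} apex-ok)) 21 {[]} (λ i ()) refl
    where
    K₅-ok : All (nae-at α ∘ K₅-clause) K₅-edges
    K₅-ok = All.universal K₅-sound K₅-edges
    apex-ok : All (nae-at α ∘ apex-clause) apex-edges
    apex-ok = All.map (λ {g} → apex-sound {g}) apex-edges-ok

theorem3 : Σ (SimpleGraph 786) (λ G → (¬ ContainsK4 G) × Arrows33 G)
-- The argument refutes the absence of a monochromatic triangle; as the search is finite, this
-- yields a triangle.
theorem3 = G₇₈₆ , K₄-free , λ col → decidable-stable (MonoTriangle? G₇₈₆ col) (Coloured.contradictory col)
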